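{- Let $r\ge2$. Suppose $k_1,k_2,\dots,k_r$ are positive integers, all congruent to $1$ modulo $q-1$, such that $k_1+k_2+\cdots+k_r<1+q+\cdots+q^{r-1}$. Then $\det[\mathcal E_{k_1}\ \mathcal E_{k_2}\ \cdots\ \mathcal E_{k_r}]=0$ identically on $\Omega^r$, where $\mathcal E_k$ denotes the vectorial Eisenstein series of weight $k$ on $\Omega^r$.
   Context: Let $\mathbb{F}_q$ be the finite field with $q$ elements, $A=\mathbb{F}_q[\theta]$, $K_\infty=\mathbb{F}_q((\theta^{ -1}))$, and $\mathbb{C}_\infty$ the completion of an algebraic closure of $K_\infty$, with absolute value normalized by $|\theta|=q$. $\mathbb{T}$ is the Tate algebra, the completion of $\mathbb{C}_\infty[t]$ for the Gauss norm $\|\sum f_it^i\|=\max|f_i|$. Let $\chi_t:A\to\mathbb{F}_q[t]\subset\mathbb{T}$ be the $\mathbb{F}_q$-algebra map $\theta\mapsto t$, and $\rho_t$ its entrywise extension to column vectors over $A$. $\Omega^r$ is the set of row vectors $\bm z=(z_r,z_{r-1},\dots,z_1)\in\mathbb{C}_\infty^r$ with $z_1=1$ and $z_1,\dots,z_r$ linearly independent over $K_\infty$. For a positive integer $k$, the vectorial Eisenstein series $\mathcal E_k:\Omega^r\to\mathbb{T}^r$ is $\mathcal E_k(\bm z)=\sum_{0\ne\bm a\in A^r}(\bm z\bm a)^{ -k}\rho_t(\bm a)$, where $A^r$ and $\mathbb{T}^r$ consist of column vectors. The series converge in $\mathbb{T}^r$. -}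

module Defs where

open import Level using (Level; _⊔_) renaming (suc to lsuc)
open import Algebra.Bundles using (CommutativeRing; RawRing)
open import Algebra.Core using (Op₁)
open import Algebra.Morphism.Structures using (module RingMorphisms)
import Algebra.Definitions.RawMonoid as RawMonoidDefs
import Algebra.Definitions.RawSemiring as RawSemiringDefs
import Algebra.Properties.Group as GroupProperties
import Algebra.Properties.Ring as RingProperties
import Algebra.Properties.Semiring.Exp as SemiringExp
import Algebra.Properties.Semiring.Sum as SemiringSum
open import Data.Fin.Base using (Fin; zero; suc; toℕ; punchIn)
open import Data.List.Base as List using (List; []; _∷_)
import Data.List.Membership.Setoid as Membership
import Data.List.Relation.Binary.Subset.Setoid as Subset
import Data.List.Relation.Unary.Unique.Setoid as Uniqueness
open import Data.Nat.Base as ℕ using (ℕ; zero; suc; _∸_)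
import Data.Nat.Properties as ℕ
open import Data.Product.Base using (Σ; ∃-syntax; _×_; _,_; proj₁)
open import Data.Rational.Base as ℚ using (ℚ; 0ℚ; 1ℚ)
import Data.Rational.Properties as ℚ
open import Data.Sum.Base using (_⊎_; inj₁; inj₂)
open import Data.Vec.Functional using (Vector)
open import Function.Bundles using (Inverse)
open import Relation.Binary.Bundles using (Setoid)
open import Relation.Binary.Construct.Add.Infimum.NonStrict ℚ._≤_
  using (_≤₋_; ⊥₋≤_; [_]; ≤₋-trans; ≤₋-reflexive-≡)
open import Relation.Binary.Definitions using (tri<; tri≈; tri>)
open import Relation.Binary.PropositionalEquality as ≡ using (_≡_)
open import Relation.Nullary.Negation using (¬_; contradiction)
open import Relation.Nullary.Construct.Add.Infimum using (_₋; ⊥₋; [_])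

open RawMonoidDefs ℕ.+-0-rawMonoid public using () renaming (sum to sumℕ)

-- The value of _⁻¹ at 0 is unconstrained.
record Field c ℓ : Set (lsuc (c ⊔ ℓ)) where
  infix 9 _⁻¹
  field
    commutativeRing : CommutativeRing c ℓ
  open CommutativeRing commutativeRing public
  open SemiringExp semiring public using (_^_)
  open SemiringSum semiring public using (sum)
  field
    _⁻¹      : Op₁ Carrier
    ⁻¹-cong  : ∀ {x y} → x ≈ y → x ⁻¹ ≈ y ⁻¹
    inverseʳ : ∀ {x} → x ≉ 0# → x * x ⁻¹ ≈ 1#
    0≉1      : 0# ≉ 1#

record FiniteField c ℓ : Set (lsuc (c ⊔ ℓ)) where
  field
    fieldStructure : Field c ℓ
  open Field fieldStructure public
  field
    q           : ℕ
    enumeration : Inverse (≡.setoid (Fin q)) setoid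

------------------------------------------------------------------------

module Determinant {c ℓ} (R : RawRing c ℓ) where
  open RawRing R
  open RawSemiringDefs rawSemiring using (_^_; sum)

  -- M i j is the entry in row i and column j; Laplace expansion along the
  -- first row.
  det : ∀ {n} → (Fin n → Fin n → Carrier) → Carrier
  det {zero}  M = 1#
  det {suc n} M = sum λ j →
    (- 1#) ^ toℕ j * (M zero j * det (λ i l → M (suc i) (punchIn j l)))

------------------------------------------------------------------------

infixl 6 _+₋_
_+₋_ : ℚ ₋ → ℚ ₋ → ℚ ₋
⊥₋    +₋ _     = ⊥₋
[ _ ] +₋ ⊥₋    = ⊥₋
[ d ] +₋ [ e ] = [ d ℚ.+ e ]

-- A field ℂ∞ as in "the completion of an algebraic closure of K∞", which
-- determines it up to isometric isomorphism.  The absolute value is recorded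
-- through its logarithm to base q, with log 0 = -∞ written ⊥₋; no real numbers
-- are needed because the nonzero absolute values on ℂ∞ are exactly the rational
-- powers of q.
record CompletedClosure {c₁ ℓ₁} (𝔽 : FiniteField c₁ ℓ₁) c ℓ
       : Set (c₁ ⊔ ℓ₁ ⊔ lsuc (c ⊔ ℓ)) where
  private module 𝔽 = FiniteField 𝔽
  field
    fieldStructure : Field c ℓ
  open Field fieldStructure public
  open RingMorphisms 𝔽.rawRing rawRing using (IsRingHomomorphism)
  field
    ι                  : 𝔽.Carrier → Carrier
    ι-isRingHomomorphism : IsRingHomomorphism ι
    θ                  : Carrier

    log∣_∣   : Carrier → ℚ ₋
    log-cong : ∀ {x y} → x ≈ y → log∣ x ∣ ≡ log∣ y ∣
    log-0    : log∣ 0# ∣ ≡ ⊥₋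
    log-⊥    : ∀ {x} → log∣ x ∣ ≡ ⊥₋ → x ≈ 0#
    log-*    : ∀ x y → log∣ x * y ∣ ≡ log∣ x ∣ +₋ log∣ y ∣
    log-+    : ∀ {x y e} → log∣ x ∣ ≤₋ e → log∣ y ∣ ≤₋ e → log∣ x + y ∣ ≤₋ e
    log-θ    : log∣ θ ∣ ≡ [ 1ℚ ]

  -- |x| ≤ qᵉ
  infix 4 ∣_∣≤q^_
  ∣_∣≤q^_ : Carrier → ℚ → Set
  ∣ x ∣≤q^ e = log∣ x ∣ ≤₋ [ e ]

  TendsToZero : (ℕ → Carrier) → Set
  TendsToZero s = ∀ e → ∃[ N ] ∀ n → N ℕ.≤ n → ∣ s n ∣≤q^ e

  infix 4 _⟶_
  _⟶_ : (ℕ → Carrier) → Carrier → Set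
  s ⟶ x = TendsToZero (λ n → s n - x)

  IsCauchy : (ℕ → Carrier) → Set
  IsCauchy s = ∀ e → ∃[ N ] ∀ m n → N ℕ.≤ m → N ℕ.≤ n → ∣ s m - s n ∣≤q^ e

  -- The subfield K∞ = 𝔽q((θ⁻¹)): the sums of Laurent series Σᵢ aᵢ θᴺ⁻ⁱ.
  InK∞ : Carrier → Set c₁
  InK∞ x = ∃[ N ] Σ (ℕ → 𝔽.Carrier) λ a →
    (λ n → sum {n} λ i → ι (a (toℕ i)) * (θ ^ N * (θ ⁻¹) ^ toℕ i)) ⟶ x

  -- xⁿ + Σ_{i<n} aᵢ xⁱ
  evalMonic : ∀ {n} → Vector Carrier n → Carrier → Carrier
  evalMonic {n} a x = x ^ n + sum λ i → a i * x ^ toℕ i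

  AlgebraicOverK∞ : Carrier → Set (c₁ ⊔ c ⊔ ℓ)
  AlgebraicOverK∞ x =
    ∃[ n ] Σ (Vector Carrier n) λ a → (∀ i → InK∞ (a i)) × evalMonic a x ≈ 0#

  -- The elements algebraic over K∞ form an algebraic closure of K∞, they are
  -- dense, and every Cauchy sequence converges.
  field
    algebraicallyClosed : ∀ {n} (a : Vector Carrier (suc n)) →
      (∀ i → AlgebraicOverK∞ (a i)) →
      ∃[ x ] AlgebraicOverK∞ x × evalMonic a x ≈ 0#
    dense    : ∀ x e → ∃[ y ] AlgebraicOverK∞ y × ∣ x - y ∣≤q^ e
    complete : ∀ s → IsCauchy s → ∃[ x ] s ⟶ x

------------------------------------------------------------------------

module _ {c₁ ℓ₁ c ℓ} (𝔽 : FiniteField c₁ ℓ₁) (ℂ∞ : CompletedClosure 𝔽 c ℓ) where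
  private module 𝔽 = FiniteField 𝔽
  open CompletedClosure ℂ∞ hiding (zero)

  module Estimates where
    private module R = RingProperties ring

    ≤-lift : ∀ {d e} → d ℚ.≤ e → [ d ] ≤₋ [ e ]
    ≤-lift = [_]

    ∣∣-cong : ∀ {x y e} → x ≈ y → ∣ x ∣≤q^ e → ∣ y ∣≤q^ e
    ∣∣-cong x≈y = ≡.subst (_≤₋ _) (log-cong x≈y)

    ∣∣-mono : ∀ {x d e} → d ℚ.≤ e → ∣ x ∣≤q^ d → ∣ x ∣≤q^ e
    ∣∣-mono d≤e p = ≤₋-trans ℚ.≤-trans p (≤-lift d≤e)

    ∣0∣≤ : ∀ {e} → ∣ 0# ∣≤q^ e
    ∣0∣≤ {e} = ≡.subst (_≤₋ [ e ]) (≡.sym log-0) (⊥₋≤ _)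

    +₋-mono : ∀ {u v d e} → u ≤₋ [ d ] → v ≤₋ [ e ] → u +₋ v ≤₋ [ d ℚ.+ e ]
    +₋-mono (⊥₋≤ _) _        = ⊥₋≤ _
    +₋-mono [ _ ]   (⊥₋≤ _)  = ⊥₋≤ _
    +₋-mono [ p ]   [ r ]    = [ ℚ.+-mono-≤ p r ]

    ∣*∣≤ : ∀ {x y d e} → ∣ x ∣≤q^ d → ∣ y ∣≤q^ e → ∣ x * y ∣≤q^ d ℚ.+ e
    ∣*∣≤ {x} {y} p r = ≡.subst (_≤₋ _) (≡.sym (log-* x y)) (+₋-mono p r)

    ∣sum∣≤ : ∀ {e n} (v : Vector Carrier n) → (∀ i → ∣ v i ∣≤q^ e) → ∣ sum v ∣≤q^ e
    ∣sum∣≤ {n = zero}  v p = ∣0∣≤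
    ∣sum∣≤ {n = suc n} v p = log-+ (p zero) (∣sum∣≤ (λ i → v (suc i)) (λ i → p (suc i)))

    double≡0 : ∀ d → d ℚ.+ d ≡ 0ℚ → d ≡ 0ℚ
    double≡0 d eq with ℚ.<-cmp d 0ℚ
    ... | tri< d<0 _ _ = contradiction eq (ℚ.<⇒≢ (ℚ.+-mono-< d<0 d<0))
    ... | tri≈ _ d≡0 _ = d≡0
    ... | tri> _ _ 0<d = contradiction (≡.sym eq) (ℚ.<⇒≢ (ℚ.+-mono-< 0<d 0<d))

    idem≡0 : ∀ d → d ≡ d ℚ.+ d → d ≡ 0ℚ
    idem≡0 d eq = GroupProperties.identityʳ-unique ℚ.+-0-group d d (≡.sym eq)

    log-1 : log∣ 1# ∣ ≡ [ 0ℚ ]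
    log-1 = go log∣ 1# ∣ ≡.refl (≡.trans (log-cong (sym (*-identityˡ 1#))) (log-* 1# 1#))
      where
      go : ∀ u → log∣ 1# ∣ ≡ u → log∣ 1# ∣ ≡ log∣ 1# ∣ +₋ log∣ 1# ∣ → log∣ 1# ∣ ≡ [ 0ℚ ]
      go ⊥₋    eq _ = contradiction (sym (log-⊥ eq)) 0≉1
      go [ d ] eq h rewrite eq = ≡.cong [_] (idem≡0 d (just-inj h))
        where
        just-inj : ∀ {a b : ℚ} → _≡_ {A = ℚ ₋} [ a ] [ b ] → a ≡ b
        just-inj ≡.refl = ≡.refl

    log-neg1 : log∣ - 1# ∣ ≡ [ 0ℚ ]
    log-neg1 = go log∣ - 1# ∣ ≡.refl (≡.trans (≡.sym (log-* (- 1#) (- 1#)))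
                 (≡.trans (log-cong (trans (R.-1*x≈-x (- 1#)) (R.-‿involutive 1#))) log-1))
      where
      go : ∀ u → log∣ - 1# ∣ ≡ u → log∣ - 1# ∣ +₋ log∣ - 1# ∣ ≡ [ 0ℚ ] → log∣ - 1# ∣ ≡ [ 0ℚ ]
      go ⊥₋    eq h rewrite eq = contradiction h λ ()
      go [ d ] eq h rewrite eq = ≡.cong [_] (double≡0 d (just-inj h))
        where
        just-inj : ∀ {a b : ℚ} → _≡_ {A = ℚ ₋} [ a ] [ b ] → a ≡ b
        just-inj ≡.refl = ≡.refl

    ∣-∣≤ : ∀ {x e} → ∣ x ∣≤q^ e → ∣ - x ∣≤q^ e
    ∣-∣≤ {x} {e} p = ∣∣-cong (R.-1*x≈-x x)
      (≡.subst (∣ - 1# * x ∣≤q^_) (ℚ.+-identityˡ e)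
        (∣*∣≤ (≤₋-reflexive-≡ ℚ.≤-reflexive log-neg1) p))

    bound : ∀ x → ∃[ e ] ∣ x ∣≤q^ e
    bound x with log∣ x ∣
    ... | ⊥₋    = 0ℚ , ⊥₋≤ _
    ... | [ d ] = d , ≤-lift ℚ.≤-refl

  open Estimates

  ----------------------------------------------------------------------

  -- The completion of ℂ∞[t] for the Gauss norm, realised as the power series
  -- Σ fₙ tⁿ with fₙ → 0.
  𝕋 : Set c
  𝕋 = Σ (ℕ → Carrier) TendsToZero

  coefficient : 𝕋 → ℕ → Carrier
  coefficient = proj₁

  infix 4 _≈ᵀ_
  _≈ᵀ_ : 𝕋 → 𝕋 → Set ℓ
  f ≈ᵀ g = ∀ n → coefficient f n ≈ coefficient g n

  -- max |fₙ| ≤ qᵉ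
  infix 4 ‖_‖≤q^_
  ‖_‖≤q^_ : 𝕋 → ℚ → Set
  ‖ f ‖≤q^ e = ∀ n → ∣ coefficient f n ∣≤q^ e

  module Boundedness where
    boundedInit : ∀ (f : ℕ → Carrier) N → ∃[ b ] ∀ n → n ℕ.< N → ∣ f n ∣≤q^ b
    boundedInit f zero = 0ℚ , λ _ ()
    boundedInit f (suc N) with boundedInit f N | bound (f N)
    ... | b , hb | b′ , hb′ = b ℚ.⊔ b′ , λ n n<1+N → go n (ℕ.m≤n⇒m<n∨m≡n (ℕ.s≤s⁻¹ n<1+N))
      where
      go : ∀ n → n ℕ.< N ⊎ n ≡ N → ∣ f n ∣≤q^ b ℚ.⊔ b′
      go n (inj₁ n<N)    = ∣∣-mono (ℚ.p≤p⊔q b b′) (hb n n<N)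
      go n (inj₂ ≡.refl) = ∣∣-mono (ℚ.p≤q⊔p b b′) hb′

    bounded : ∀ (f : 𝕋) → ∃[ b ] ‖ f ‖≤q^ b
    bounded (f , f→0) with f→0 0ℚ
    ... | N , h with boundedInit f N
    ... | b , hb = b ℚ.⊔ 0ℚ , λ n → go n (ℕ.<-≤-connex n N)
      where
      go : ∀ n → n ℕ.< N ⊎ N ℕ.≤ n → ∣ f n ∣≤q^ b ℚ.⊔ 0ℚ
      go n (inj₁ n<N) = ∣∣-mono (ℚ.p≤p⊔q b 0ℚ) (hb n n<N)
      go n (inj₂ N≤n) = ∣∣-mono (ℚ.p≤q⊔p b 0ℚ) (h n N≤n)

    cancel : ∀ e b → (e ℚ.- b) ℚ.+ b ≡ e
    cancel e b = ≡.trans (ℚ.+-assoc e (ℚ.- b) b)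
      (≡.trans (≡.cong (e ℚ.+_) (ℚ.+-inverseˡ b)) (ℚ.+-identityʳ e))

    cancel′ : ∀ e b → b ℚ.+ (e ℚ.- b) ≡ e
    cancel′ e b = ≡.trans (ℚ.+-comm b _) (cancel e b)

  open Boundedness

  0ᵀ : 𝕋
  0ᵀ = (λ _ → 0#) , λ e → 0 , λ _ _ → ∣0∣≤

  1ᵀ : 𝕋
  1ᵀ = one , λ e → 1 , λ { (suc n) _ → ∣0∣≤ }
    where
    one : ℕ → Carrier
    one zero    = 1#
    one (suc n) = 0#

  infixl 6 _+ᵀ_ _-ᵀ_
  infixl 7 _*ᵀ_ _•_
  infix  8 -ᵀ_

  _+ᵀ_ : 𝕋 → 𝕋 → 𝕋
  (f , f→0) +ᵀ (g , g→0) = (λ n → f n + g n) , λ e →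
    let (M , hf) = f→0 e ; (N , hg) = g→0 e in
    M ℕ.⊔ N , λ n h → log-+ (hf n (ℕ.m⊔n≤o⇒m≤o M N h)) (hg n (ℕ.m⊔n≤o⇒n≤o M N h))

  -ᵀ_ : 𝕋 → 𝕋
  -ᵀ (f , f→0) = (λ n → - f n) , λ e →
    let (N , hf) = f→0 e in N , λ n h → ∣-∣≤ (hf n h)

  _-ᵀ_ : 𝕋 → 𝕋 → 𝕋
  f -ᵀ g = f +ᵀ (-ᵀ g)

  _•_ : Carrier → 𝕋 → 𝕋
  x • (f , f→0) = (λ n → x * f n) , λ e →
    let (b , hx) = bound x ; (N , hf) = f→0 (e ℚ.- b) in
    N , λ n h → ≡.subst (∣ x * f n ∣≤q^_) (cancel′ e b) (∣*∣≤ hx (hf n h))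

  _*ᵀ_ : 𝕋 → 𝕋 → 𝕋
  _*ᵀ_ F@(f , f→0) G@(g , g→0) = product , product→0
    where
    product : ℕ → Carrier
    product n = sum {suc n} λ i → f (toℕ i) * g (n ∸ toℕ i)

    product→0 : TendsToZero product
    product→0 e =
      let (b  , hf)  = bounded F
          (b′ , hg)  = bounded G
          (M  , hf′) = f→0 (e ℚ.- b′)
          (N  , hg′) = g→0 (e ℚ.- b)
          term : ∀ n → M ℕ.+ N ℕ.≤ n → ∀ i → M ℕ.≤ i ⊎ i ℕ.< M → ∣ f i * g (n ∸ i) ∣≤q^ e
          term n h i = λ
            { (inj₁ M≤i) → ≡.subst (∣ f i * g (n ∸ i) ∣≤q^_) (cancel e b′)
                (∣*∣≤ (hf′ i M≤i) (hg (n ∸ i)))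
            ; (inj₂ i<M) → ≡.subst (∣ f i * g (n ∸ i) ∣≤q^_) (cancel′ e b)
                (∣*∣≤ (hf i) (hg′ (n ∸ i) (ℕ.≤-trans
                  (ℕ.≤-reflexive (≡.sym (ℕ.m+n∸m≡n M N)))
                  (ℕ.∸-mono h (ℕ.<⇒≤ i<M)))))
            }
      in M ℕ.+ N , λ n h → ∣sum∣≤ {n = suc n} _ λ i → term n h (toℕ i) (ℕ.≤-<-connex M (toℕ i))

  𝕋-rawRing : RawRing c ℓ
  𝕋-rawRing = record
    { Carrier = 𝕋 ; _≈_ = _≈ᵀ_ ; _+_ = _+ᵀ_ ; _*_ = _*ᵀ_ ; -_ = -ᵀ_ ; 0# = 0ᵀ ; 1# = 1ᵀ }

  ----------------------------------------------------------------------

  -- 𝔽q[θ]: lists of coefficients, constant term first; _≈ᴬ_ identifies lists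
  -- differing by trailing zeros.
  A : Set c₁
  A = List 𝔽.Carrier

  coeff : A → ℕ → 𝔽.Carrier
  coeff []      _       = 𝔽.0#
  coeff (x ∷ _) zero    = x
  coeff (_ ∷ a) (suc n) = coeff a n

  infix 4 _≈ᴬ_
  _≈ᴬ_ : A → A → Set ℓ₁
  a ≈ᴬ b = ∀ n → coeff a n 𝔽.≈ coeff b n

  evalθ : A → Carrier
  evalθ []      = 0#
  evalθ (x ∷ a) = ι x + θ * evalθ a

  -- θ ↦ t, so the coefficients are unchanged.
  χₜ : A → 𝕋
  χₜ a = (λ n → ι (coeff a n)) , λ e → List.length a , λ n h → vanish e a n h
    where
    open RingMorphisms.IsRingHomomorphism ι-isRingHomomorphism using (0#-homo)
    vanish : ∀ e a n → List.length a ℕ.≤ n → ∣ ι (coeff a n) ∣≤q^ e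
    vanish e []      n       _         = ∣∣-cong (sym 0#-homo) ∣0∣≤
    vanish e (_ ∷ a) (suc n) (ℕ.s≤s h) = vanish e a n h

  NonzeroVector : ℕ → Set (c₁ ⊔ ℓ₁)
  NonzeroVector r = Σ (Vector A r) λ a → ¬ (∀ i → a i ≈ᴬ [])

  nonzeroVectors : ℕ → Setoid (c₁ ⊔ ℓ₁) ℓ₁
  nonzeroVectors r = record
    { Carrier       = NonzeroVector r
    ; _≈_           = λ a b → ∀ i → proj₁ a i ≈ᴬ proj₁ b i
    ; isEquivalence = record
      { refl  = λ _ _ → 𝔽.refl
      ; sym   = λ p i n → 𝔽.sym (p i n)
      ; trans = λ p p′ i n → 𝔽.trans (p i n) (p′ i n)
      }
    }

  ----------------------------------------------------------------------

  -- s is the limit of the net of partial sums over finite subsets of I; a finite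
  -- subset is a list without repetitions.
  module _ {i ℓᵢ} (I : Setoid i ℓᵢ) where
    private module I = Setoid I
    open Subset I using (_⊆_)
    open Uniqueness I using (Unique)

    HasSum : ∀ {r} → (I.Carrier → Vector 𝕋 r) → Vector 𝕋 r → Set (i ⊔ ℓᵢ)
    HasSum f s = ∀ e → ∃[ S₀ ] ∀ S → Unique S → S₀ ⊆ S → ∀ j →
      ‖ List.foldr _+ᵀ_ 0ᵀ (List.map (λ a → f a j) S) -ᵀ s j ‖≤q^ e

  ----------------------------------------------------------------------

  -- The vector (z_r , … , z_1): position i : Fin r holds z_{r-i}.
  record InΩ {r} (z : Vector Carrier r) : Set (c₁ ⊔ c ⊔ ℓ) where
    field
      z₁≈1        : ∀ i → suc (toℕ i) ≡ r → z i ≈ 1#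
      independent : ∀ (x : Vector Carrier r) → (∀ i → InK∞ (x i)) →
                    sum (λ i → x i * z i) ≈ 0# → ∀ i → x i ≈ 0#

  pairing : ∀ {r} → Vector Carrier r → Vector A r → Carrier
  pairing z a = sum λ i → z i * evalθ (a i)

  -- "E is the value at z of the Eisenstein series of weight k".  A relation,
  -- because a limit is only determined up to the equality of 𝕋, and its
  -- existence for z ∈ Ωʳ rests on the compactness of the unit sphere of K∞ʳ,
  -- which is not available constructively.
  IsEisenstein : ∀ {r} → ℕ → Vector Carrier r → Vector 𝕋 r → Set (c₁ ⊔ ℓ₁)
  IsEisenstein {r} k z E = HasSum (nonzeroVectors r)
    (λ (a , _) j → ((pairing z a) ⁻¹) ^ k • χₜ (a j)) E

  open Determinant 𝕋-rawRing public using () renaming (det to detᵀ)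

{-# OPTIONS --safe #-}

-- Restrict the sum defining ℰₖ to the finite 𝔽q-space V of vectors a with entries
-- of degree less than d.  Write λ = z a and let e(X) = Σ eᵢ X^(qⁱ) be the
-- polynomial with zero set z V, so that e₀ ≠ 0.  Multiplying e(λ) = 0 by
-- λ^(-k-1) a and summing over V gives a relation between the truncated series of
-- weights k + 1 - qⁱ ≤ k and the sums Σ λ^(qⁱ-1-k) a with qⁱ > k.  As a function on
-- V the coordinates of λ^(qⁱ-1-k) a are products of linear forms, one more in
-- number than the digit sum of qⁱ - 1 - k to base q; unless k is a power of q this
-- is less than (q - 1) dim V and the sum vanishes.  Hence every truncated ℰₖ is a
-- combination of the truncated ℰ_(q^l) with q^l ≤ k.
--
-- Expand the determinant of the truncated series accordingly.  Distinct exponents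
-- l₁, …, l_r would give Σ kⱼ ≥ Σ q^(lⱼ) ≥ 1 + q + ⋯ + q^(r-1), so in each term two
-- columns agree, and the determinant vanishes for every d; by continuity it
-- vanishes in the limit.

module Submission where

open import Defs
open import Level using (Level; _⊔_; 0ℓ) renaming (suc to lsuc)
open import Algebra.Bundles using (CommutativeMonoid; CommutativeRing)
open import Algebra.Morphism.Structures using (module RingMorphisms)
import Algebra.Properties.CommutativeMonoid.Sum as CommutativeMonoidSum
import Algebra.Properties.CommutativeSemiring.Binomial as Binomial
import Algebra.Properties.CommutativeSemiring.Exp as CommutativeSemiringExp
import Algebra.Properties.Ring as RingProperties
import Algebra.Properties.Semiring.Exp as SemiringExp
import Algebra.Properties.Semiring.Mult as SemiringMult
import Algebra.Properties.Semiring.Sum as SemiringSum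
import Algebra.Solver.Ring.NaturalCoefficients.Default as SemiringSolver
open import Data.Fin.Base as Fin
  using (Fin; zero; suc; toℕ; punchIn; punchOut; inject₁; fromℕ; fromℕ<)
open import Data.Fin.Permutation using (permutation)
import Data.Fin.Properties as Fin
open import Data.List.Base as List using (List; []; _∷_; length; replicate; _++_)
import Data.List.Membership.Setoid as Membership
import Data.List.Membership.Setoid.Properties as MembershipProperties
import Data.List.Properties as List
import Data.List.Relation.Unary.All as ListAll
import Data.List.Relation.Unary.AllPairs as AllPairs
open import Data.List.Relation.Unary.Any using (here; there)
import Data.List.Relation.Unary.Unique.Setoid as Uniqueness
import Data.List.Relation.Unary.Unique.Setoid.Properties as Unique
open import Data.Nat.Base as ℕ using (ℕ; zero; suc; z≤n; s≤s; _∸_)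
open import Data.Nat.Combinatorics as ℕ using (nCn≡1; nCk≡nC[n∸k])
open import Data.Nat.Divisibility using (_∣_)
open import Data.Nat.DivMod using (_/_; _%_; m≡m%n+[m/n]*n; m%n<n; m<n*o⇒m/o<n)
open import Data.Nat.Induction using (<-rec)
import Data.Nat.Properties as ℕ
open import Data.Nat.Solver using (module +-*-Solver)
open import Data.Product.Base using (Σ; ∃-syntax; _×_; _,_; proj₁; proj₂)
open import Data.Rational.Base as ℚ using (ℚ; 0ℚ; 1ℚ)
import Data.Rational.Properties as ℚ
open import Data.Sum.Base using (_⊎_; inj₁; inj₂)
open import Data.Vec.Base as Vec using (Vec; []; _∷_)
open import Data.Vec.Functional using (Vector; updateAt)
open import Data.Vec.Functional.Properties using (updateAt-updates; updateAt-minimal)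
import Data.Vec.Properties as VecProperties
import Data.Vec.Relation.Binary.Equality.Setoid as VecEquality
open import Data.Vec.Relation.Binary.Pointwise.Inductive as Pointwise using (Pointwise; []; _∷_)
open import Data.Vec.Relation.Unary.All as All using (All; []; _∷_)
import Data.Vec.Relation.Unary.All.Properties as AllProperties
open import Function.Base using (const; _∘_)
open import Function.Bundles using (Inverse)
open import Relation.Binary.Bundles using (Setoid)
open import Relation.Binary.Construct.Add.Infimum.NonStrict ℚ._≤_
  using (_≤₋_; ⊥₋≤_; [_]; [≤]-injective)
open import Relation.Binary.Definitions using (Decidable; tri<; tri≈; tri>)
open import Relation.Binary.PropositionalEquality as ≡ using (_≡_; _≢_)
import Relation.Binary.Reasoning.Setoid as SetoidReasoning
open import Relation.Nullary using (¬_; Dec; yes; no; contradiction)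
open import Relation.Nullary.Construct.Add.Infimum using (_₋; ⊥₋; [_])
import Relation.Nullary.Decidable as Dec
open import Relation.Nullary.Decidable using (_×-dec_; ¬?)

-- Determinants

-- Why few factors make the sum vanish: in a product of fewer than (q - 1) D linear forms on the
-- D-dimensional space V, every monomial has some variable with exponent s < q - 1, and the sum of
-- xˢ over 𝔽q is 0 for such s. This is the mechanism of the Chevalley-Warning theorem. Why powers of
-- q are the exceptions: if k has digit sum s to base q, the digits of qⁱ - 1 - k are complementary
-- to those of k and add up to i (q - 1) - s. With the factor a there are i (q - 1) - s + 1 linear
-- forms, and i is at most D, so the bound holds as soon as s is at least 2. A positive k with s < 2
-- is a power of q. Why a finite V: e is then a polynomial and the relation between the truncated
-- series is an exact identity, with coefficients independent of the coordinate of a. It is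
-- therefore a relation between columns, and analysis enters only in the last passage to the limit.

punchIn-adjacent : ∀ {n} (j : Fin (suc (suc n))) (p : Fin (suc n)) →
  j ≢ inject₁ p → j ≢ suc p →
  ∃[ p′ ] punchIn j (inject₁ p′) ≡ inject₁ p × punchIn j (suc p′) ≡ suc p
punchIn-adjacent zero zero h _ = contradiction ≡.refl h
punchIn-adjacent {suc n} zero (suc p) _ _ = p , ≡.refl , ≡.refl
punchIn-adjacent (suc zero) zero _ h = contradiction ≡.refl h
punchIn-adjacent {suc n} (suc (suc j)) zero _ _ = zero , ≡.refl , ≡.refl
punchIn-adjacent {suc n} (suc j) (suc p) h h′ =
  let (p′ , e , e′) = punchIn-adjacent j p (h ∘ ≡.cong suc) (h′ ∘ ≡.cong suc) in
  suc p′ , ≡.cong suc e , ≡.cong suc e′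

-- Two minors that drop neighbouring columns differ only where each keeps the column dropped by the
-- other; if these columns are equal, so are the minors.
punchIn-neighbours : ∀ {n} (p : Fin n) (l : Fin n) →
  punchIn (inject₁ p) l ≡ punchIn (suc p) l ⊎
  (punchIn (inject₁ p) l ≡ suc p × punchIn (suc p) l ≡ inject₁ p)
punchIn-neighbours zero zero = inj₂ (≡.refl , ≡.refl)
punchIn-neighbours zero (suc l) = inj₁ ≡.refl
punchIn-neighbours (suc p) zero = inj₁ ≡.refl
punchIn-neighbours (suc p) (suc l) with punchIn-neighbours p l
... | inj₁ e = inj₁ (≡.cong suc e)
... | inj₂ (e , e′) = inj₂ (≡.cong suc e , ≡.cong suc e′)

module DeterminantProperties {c ℓ} (R : CommutativeRing c ℓ) where
  open CommutativeRing R hiding (zero)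
  open Determinant rawRing using (det)
  open RingProperties ring
  open SemiringExp semiring using (_^_)
  open SemiringSum semiring
  open SetoidReasoning setoid

  det-cong : ∀ {n} {M N : Fin n → Fin n → Carrier} →
    (∀ i j → M i j ≈ N i j) → det M ≈ det N
  det-cong {zero} h = refl
  det-cong {suc n} h = sum-cong-≋ λ j →
    *-congˡ {x = (- 1#) ^ toℕ j} (*-cong (h zero j) (det-cong λ i l → h (suc i) (punchIn j l)))

  -- Linearity in a column has to be read off from an expansion along a row. In the term of column p
  -- the entry is linear and the minors agree; in any other term the entries agree and the minor is
  -- linear, by induction, in the column that p becomes.
  det-linear : ∀ {n} (p : Fin n) a b {M M₁ M₂ : Fin n → Fin n → Carrier} →
    (∀ i j → j ≢ p → M i j ≈ M₁ i j) → (∀ i j → j ≢ p → M i j ≈ M₂ i j) →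
    (∀ i → M i p ≈ a * M₁ i p + b * M₂ i p) →
    det M ≈ a * det M₁ + b * det M₂
  det-linear {suc n} p a b {M} {M₁} {M₂} h₁ h₂ h = begin
    sum (term M)                                           ≈⟨ sum-cong-≋ terms ⟩
    sum (λ j → a * term M₁ j + b * term M₂ j)              ≈⟨ ∑-distrib-+ (λ j → a * term M₁ j) (λ j → b * term M₂ j) ⟩
    sum (λ j → a * term M₁ j) + sum (λ j → b * term M₂ j)
      ≈⟨ +-cong (*-distribˡ-sum a (term M₁)) (*-distribˡ-sum b (term M₂)) ⟨
    a * sum (term M₁) + b * sum (term M₂)                  ∎
    where
    open SemiringSolver commutativeSemiring
    minor : (Fin (suc n) → Fin (suc n) → Carrier) → Fin (suc n) → Fin n → Fin n → Carrier
    minor N j i l = N (suc i) (punchIn j l)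
    term : (Fin (suc n) → Fin (suc n) → Carrier) → Fin (suc n) → Carrier
    term N j = (- 1#) ^ toℕ j * (N zero j * det (minor N j))
    terms : ∀ j → term M j ≈ a * term M₁ j + b * term M₂ j
    terms j with j Fin.≟ p
    ... | yes ≡.refl = begin
      s * (M zero p * det (minor M p))
        ≈⟨ *-congˡ (*-congʳ (h zero)) ⟩
      s * ((a * M₁ zero p + b * M₂ zero p) * det (minor M p))
        ≈⟨ solve 6 (λ s a x b y d → s :* ((a :* x :+ b :* y) :* d) :=
             a :* (s :* (x :* d)) :+ b :* (s :* (y :* d)))
             refl s a (M₁ zero p) b (M₂ zero p) (det (minor M p)) ⟩
      a * (s * (M₁ zero p * det (minor M p))) + b * (s * (M₂ zero p * det (minor M p)))
        ≈⟨ +-cong (*-congˡ (*-congˡ (*-congˡ (det-cong λ i l → h₁ (suc i) _ (Fin.punchInᵢ≢i p l)))))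
                  (*-congˡ (*-congˡ (*-congˡ (det-cong λ i l → h₂ (suc i) _ (Fin.punchInᵢ≢i p l))))) ⟩
      a * term M₁ p + b * term M₂ p ∎
      where s = (- 1#) ^ toℕ p
    ... | no j≢p = begin
      s * (M zero j * det (minor M j))
        ≈⟨ *-congˡ (*-congˡ (det-linear p′ a b
             (λ i l l≢p′ → h₁ (suc i) _ (away l l≢p′)) (λ i l l≢p′ → h₂ (suc i) _ (away l l≢p′))
             (λ i → ≡.subst (λ x → M (suc i) x ≈ a * M₁ (suc i) x + b * M₂ (suc i) x)
                      (≡.sym e) (h (suc i))))) ⟩
      s * (M zero j * (a * det (minor M₁ j) + b * det (minor M₂ j)))
        ≈⟨ solve 6 (λ s x a d b d′ → s :* (x :* (a :* d :+ b :* d′)) :=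
             a :* (s :* (x :* d)) :+ b :* (s :* (x :* d′)))
             refl s (M zero j) a (det (minor M₁ j)) b (det (minor M₂ j)) ⟩
      a * (s * (M zero j * det (minor M₁ j))) + b * (s * (M zero j * det (minor M₂ j)))
        ≈⟨ +-cong (*-congˡ (*-congˡ (*-congʳ (h₁ zero j j≢p))))
                  (*-congˡ (*-congˡ (*-congʳ (h₂ zero j j≢p)))) ⟩
      a * term M₁ j + b * term M₂ j ∎
      where
      s = (- 1#) ^ toℕ j
      p′ = punchOut j≢p
      e : punchIn j p′ ≡ p
      e = Fin.punchIn-punchOut j≢p
      away : ∀ l → l ≢ p′ → punchIn j l ≢ p
      away l l≢p′ e′ = l≢p′ (Fin.punchIn-injective j l p′ (≡.trans e′ (≡.sym e)))

  sum-zero : ∀ {n} {f : Fin n → Carrier} → (∀ i → f i ≈ 0#) → sum f ≈ 0#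
  sum-zero {n} h = trans (sum-cong-≋ h) (sum-replicate-zero n)

  sum-adjacent : ∀ {n} (p : Fin n) (f : Fin (suc n) → Carrier) →
    (∀ j → j ≢ inject₁ p → j ≢ suc p → f j ≈ 0#) →
    f (inject₁ p) + f (suc p) ≈ 0# → sum f ≈ 0#
  sum-adjacent zero f h e = begin
    f zero + (f (suc zero) + sum (λ j → f (suc (suc j)))) ≈⟨ +-assoc _ _ _ ⟨
    f zero + f (suc zero) + sum (λ j → f (suc (suc j)))
      ≈⟨ +-cong e (sum-zero λ j → h (suc (suc j)) (λ ()) (λ ())) ⟩
    0# + 0#                                               ≈⟨ +-identityˡ 0# ⟩
    0#                                                    ∎
  sum-adjacent (suc p) f h e = trans (+-cong (h zero (λ ()) (λ ()))
    (sum-adjacent p (f ∘ suc)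
      (λ j h₁ h₂ → h (suc j) (h₁ ∘ Fin.suc-injective) (h₂ ∘ Fin.suc-injective)) e))
    (+-identityˡ 0#)

  -- The terms of the two equal columns have equal minors and opposite signs, and in every other
  -- minor the two columns remain neighbours. Nothing is divided by 2, so characteristic 2 is
  -- covered.
  det-adjacent : ∀ {n} (p : Fin n) (M : Fin (suc n) → Fin (suc n) → Carrier) →
    (∀ i → M i (inject₁ p) ≈ M i (suc p)) → det M ≈ 0#
  det-adjacent {suc n} p M h = sum-adjacent p term others pair
    where
    minor : Fin (suc (suc n)) → Fin (suc n) → Fin (suc n) → Carrier
    minor j i l = M (suc i) (punchIn j l)
    term : Fin (suc (suc n)) → Carrier
    term j = (- 1#) ^ toℕ j * (M zero j * det (minor j))
    others : ∀ j → j ≢ inject₁ p → j ≢ suc p → term j ≈ 0#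
    others j h₁ h₂ =
      let (p′ , e , e′) = punchIn-adjacent j p h₁ h₂ in
      trans (*-congˡ (trans (*-congˡ (det-adjacent p′ (minor j) λ i →
        trans (reflexive (≡.cong (M (suc i)) e))
          (trans (h (suc i)) (reflexive (≡.cong (M (suc i)) (≡.sym e′))))))
        (zeroʳ _))) (zeroʳ _)
    minors : ∀ i l → minor (inject₁ p) i l ≈ minor (suc p) i l
    minors i l with punchIn-neighbours p l
    ... | inj₁ e = reflexive (≡.cong (M (suc i)) e)
    ... | inj₂ (e , e′) = trans (reflexive (≡.cong (M (suc i)) e))
      (trans (sym (h (suc i))) (reflexive (≡.cong (M (suc i)) (≡.sym e′))))
    pair : term (inject₁ p) + term (suc p) ≈ 0#
    pair = begin
      (- 1#) ^ toℕ (inject₁ p) * x + - 1# * s * y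
        ≈⟨ +-cong (*-cong (reflexive (≡.cong ((- 1#) ^_) (Fin.toℕ-inject₁ p)))
             (*-cong (h zero) (det-cong minors))) (*-assoc _ _ _) ⟩
      s * y + - 1# * (s * y)  ≈⟨ +-congˡ (-1*x≈-x (s * y)) ⟩
      s * y + - (s * y)       ≈⟨ -‿inverseʳ _ ⟩
      0#                      ∎
      where
      s = (- 1#) ^ toℕ p
      x = M zero (inject₁ p) * det (minor (inject₁ p))
      y = M zero (suc p) * det (minor (suc p))

  infixl 5 _[_≔_]
  _[_≔_] : ∀ {n} → (Fin n → Vector Carrier n) → Fin n → Vector Carrier n → Fin n → Vector Carrier n
  C [ p ≔ v ] = updateAt C p (const v)

  colDet : ∀ {n} → (Fin n → Vector Carrier n) → Carrier
  colDet C = det λ i j → C j i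

  colDet-adjacent : ∀ {n} (p : Fin n) (C : Fin (suc n) → Vector Carrier (suc n)) →
    (∀ i → C (inject₁ p) i ≈ C (suc p) i) → colDet C ≈ 0#
  colDet-adjacent p C = det-adjacent p λ i j → C j i

  module _ {n} (C : Fin n → Vector Carrier n) (p : Fin n) where
    updated : ∀ v i → (C [ p ≔ v ]) p i ≈ v i
    updated v i = reflexive (≡.cong (λ f → f i) (updateAt-updates p C))

    untouched : ∀ v j → j ≢ p → (C [ p ≔ v ]) j ≡ C j
    untouched v j j≢p = updateAt-minimal j p C j≢p

    colDet-linear : ∀ a b {u v w : Vector Carrier n} → (∀ i → u i ≈ a * v i + b * w i) →
      colDet (C [ p ≔ u ]) ≈ a * colDet (C [ p ≔ v ]) + b * colDet (C [ p ≔ w ])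
    colDet-linear a b {u} {v} {w} h = det-linear p a b
      (λ i j j≢p → reflexive (≡.cong (λ f → f i) (≡.trans (untouched u j j≢p) (≡.sym (untouched v j j≢p)))))
      (λ i j j≢p → reflexive (≡.cong (λ f → f i) (≡.trans (untouched u j j≢p) (≡.sym (untouched w j j≢p)))))
      (λ i → trans (updated u i) (trans (h i)
        (sym (+-cong (*-congˡ (updated v i)) (*-congˡ (updated w i))))))

    colDet-update : ∀ {v} → (∀ i → v i ≈ C p i) → colDet (C [ p ≔ v ]) ≈ colDet C
    colDet-update {v} h = det-cong λ i j → go i j
      where
      go : ∀ i j → (C [ p ≔ v ]) j i ≈ C j i
      go i j with j Fin.≟ p
      ... | yes ≡.refl = trans (updated v i) (h i)
      ... | no j≢p = reflexive (≡.cong (λ f → f i) (untouched v j j≢p))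

  -- Let x be the column left of p.  In det(.., u, .., x, u, ..) with u in positions
  -- o and p, replace both x and the u at p by x + u: the result vanishes,
  -- and so do all terms of its bilinear expansion but the one sought.
  private
    colDet-gap : ∀ {n} d (o p : Fin n) → toℕ p ≡ d ℕ.+ suc (toℕ o) → (C : Fin n → Vector Carrier n) →
      (∀ i → C o i ≈ C p i) → colDet C ≈ 0#
    colDet-gap {suc n} d zero zero e C h = contradiction e (λ e → contradiction (≡.trans e (ℕ.+-suc d 0)) λ ())
    colDet-gap {suc n} d (suc o) zero e C h = contradiction (≡.trans e (ℕ.+-suc d _)) λ ()
    colDet-gap {suc n} zero o (suc p) e C h = colDet-adjacent p C λ i →
      trans (reflexive (≡.cong (λ j → C j i) (Fin.toℕ-injective
        (≡.trans (Fin.toℕ-inject₁ p) (ℕ.suc-injective e))))) (h i)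
    colDet-gap {suc n} (suc d) o (suc p) e C h = begin
      colDet C ≈⟨ colDet-update C x (λ _ → refl) ⟨
      colDet (C [ x ≔ C x ]) ≈⟨ *-identityˡ _ ⟨
      1# * colDet (C [ x ≔ C x ]) ≈⟨ +-identityʳ _ ⟨
      1# * colDet (C [ x ≔ C x ]) + 0#
        ≈⟨ +-congˡ (trans (*-congˡ (colDet-adjacent p (C [ x ≔ u ]) λ i → trans (updated C x u i)
              (reflexive (≡.cong (λ f → f i) (≡.sym (untouched C x u y y≢x)))))) (zeroʳ _)) ⟨
      1# * colDet (C [ x ≔ C x ]) + 1# * colDet (C [ x ≔ u ])
        ≈⟨ colDet-linear C x 1# 1# (λ i → sym (+-cong (*-identityˡ _) (*-identityˡ _))) ⟨
      colDet C₁ ≈⟨ +-identityˡ _ ⟨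
      0# + colDet C₁
        ≈⟨ +-cong (trans (*-congˡ C₂≈0) (zeroʳ _)) (trans (*-identityˡ _) (colDet-update C₁ y (λ i → reflexive
             (≡.cong (λ f → f i) (≡.sym (untouched C x _ y y≢x)))))) ⟨
      1# * colDet (C₁ [ y ≔ C x ]) + 1# * colDet (C₁ [ y ≔ u ])
        ≈⟨ colDet-linear C₁ y 1# 1# (λ i → sym (+-cong (*-identityˡ _) (*-identityˡ _))) ⟨
      colDet (C₁ [ y ≔ x+u ])
        ≈⟨ colDet-adjacent p (C₁ [ y ≔ x+u ]) (λ i → trans (reflexive (≡.cong (λ f → f i) (untouched C₁ y x+u x (y≢x ∘ ≡.sym))))
             (trans (updated C x x+u i) (sym (updated C₁ y x+u i)))) ⟩
      0# ∎
      where
      y = suc p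
      x = inject₁ p
      u = C y
      x+u : Vector Carrier (suc n)
      x+u i = C x i + u i
      C₁ = C [ x ≔ x+u ]
      toℕ-x : toℕ x ≡ d ℕ.+ suc (toℕ o)
      toℕ-x = ≡.trans (Fin.toℕ-inject₁ p) (ℕ.suc-injective e)
      y≢x : y ≢ x
      y≢x e = ℕ.1+n≢n (≡.trans (≡.cong toℕ e) (Fin.toℕ-inject₁ p))
      o≢x : o ≢ x
      o≢x e = ℕ.<⇒≢ (ℕ.m≤n+m (suc (toℕ o)) d) (≡.trans (≡.cong toℕ e) toℕ-x)
      o≢y : o ≢ y
      o≢y e′ = ℕ.<⇒≢ (ℕ.m≤n+m (suc (toℕ o)) (suc d)) (≡.trans (≡.cong toℕ e′) e)
      C₂ = C₁ [ y ≔ C x ]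
      C₂o : C₂ o ≡ C o
      C₂o = ≡.trans (untouched C₁ y _ o o≢y) (untouched C x _ o o≢x)
      C₂x≈ : ∀ i → C₂ x i ≈ 1# * C x i + 1# * u i
      C₂x≈ i = trans (reflexive (≡.cong (λ f → f i) (untouched C₁ y _ x (y≢x ∘ ≡.sym))))
        (trans (updated C x _ i) (sym (+-cong (*-identityˡ _) (*-identityˡ _))))
      C₂≈0 : colDet C₂ ≈ 0#
      C₂≈0 = begin
        colDet C₂ ≈⟨ colDet-update C₂ x (λ i → refl) ⟨
        colDet (C₂ [ x ≔ C₂ x ]) ≈⟨ colDet-linear C₂ x 1# 1# C₂x≈ ⟩
        1# * colDet (C₂ [ x ≔ C x ]) + 1# * colDet (C₂ [ x ≔ u ])
          ≈⟨ +-cong (*-congˡ (colDet-adjacent p (C₂ [ x ≔ C x ]) λ i → trans (updated C₂ x (C x) i)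
               (sym (trans (reflexive (≡.cong (λ f → f i) (untouched C₂ x (C x) y y≢x)))
                 (updated C₁ y (C x) i)))))
               -- Here u stands at o and at x, one place closer to each other than o and y: the
               -- induction on d.
               (*-congˡ (colDet-gap d o x toℕ-x (C₂ [ x ≔ u ]) λ i →
                 trans (reflexive (≡.cong (λ f → f i) (≡.trans (untouched C₂ x u o o≢x) C₂o)))
                   (trans (h i) (sym (updated C₂ x u i))))) ⟩
        1# * 0# + 1# * 0# ≈⟨ +-cong (zeroʳ _) (zeroʳ _) ⟩
        0# + 0# ≈⟨ +-identityˡ _ ⟩
        0# ∎

  colDet-alternating : ∀ {n} (o p : Fin n) → o ≢ p → (C : Fin n → Vector Carrier n) →
    (∀ i → C o i ≈ C p i) → colDet C ≈ 0#
  colDet-alternating o p o≢p C h with ℕ.<-cmp (toℕ o) (toℕ p)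
  ... | tri< o<p _ _ = colDet-gap (toℕ p ℕ.∸ suc (toℕ o)) o p (≡.sym (ℕ.m∸n+n≡m o<p)) C h
  ... | tri≈ _ e _ = contradiction (Fin.toℕ-injective e) o≢p
  ... | tri> _ _ p<o = colDet-gap (toℕ o ℕ.∸ suc (toℕ p)) p o (≡.sym (ℕ.m∸n+n≡m p<o)) C (λ i → sym (h i))

  -- Two-term combinations are what `det-linear` expands, so the multilinear expansion becomes an
  -- induction on the derivation and no list of coefficients is carried along.
  data Span {n g} (G : Vector Carrier n → Set g) : Vector Carrier n → Set (c ⊔ ℓ ⊔ g) where
    generator   : ∀ {v} → G v → Span G v
    zero        : ∀ {v} → (∀ i → v i ≈ 0#) → Span G v
    combination : ∀ a b {u v w} → Span G v → Span G w → (∀ i → u i ≈ a * v i + b * w i) → Span G u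

  span-cong : ∀ {n g} {G : Vector Carrier n → Set g} {u v : Vector Carrier n} →
    (∀ i → u i ≈ v i) → Span G v → Span G u
  span-cong e s = combination 1# 0# s s λ i →
    trans (e i) (sym (trans (+-cong (*-identityˡ _) (zeroˡ _)) (+-identityʳ _)))

  span-sum : ∀ {n g} {G : Vector Carrier n → Set g} m (a : Fin m → Carrier) (v : Fin m → Vector Carrier n) →
    (∀ i → Span G (v i)) → Span G (λ j → sum λ i → a i * v i j)
  span-sum zero a v h = zero λ _ → refl
  span-sum (suc m) a v h = combination (a zero) 1# (h zero) (span-sum m (a ∘ suc) (v ∘ suc) (h ∘ suc))
    λ i → +-congˡ (sym (*-identityˡ _))

  module _ {n} (C : Fin n → Vector Carrier n) (p : Fin n) where
    colDet-span : ∀ {g} {G : Vector Carrier n → Set g} →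
      (∀ v → G v → colDet (C [ p ≔ v ]) ≈ 0#) → ∀ {v} → Span G v → colDet (C [ p ≔ v ]) ≈ 0#
    colDet-span h (generator g) = h _ g
    colDet-span h {v} (zero e) = begin
      colDet (C [ p ≔ v ])
        -- A zero column is read as 0 v + 0 v, so that linearity applies to it.
        ≈⟨ colDet-linear C p 0# 0# {v} {v} {v} (λ i → trans (e i) (sym (zeros _ _))) ⟩
      0# * colDet (C [ p ≔ v ]) + 0# * colDet (C [ p ≔ v ]) ≈⟨ zeros _ _ ⟩
      0# ∎
      where
      zeros : ∀ x y → 0# * x + 0# * y ≈ 0#
      zeros x y = trans (+-cong (zeroˡ _) (zeroˡ _)) (+-identityˡ 0#)
    colDet-span h (combination a b s t e) = trans (colDet-linear C p a b e)
      (trans (+-cong (trans (*-congˡ (colDet-span h s)) (zeroʳ a))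
                     (trans (*-congˡ (colDet-span h t)) (zeroʳ b))) (+-identityˡ 0#))

  -- Each column has its own generators, because the powers of q allowed for column j are bounded by
  -- its own weight. The columns are expanded one at a time from the last to the first: in `go m`
  -- those from position m on are already generators.
  colDet-spans : ∀ {n g} (G : Fin n → Vector Carrier n → Set g) →
    (∀ C → (∀ j → G j (C j)) → colDet C ≈ 0#) →
    ∀ C → (∀ j → Span (G j) (C j)) → colDet C ≈ 0#
  colDet-spans {n} G h C s = go n ℕ.≤-refl C (λ j _ → s j)
    (λ j n≤j → contradiction (Fin.toℕ<n j) (ℕ.≤⇒≯ n≤j))
    where
    go : ∀ m → m ℕ.≤ n → ∀ C → (∀ j → toℕ j ℕ.< m → Span (G j) (C j)) →
         (∀ j → m ℕ.≤ toℕ j → G j (C j)) → colDet C ≈ 0#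
    go zero _ C _ g = h C (λ j → g j z≤n)
    go (suc m) m<n C s g = trans (sym (colDet-update C p (λ _ → refl)))
      (colDet-span C p (λ v gv → go m (ℕ.<⇒≤ m<n) (C [ p ≔ v ])
        (λ j j<m → ≡.subst (Span (G j)) (≡.sym (untouched C p v j
            (λ e → ℕ.<⇒≢ j<m (≡.trans (≡.cong toℕ e) toℕ-p)))) (s j (ℕ.m<n⇒m<1+n j<m)))
        (λ j m≤j → generators v gv j m≤j (j Fin.≟ p)))
        (s p (s≤s (ℕ.≤-reflexive toℕ-p))))
      where
      p = fromℕ< m<n
      toℕ-p : toℕ p ≡ m
      toℕ-p = Fin.toℕ-fromℕ< m<n
      generators : ∀ v → G p v → ∀ j → m ℕ.≤ toℕ j → Dec (j ≡ p) → G j ((C [ p ≔ v ]) j)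
      generators v gv j m≤j (yes ≡.refl) = ≡.subst (G p) (≡.sym (updateAt-updates p C)) gv
      generators v gv j m≤j (no j≢p) = ≡.subst (G j) (≡.sym (untouched C p v j j≢p))
        (g j (ℕ.≤∧≢⇒< m≤j λ e → j≢p (Fin.toℕ-injective (≡.trans (≡.sym e) (≡.sym toℕ-p)))))

-- The Tate algebra

module CauchyProduct {c ℓ} (R : CommutativeRing c ℓ) where
  open CommutativeRing R hiding (zero)
  open SemiringSum semiring
  open SetoidReasoning setoid
  open SemiringSolver commutativeSemiring using (solve; _:+_; _:*_; _:=_)

  infixl 7 _⊛_
  -- This is the coefficient sequence of `_*ᵀ_`. Equality in 𝕋 is coefficientwise, so the ring laws
  -- can be proved for arbitrary sequences, without convergence to 0.
  _⊛_ : (ℕ → Carrier) → (ℕ → Carrier) → ℕ → Carrier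
  (f ⊛ g) n = sum {suc n} λ i → f (toℕ i) * g (n ∸ toℕ i)

  ⊛-cong : ∀ {f f′ g g′} → (∀ n → f n ≈ f′ n) → (∀ n → g n ≈ g′ n) → ∀ n → (f ⊛ g) n ≈ (f′ ⊛ g′) n
  ⊛-cong p r n = sum-cong-≋ {suc n} λ i → *-cong (p (toℕ i)) (r (n ∸ toℕ i))

  ⊛-distribˡ : ∀ f g h n → (f ⊛ (λ m → g m + h m)) n ≈ (f ⊛ g) n + (f ⊛ h) n
  ⊛-distribˡ f g h n = trans (sum-cong-≋ {suc n} λ i → distribˡ (f (toℕ i)) (g (n ∸ toℕ i)) (h (n ∸ toℕ i)))
    (∑-distrib-+ {suc n} (λ i → f (toℕ i) * g (n ∸ toℕ i)) (λ i → f (toℕ i) * h (n ∸ toℕ i)))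

  ⊛-distribʳ : ∀ f g h n → ((λ m → g m + h m) ⊛ f) n ≈ (g ⊛ f) n + (h ⊛ f) n
  ⊛-distribʳ f g h n = trans (sum-cong-≋ {suc n} λ i → distribʳ (f (n ∸ toℕ i)) (g (toℕ i)) (h (toℕ i)))
    (∑-distrib-+ {suc n} (λ i → g (toℕ i) * f (n ∸ toℕ i)) (λ i → h (toℕ i) * f (n ∸ toℕ i)))

  ⊛-scale : ∀ a f g n → ((λ m → a * f m) ⊛ g) n ≈ a * (f ⊛ g) n
  ⊛-scale a f g n = trans (sum-cong-≋ {suc n} λ i → *-assoc a (f (toℕ i)) (g (n ∸ toℕ i)))
    (sym (*-distribˡ-sum {suc n} a (λ i → f (toℕ i) * g (n ∸ toℕ i))))

  ⊛-zeroˡ : ∀ g n → (const 0# ⊛ g) n ≈ 0#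
  ⊛-zeroˡ g n = trans (sum-cong-≋ {suc n} λ i → zeroˡ (g (n ∸ toℕ i))) (sum-replicate-zero (suc n))

  -- By computation the product unfolds at index 0 of the left factor. Unfolding it at index 0 of
  -- the right factor instead is what turns commutativity into an induction.
  ⊛-suc : ∀ f g n → (f ⊛ g) (suc n) ≈ f (suc n) * g 0 + (f ⊛ (g ∘ suc)) n
  ⊛-suc f g zero = begin
    f 0 * g 1 + (f 1 * g 0 + 0#) ≈⟨ +-congˡ (+-identityʳ _) ⟩
    f 0 * g 1 + f 1 * g 0        ≈⟨ +-comm _ _ ⟩
    f 1 * g 0 + f 0 * g 1        ≈⟨ +-congˡ (+-identityʳ _) ⟨
    f 1 * g 0 + (f 0 * g 1 + 0#) ∎
  ⊛-suc f g (suc n) = begin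
    f 0 * g (2 ℕ.+ n) + ((f ∘ suc) ⊛ g) (suc n)
      ≈⟨ +-congˡ (⊛-suc (f ∘ suc) g n) ⟩
    f 0 * g (2 ℕ.+ n) + (f (2 ℕ.+ n) * g 0 + ((f ∘ suc) ⊛ (g ∘ suc)) n)
      ≈⟨ solve 3 (λ a b c → a :+ (b :+ c) := b :+ (a :+ c)) refl _ _ _ ⟩
    f (2 ℕ.+ n) * g 0 + (f ⊛ (g ∘ suc)) (suc n) ∎

  ⊛-comm : ∀ f g n → (f ⊛ g) n ≈ (g ⊛ f) n
  ⊛-comm f g zero = +-congʳ (*-comm (f 0) (g 0))
  ⊛-comm f g (suc n) = begin
    f 0 * g (suc n) + ((f ∘ suc) ⊛ g) n ≈⟨ +-cong (*-comm _ _) (⊛-comm (f ∘ suc) g n) ⟩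
    g (suc n) * f 0 + (g ⊛ (f ∘ suc)) n ≈⟨ ⊛-suc g f n ⟨
    (g ⊛ f) (suc n)                     ∎

  ⊛-assoc : ∀ f g h n → ((f ⊛ g) ⊛ h) n ≈ (f ⊛ (g ⊛ h)) n
  ⊛-assoc f g h zero = +-congʳ (begin
    (f 0 * g 0 + 0#) * h 0 ≈⟨ *-congʳ (+-identityʳ _) ⟩
    f 0 * g 0 * h 0        ≈⟨ *-assoc _ _ _ ⟩
    f 0 * (g 0 * h 0)      ≈⟨ *-congˡ (+-identityʳ _) ⟨
    f 0 * (g 0 * h 0 + 0#) ∎)
  ⊛-assoc f g h (suc n) = begin
    (f 0 * g 0 + 0#) * h (suc n) + ((λ m → f 0 * g (suc m) + ((f ∘ suc) ⊛ g) m) ⊛ h) n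
      ≈⟨ +-cong (*-congʳ (+-identityʳ _)) (⊛-distribʳ h (λ m → f 0 * g (suc m)) ((f ∘ suc) ⊛ g) n) ⟩
    f 0 * g 0 * h (suc n) + (((λ m → f 0 * g (suc m)) ⊛ h) n + (((f ∘ suc) ⊛ g) ⊛ h) n)
      ≈⟨ +-congˡ (+-cong (⊛-scale (f 0) (g ∘ suc) h n) (⊛-assoc (f ∘ suc) g h n)) ⟩
    f 0 * g 0 * h (suc n) + (f 0 * ((g ∘ suc) ⊛ h) n + ((f ∘ suc) ⊛ (g ⊛ h)) n)
      ≈⟨ solve 5 (λ a b c d e → a :* b :* c :+ (a :* d :+ e) := a :* (b :* c :+ d) :+ e) refl _ _ _ _ _ ⟩
    f 0 * (g ⊛ h) (suc n) + ((f ∘ suc) ⊛ (g ⊛ h)) n ∎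

  ⊛-constantˡ : ∀ x e g → e 0 ≈ x → (∀ n → e (suc n) ≈ 0#) → ∀ n → (e ⊛ g) n ≈ x * g n
  ⊛-constantˡ x e g e₀ e₊ zero = trans (+-identityʳ _) (*-congʳ e₀)
  ⊛-constantˡ x e g e₀ e₊ (suc n) = begin
    e 0 * g (suc n) + ((e ∘ suc) ⊛ g) n
      ≈⟨ +-cong (*-congʳ e₀) (trans (⊛-cong {g = g} e₊ (λ _ → refl) n) (⊛-zeroˡ g n)) ⟩
    x * g (suc n) + 0# ≈⟨ +-identityʳ _ ⟩
    x * g (suc n) ∎

-- Only upper bounds are recorded, so the maximum that defines the Gauss norm never has to be found;
-- submultiplicativity is all that continuity of products asks for.
record UltrametricNorm {c ℓ} (R : CommutativeRing c ℓ) : Set (lsuc 0ℓ ⊔ c ⊔ ℓ) where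
  open CommutativeRing R
  field
    ‖_‖≤_   : Carrier → ℚ → Set
    ‖‖-cong : ∀ {f g e} → f ≈ g → ‖ f ‖≤ e → ‖ g ‖≤ e
    ‖0‖     : ∀ {e} → ‖ 0# ‖≤ e
    ‖+‖     : ∀ {f g e} → ‖ f ‖≤ e → ‖ g ‖≤ e → ‖ f + g ‖≤ e
    ‖*‖     : ∀ {f g d e} → ‖ f ‖≤ d → ‖ g ‖≤ e → ‖ f * g ‖≤ (d ℚ.+ e)
    bounded : ∀ f → ∃[ e ] ‖ f ‖≤ e

-- Near d y says that y is within distance q^d of x.
module Continuity {c ℓ} (R : CommutativeRing c ℓ) (norm : UltrametricNorm R)
  {a} {X : Set a} (Near : ℚ → X → Set)
  (Near-mono : ∀ {d e y} → d ℚ.≤ e → Near d y → Near e y) (x : X) where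

  open CommutativeRing R hiding (zero)
  open UltrametricNorm norm
  open SetoidReasoning setoid
  open SemiringSolver commutativeSemiring using (solve; _:+_; _:*_; _:=_)
  open RingProperties ring using (//-rightDividesˡ; xyx⁻¹≈y)
  open Determinant rawRing using (det)

  Continuous : (X → Carrier) → Set a
  Continuous F = ∀ e → ∃[ d ] ∀ y → Near d y → ‖ F y - F x ‖≤ e

  private
    difference : ∀ {u v t} → u ≈ v + t → t ≈ u - v
    difference {u} {v} {t} p = sym (trans (+-congʳ p) (xyx⁻¹≈y v t))

    restore : ∀ u v → u ≈ v + (u - v)
    restore u v = sym (trans (+-comm v (u - v)) (//-rightDividesˡ v u))

    both : ∀ {a b} {P Q : X → Set} → (∀ y → Near a y → P y) → (∀ y → Near b y → Q y) →
      ∀ y → Near (a ℚ.⊓ b) y → P y × Q y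
    both {a} {b} p r y h = p y (Near-mono (ℚ.p⊓q≤p a b) h) , r y (Near-mono (ℚ.p⊓q≤q a b) h)

    -+-cancel : ∀ d e → (d ℚ.- e) ℚ.+ e ≡ d
    -+-cancel d e = ≡.trans (ℚ.+-assoc d (ℚ.- e) e)
      (≡.trans (≡.cong (d ℚ.+_) (ℚ.+-inverseˡ e)) (ℚ.+-identityʳ d))

  const-continuous : ∀ f → Continuous (const f)
  const-continuous f e = e , λ y _ → ‖‖-cong {0#} {f - f} (sym (-‿inverseʳ f)) ‖0‖

  +-continuous : ∀ F G → Continuous F → Continuous G → Continuous (λ y → F y + G y)
  +-continuous F G cF cG e with cF e | cG e
  ... | a , hF | b , hG = a ℚ.⊓ b , λ y h →
    let (p , r) = both hF hG y h
        u = F y - F x ; v = G y - G x in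
    ‖‖-cong {u + v} {F y + G y - (F x + G x)}
      (difference (begin
        F y + G y             ≈⟨ +-cong (restore (F y) (F x)) (restore (G y) (G x)) ⟩
        F x + u + (G x + v)   ≈⟨ solve 4 (λ a b c d → (a :+ b) :+ (c :+ d) := (a :+ c) :+ (b :+ d))
                                   refl (F x) u (G x) v ⟩
        F x + G x + (u + v) ∎))
      (‖+‖ p r)

  *-continuous : ∀ F G → Continuous F → Continuous G → Continuous (λ y → F y * G y)
  *-continuous F G cF cG e with bounded (F x) | bounded (G x)
  -- The error is u G(x) + F(x) v + u v. The first two summands need |u| at most q^(e - bG) and |v|
  -- at most q^(e - bF), the last one |u| at most q^e and |v| at most 1.
  ... | bF , F≤ | bG , G≤ with cF (e ℚ.- bG) | cF e | cG (e ℚ.- bF) | cG ℚ.0ℚ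
  ... | a , hF | a′ , hF′ | b , hG | b′ , hG′ = (a ℚ.⊓ a′) ℚ.⊓ (b ℚ.⊓ b′) , λ y h →
    let ((p , p′) , (r , r′)) = both (both hF hF′) (both hG hG′) y h
        u = F y - F x ; v = G y - G x in
    ‖‖-cong {u * G x + F x * v + u * v} {F y * G y - F x * G x}
      (difference (begin
        F y * G y               ≈⟨ *-cong (restore (F y) (F x)) (restore (G y) (G x)) ⟩
        (F x + u) * (G x + v)   ≈⟨ solve 4 (λ a b c d → (a :+ b) :* (c :+ d) :=
                                     (a :* c) :+ ((b :* c) :+ (a :* d) :+ (b :* d)))
                                     refl (F x) u (G x) v ⟩
        F x * G x + (u * G x + F x * v + u * v) ∎))
      (‖+‖ (‖+‖
        (≡.subst (‖_‖≤_ _) (-+-cancel e bG) (‖*‖ p G≤))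
        (≡.subst (‖_‖≤_ _) (≡.trans (ℚ.+-comm bF _) (-+-cancel e bF)) (‖*‖ F≤ r)))
        (≡.subst (‖_‖≤_ _) (ℚ.+-identityʳ e) (‖*‖ p′ r′)))

  open SemiringSum semiring using (sum)
  open SemiringExp semiring using (_^_)

  sum-continuous : ∀ n (F : Fin n → X → Carrier) → (∀ i → Continuous (F i)) →
    Continuous (λ y → sum λ i → F i y)
  sum-continuous zero F h = const-continuous 0#
  sum-continuous (suc n) F h = +-continuous (F zero) (λ y → sum λ i → F (suc i) y)
    (h zero) (sum-continuous n (λ i → F (suc i)) (λ i → h (suc i)))

  det-continuous : ∀ n (F : Fin n → Fin n → X → Carrier) → (∀ i j → Continuous (F i j)) →
    Continuous (λ y → det λ i j → F i j y)
  det-continuous zero F h = const-continuous 1#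
  det-continuous (suc n) F h = sum-continuous (suc n)
    (λ j y → sign j * (F zero j y * minor j y)) λ j →
    *-continuous (λ _ → sign j) (λ y → F zero j y * minor j y)
      (const-continuous (sign j)) (*-continuous (F zero j) (minor j) (h zero j)
        (det-continuous n (λ i l → F (suc i) (punchIn j l)) λ i l → h (suc i) (punchIn j l)))
    where
    sign : Fin (suc n) → Carrier
    sign j = (- 1#) ^ toℕ j
    minor : Fin (suc n) → X → Carrier
    minor j y = det λ i l → F (suc i) (punchIn j l) y

-- The Tate algebra as a normed commutative ring

module _ {c₁ ℓ₁ c ℓ} (𝔽 : FiniteField c₁ ℓ₁) (ℂ∞ : CompletedClosure 𝔽 c ℓ) where
  private module K = CompletedClosure ℂ∞
  open K using (Carrier; ∣_∣≤q^_)
  open CauchyProduct K.commutativeRing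

  private
    T = 𝕋 𝔽 ℂ∞
    infixl 7 _*T_ _•T_
    _*T_ = _*ᵀ_ 𝔽 ℂ∞
    _•T_ = _•_ 𝔽 ℂ∞
    infix 4 _≈T_
    _≈T_ = _≈ᵀ_ 𝔽 ℂ∞
    0T = 0ᵀ 𝔽 ℂ∞
    1T = 1ᵀ 𝔽 ℂ∞

  *ᵀ-identityˡ : ∀ f → 1T *T f ≈T f
  *ᵀ-identityˡ f n = K.trans (⊛-constantˡ K.1# (proj₁ 1T) (proj₁ f) K.refl (λ _ → K.refl) n) (K.*-identityˡ _)

  *ᵀ-comm : ∀ f g → f *T g ≈T g *T f
  *ᵀ-comm f g = ⊛-comm (proj₁ f) (proj₁ g)

  𝕋-commutativeRing : CommutativeRing c ℓ
  𝕋-commutativeRing = record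
    { Carrier = T ; _≈_ = _≈T_ ; _+_ = _+ᵀ_ 𝔽 ℂ∞ ; _*_ = _*T_ ; -_ = -ᵀ_ 𝔽 ℂ∞ ; 0# = 0T ; 1# = 1T
    ; isCommutativeRing = record
      { isRing = record
        { +-isAbelianGroup = record
          { isGroup = record
            { isMonoid = record
              { isSemigroup = record
                { isMagma = record
                  { isEquivalence = record
                    { refl = λ _ → K.refl ; sym = λ p n → K.sym (p n) ; trans = λ p r n → K.trans (p n) (r n) }
                  ; ∙-cong = λ p r n → K.+-cong (p n) (r n) }
                ; assoc = λ _ _ _ _ → K.+-assoc _ _ _ }
              ; identity = (λ _ _ → K.+-identityˡ _) , (λ _ _ → K.+-identityʳ _) }
            ; inverse = (λ _ _ → K.-‿inverseˡ _) , (λ _ _ → K.-‿inverseʳ _)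
            ; ⁻¹-cong = λ p n → K.-‿cong (p n) }
          ; comm = λ _ _ _ → K.+-comm _ _ }
        ; *-cong = λ p r → ⊛-cong p r
        ; *-assoc = λ f g h → ⊛-assoc (proj₁ f) (proj₁ g) (proj₁ h)
        ; *-identity = *ᵀ-identityˡ , λ f n → K.trans (*ᵀ-comm f 1T n) (*ᵀ-identityˡ f n)
        ; distrib = (λ f g h → ⊛-distribˡ (proj₁ f) (proj₁ g) (proj₁ h))
                  , (λ f g h → ⊛-distribʳ (proj₁ f) (proj₁ g) (proj₁ h)) }
      ; *-comm = *ᵀ-comm } }

  constantᵀ : Carrier → T
  constantᵀ x = x •T 1T

  constantᵀ-* : ∀ x f n → proj₁ (constantᵀ x *T f) n K.≈ x K.* proj₁ f n
  constantᵀ-* x f = ⊛-constantˡ x (proj₁ (constantᵀ x)) (proj₁ f) (K.*-identityʳ x) (λ _ → K.zeroʳ x)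

  open Estimates 𝔽 ℂ∞

  gaussNorm : UltrametricNorm 𝕋-commutativeRing
  gaussNorm = record
    { ‖_‖≤_   = ‖_‖≤q^_ 𝔽 ℂ∞
    ; ‖‖-cong = λ p b n → ∣∣-cong (p n) (b n)
    ; ‖0‖     = λ _ → ∣0∣≤
    ; ‖+‖     = λ p r n → K.log-+ (p n) (r n)
    ; ‖*‖     = λ p r n → ∣sum∣≤ {n = suc n} _ λ i → ∣*∣≤ (p (toℕ i)) (r (n ∸ toℕ i))
    ; bounded = Boundedness.bounded 𝔽 ℂ∞ }

  ‖‖-mono : ∀ {f d e} → d ℚ.≤ e → ‖_‖≤q^_ 𝔽 ℂ∞ f d → ‖_‖≤q^_ 𝔽 ℂ∞ f e
  ‖‖-mono d≤e p n = ∣∣-mono d≤e (p n)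

-- Finite fields

module DiscreteField {c ℓ} (F : Field c ℓ) (_≟_ : Decidable (Field._≈_ F)) where
  open Field F hiding (zero)
  open RingProperties ring
  open SemiringExp semiring using (^-congˡ)
  open SetoidReasoning setoid

  inverseˡ : ∀ {x} → x ≉ 0# → x ⁻¹ * x ≈ 1#
  inverseˡ x≉0 = trans (*-comm _ _) (inverseʳ x≉0)

  cancelˡ : ∀ {x y z} → x ≉ 0# → x * y ≈ x * z → y ≈ z
  cancelˡ {x} {y} {z} x≉0 e = begin
    y               ≈⟨ *-identityˡ y ⟨
    1# * y          ≈⟨ *-congʳ (inverseˡ x≉0) ⟨
    x ⁻¹ * x * y    ≈⟨ *-assoc _ _ _ ⟩
    x ⁻¹ * (x * y)  ≈⟨ *-congˡ e ⟩
    x ⁻¹ * (x * z)  ≈⟨ *-assoc _ _ _ ⟨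
    x ⁻¹ * x * z    ≈⟨ *-congʳ (inverseˡ x≉0) ⟩
    1# * z          ≈⟨ *-identityˡ z ⟩
    z               ∎

  x*y≈0⇒y≈0 : ∀ {x y} → x ≉ 0# → x * y ≈ 0# → y ≈ 0#
  x*y≈0⇒y≈0 x≉0 e = cancelˡ x≉0 (trans e (sym (zeroʳ _)))

  *-≉0 : ∀ {x y} → x ≉ 0# → y ≉ 0# → x * y ≉ 0#
  *-≉0 x≉0 y≉0 e = y≉0 (x*y≈0⇒y≈0 x≉0 e)

  1^n≈1 : ∀ n → 1# ^ n ≈ 1#
  1^n≈1 zero = refl
  1^n≈1 (suc n) = trans (*-identityˡ _) (1^n≈1 n)

  ^-≉0 : ∀ {x} n → x ≉ 0# → x ^ n ≉ 0#
  ^-≉0 zero x≉0 e = 0≉1 (sym e)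
  ^-≉0 (suc n) x≉0 = *-≉0 x≉0 (^-≉0 n x≉0)

  eval : ∀ {n} → Vec Carrier n → Carrier → Carrier
  eval [] x = 0#
  eval (c ∷ p) x = c + x * eval p x

  -- (P(X) - P(a)) / (X - a)
  quotient : ∀ {n} → Vec Carrier (suc n) → Carrier → Vec Carrier n
  quotient {zero} _ a = []
  quotient {suc n} (c ∷ p) a = eval p a ∷ quotient p a

  eval-quotient : ∀ {n} (p : Vec Carrier (suc n)) a x →
    eval p x ≈ (x - a) * eval (quotient p a) x + eval p a
  eval-quotient {zero} (c ∷ []) a x = begin
    c + x * 0#                      ≈⟨ +-congˡ (trans (zeroʳ x) (sym (zeroʳ a))) ⟩
    c + a * 0#                      ≈⟨ +-identityˡ _ ⟨
    0# + (c + a * 0#)               ≈⟨ +-congʳ (zeroʳ _) ⟨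
    (x - a) * 0# + (c + a * 0#)     ∎
  eval-quotient {suc n} (c ∷ p) a x = begin
    c + x * eval p x
      ≈⟨ +-congˡ (*-cong restore (trans (eval-quotient p a x) (+-congʳ (*-congʳ refl)))) ⟩
    c + (x - a + a) * (d * Q + P)
      ≈⟨ +-congˡ (trans (distribʳ _ _ _) (+-congʳ (distribˡ _ _ _))) ⟩
    c + (d * (d * Q) + d * P + a * (d * Q + P))
      ≈⟨ solve 5 (λ c d Q P a → c :+ (d :* (d :* Q) :+ d :* P :+ a :* (d :* Q :+ P)) :=
           d :* (P :+ (d :+ a) :* Q) :+ (c :+ a :* P)) refl c d Q P a ⟩
    d * (P + (d + a) * Q) + (c + a * P)
      ≈⟨ +-congʳ (*-congˡ (+-congˡ (*-congʳ restore))) ⟨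
    d * (P + x * Q) + (c + a * P) ∎
    where
    open SemiringSolver commutativeSemiring using (solve; _:+_; _:*_; _:=_)
    d = x - a
    P = eval p a
    Q = eval (quotient p a) x
    restore : x ≈ d + a
    restore = sym (//-rightDividesˡ a x)

  private
    ZeroPoly : ∀ {n} → Vec Carrier n → Set _
    ZeroPoly = All (_≈ 0#)

    root-zero : ∀ {c x e} → c + x * e ≈ 0# → e ≈ 0# → c ≈ 0#
    root-zero {c} {x} {e} r e≈0 = begin
      c          ≈⟨ +-identityʳ c ⟨
      c + 0#     ≈⟨ +-congˡ (trans (*-congˡ e≈0) (zeroʳ x)) ⟨
      c + x * e  ≈⟨ r ⟩
      0#         ∎

    quotient-zero : ∀ {n} (p : Vec Carrier (suc n)) a →
      eval p a ≈ 0# → ZeroPoly (quotient p a) → ZeroPoly p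
    quotient-zero {zero} (c ∷ []) a r [] = root-zero r refl ∷ []
    quotient-zero {suc n} (c ∷ p) a r (e ∷ z) = root-zero r e ∷ quotient-zero p a e z

  -- Dividing by X - r₀ keeps the other roots, since their differences from r₀ are nonzero, and
  -- shortens the vector. A vector of length n has degree less than n, hence as many roots as
  -- coefficients.
  roots⇒zero : ∀ {n} (p : Vec Carrier n) (r : Fin n → Carrier) →
    (∀ i j → r i ≈ r j → i ≡ j) → (∀ i → eval p (r i) ≈ 0#) → ZeroPoly p
  roots⇒zero [] r distinct root = []
  roots⇒zero {suc n} p@(_ ∷ _) r distinct root = quotient-zero p a (root zero)
    (roots⇒zero (quotient p a) (r ∘ suc)
      (λ i j e → Fin.suc-injective (distinct (suc i) (suc j) e))
      (λ i → x*y≈0⇒y≈0 (λ e → contradiction (distinct (suc i) zero (x∙y⁻¹≈ε⇒x≈y _ _ e)) λ ())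
        (begin
          (r (suc i) - a) * eval (quotient p a) (r (suc i))            ≈⟨ +-identityʳ _ ⟨
          (r (suc i) - a) * eval (quotient p a) (r (suc i)) + 0#       ≈⟨ +-congˡ (root zero) ⟨
          (r (suc i) - a) * eval (quotient p a) (r (suc i)) + eval p a ≈⟨ eval-quotient p a (r (suc i)) ⟨
          eval p (r (suc i))                                           ≈⟨ root (suc i) ⟩
          0#                                                           ∎)))
    where a = r zero

  private
    monomial : ∀ n → Vec Carrier (suc n)
    monomial zero = 1# ∷ []
    monomial (suc n) = 0# ∷ monomial n

    eval-monomial : ∀ n x → eval (monomial n) x ≈ x ^ n
    eval-monomial zero x = trans (+-congˡ (zeroʳ x)) (+-identityʳ 1#)
    eval-monomial (suc n) x = trans (+-identityˡ _) (*-congˡ (eval-monomial n x))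

  -- X^(s+2) - X has at most s + 2 roots.
  ¬fixed-by-power : ∀ s (r : Fin (3 ℕ.+ s) → Carrier) →
    (∀ i j → r i ≈ r j → i ≡ j) → ¬ (∀ i → r i ^ (2 ℕ.+ s) ≈ r i)
  ¬fixed-by-power s r distinct fixed = conclude (roots⇒zero (0# ∷ - 1# ∷ monomial s) r distinct root)
    where
    root : ∀ i → eval (0# ∷ - 1# ∷ monomial s) (r i) ≈ 0#
    root i = begin
      0# + x * (- 1# + x * eval (monomial s) x) ≈⟨ +-identityˡ _ ⟩
      x * (- 1# + x * eval (monomial s) x)      ≈⟨ *-congˡ (+-congˡ (*-congˡ (eval-monomial s x))) ⟩
      x * (- 1# + x ^ suc s)                    ≈⟨ distribˡ _ _ _ ⟩
      x * - 1# + x ^ (2 ℕ.+ s)                  ≈⟨ +-cong (trans (*-comm x (- 1#)) (-1*x≈-x x)) (fixed i) ⟩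
      - x + x                                   ≈⟨ -‿inverseˡ x ⟩
      0#                                        ∎
      where x = r i
    conclude : ¬ ZeroPoly (0# ∷ - 1# ∷ monomial s)
    conclude (_ ∷ -1≈0 ∷ _) = 0≉1 (begin
      0#        ≈⟨ -0#≈0# ⟨
      - 0#      ≈⟨ -‿cong -1≈0 ⟨
      - - 1#    ≈⟨ -‿involutive 1# ⟩
      1#        ∎)

-- Decidable equality and Fermat's theorem in a finite field

module FiniteFieldProperties {c₁ ℓ₁} (𝔽 : FiniteField c₁ ℓ₁) where
  open FiniteField 𝔽 hiding (zero; sum)
  private module E = Inverse enumeration

  element : Fin q → Carrier
  element = E.to

  index : Carrier → Fin q
  index = E.from

  element-index : ∀ x → element (index x) ≈ x
  element-index x = E.strictlyInverseˡ x

  index-element : ∀ i → index (element i) ≡ i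
  index-element i = E.strictlyInverseʳ i

  index-injective : ∀ {x y} → index x ≡ index y → x ≈ y
  index-injective {x} {y} e = trans (sym (element-index x)) (trans (E.to-cong e) (element-index y))

  element-injective : ∀ i j → element i ≈ element j → i ≡ j
  element-injective i j e = ≡.trans (≡.sym (index-element i)) (≡.trans (E.from-cong e) (index-element j))

  _≟𝔽_ : Decidable _≈_
  x ≟𝔽 y = Dec.map′ index-injective E.from-cong (index x Fin.≟ index y)

  2≤q : 2 ℕ.≤ q
  2≤q = go q (index 0#) (index 1#) (λ e → 0≉1 (index-injective e))
    where
    go : ∀ n (i j : Fin n) → i ≢ j → 2 ℕ.≤ n
    go (suc zero) zero zero i≢j = contradiction ≡.refl i≢j
    go (suc (suc n)) _ _ _ = s≤s (s≤s z≤n)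

  module _ {m ℓₘ} (M : CommutativeMonoid m ℓₘ) where
    private module M = CommutativeMonoid M
    open CommutativeMonoidSum M

    -- A general commutative monoid is allowed because Fermat's theorem reindexes a product, the
    -- power sums a sum.
    sum-bijection : (h : Carrier → M.Carrier) → (∀ {x y} → x ≈ y → h x M.≈ h y) →
      (σ τ : Carrier → Carrier) → (∀ {x y} → x ≈ y → σ x ≈ σ y) → (∀ {x y} → x ≈ y → τ x ≈ τ y) →
      (∀ x → σ (τ x) ≈ x) → (∀ x → τ (σ x) ≈ x) →
      sum (λ i → h (element i)) M.≈ sum (λ i → h (σ (element i)))
    sum-bijection h h-cong σ τ σ-cong τ-cong στ τσ = M.trans
      (sum-permute (h ∘ element) (permutation to from to-from from-to))
      (sum-cong-≋ {q} λ i → h-cong (element-index (σ (element i))))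
      where
      to from : Fin q → Fin q
      to i = index (σ (element i))
      from i = index (τ (element i))
      to-from : ∀ i → to (from i) ≡ i
      to-from i = ≡.trans (E.from-cong (trans (σ-cong (element-index _)) (στ _))) (index-element i)
      from-to : ∀ i → from (to i) ≡ i
      from-to i = ≡.trans (E.from-cong (trans (τ-cong (element-index _)) (τσ _))) (index-element i)

  private
    open DiscreteField fieldStructure _≟𝔽_ using (cancelˡ; inverseˡ; *-≉0)
    module Π = CommutativeMonoidSum *-commutativeMonoid
  open SetoidReasoning setoid

  private
    product-≉0 : ∀ n (f : Fin n → Carrier) → (∀ i → f i ≉ 0#) → Π.sum f ≉ 0#
    product-≉0 zero f h e = 0≉1 (sym e)
    product-≉0 (suc n) f h = *-≉0 (h zero) (product-≉0 n (f ∘ suc) (h ∘ suc))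

    -- The extra x makes up for the one index where g is 1, which gives the exponent n without a
    -- predecessor.
    product-but-one : ∀ n x (k : Fin n) (g : Fin n → Carrier) → g k ≈ 1# → (∀ i → i ≢ k → g i ≈ x) →
      x * Π.sum g ≈ x ^ n
    product-but-one (suc n) x k g one others = *-congˡ (begin
      Π.sum g                             ≈⟨ Π.sum-remove {i = k} g ⟩
      g k * Π.sum (λ i → g (punchIn k i)) ≈⟨ *-cong one (Π.sum-cong-≋ {n} λ i → others _ (Fin.punchInᵢ≢i k i)) ⟩
      1# * Π.sum {n} (λ _ → x)            ≈⟨ *-identityˡ _ ⟩
      Π.sum {n} (λ _ → x)                 ≈⟨ Π.sum-replicate n ⟩
      x ^ n                               ∎)

    0^q : ∀ n → 1 ℕ.≤ n → 0# ^ n ≈ 0#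
    0^q (suc n) _ = zeroˡ _

  -- Multiplication by x permutes the nonzero elements; the element 0 is made
  -- harmless by replacing it with 1 in the product.
  fermat : ∀ x → x ^ q ≈ x
  fermat x with x ≟𝔽 0#
  ... | yes x≈0 = trans (SemiringExp.^-congˡ semiring q x≈0) (trans (0^q q (ℕ.<⇒≤ 2≤q)) (sym x≈0))
  ... | no x≉0 = begin
    x ^ q                        ≈⟨ product-but-one q x (index 0#) g g-zero g-other ⟨
    x * Π.sum g                  ≈⟨ *-congˡ (cancelˡ P≉0 (begin
      P * Π.sum g                                ≈⟨ *-comm _ _ ⟩
      Π.sum g * P                                ≈⟨ Π.∑-distrib-+ g (λ i → h (element i)) ⟨
      Π.sum (λ i → g i * h (element i))          ≈⟨ Π.sum-cong-≋ (λ i → scaled (element i)) ⟨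
      Π.sum (λ i → h (x * element i))            ≈⟨ sum-bijection *-commutativeMonoid h h-cong (x *_) (x ⁻¹ *_)
                                                     *-congˡ *-congˡ
                                                     (λ y → undo (inverseʳ x≉0) y) (λ y → undo (inverseˡ x≉0) y) ⟨
      P                                          ≈⟨ *-identityʳ P ⟨
      P * 1#                                     ∎)) ⟩
    x * 1#                       ≈⟨ *-identityʳ x ⟩
    x                            ∎
    where
    undo : ∀ {a b} → a * b ≈ 1# → ∀ y → a * (b * y) ≈ y
    undo e y = trans (sym (*-assoc _ _ y)) (trans (*-congʳ e) (*-identityˡ y))
    select : ∀ {y} → Carrier → Carrier → Dec (y ≈ 0#) → Carrier
    select a b (yes _) = a
    select a b (no _) = b
    h : Carrier → Carrier
    h y = select 1# y (y ≟𝔽 0#)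
    factor : Carrier → Carrier
    factor y = select 1# x (y ≟𝔽 0#)
    g : Fin q → Carrier
    g i = factor (element i)
    P = Π.sum (λ i → h (element i))
    h-cong : ∀ {y z} → y ≈ z → h y ≈ h z
    h-cong {y} {z} e with y ≟𝔽 0# | z ≟𝔽 0#
    ... | yes _ | yes _ = refl
    ... | yes p | no n = contradiction (trans (sym e) p) n
    ... | no n | yes p = contradiction (trans e p) n
    ... | no _ | no _ = e
    h≉0 : ∀ y → h y ≉ 0#
    h≉0 y with y ≟𝔽 0#
    ... | yes _ = λ e → 0≉1 (sym e)
    ... | no n = n
    P≉0 : P ≉ 0#
    P≉0 = product-≉0 q _ (λ i → h≉0 (element i))
    scaled : ∀ y → h (x * y) ≈ factor y * h y
    scaled y with y ≟𝔽 0# | (x * y) ≟𝔽 0#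
    ... | yes _ | yes _ = sym (*-identityˡ 1#)
    ... | yes p | no n = contradiction (trans (*-congˡ p) (zeroʳ x)) n
    ... | no n | yes p = contradiction p (*-≉0 x≉0 n)
    ... | no _ | no _ = refl
    g-zero : g (index 0#) ≈ 1#
    g-zero with element (index 0#) ≟𝔽 0#
    ... | yes _ = refl
    ... | no n = contradiction (element-index 0#) n
    g-other : ∀ i → i ≢ index 0# → g i ≈ x
    g-other i i≢ with element i ≟𝔽 0#
    ... | yes p = contradiction (≡.trans (≡.sym (index-element i)) (E.from-cong p)) i≢
    ... | no _ = refl

-- Fields containing 𝔽q: power sums and the Frobenius map

module FieldExtension {c₁ ℓ₁ c ℓ} (𝔽 : FiniteField c₁ ℓ₁) (K : Field c ℓ)
  (_≟_ : Decidable (Field._≈_ K)) (ι : FiniteField.Carrier 𝔽 → Field.Carrier K)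
  (ι-homo : RingMorphisms.IsRingHomomorphism (FiniteField.rawRing 𝔽) (Field.rawRing K) ι) where

  private module 𝔽 = FiniteField 𝔽
  open Field K hiding (zero)
  open FiniteFieldProperties 𝔽
  open DiscreteField K _≟_
  open RingMorphisms.IsRingHomomorphism ι-homo renaming (⟦⟧-cong to ι-cong)
  open RingProperties ring
  open SemiringSum semiring hiding (sum)
  open SemiringExp semiring using (^-congˡ)
  open SemiringMult semiring using (×-congʳ; ×-assoc-*) renaming (_×_ to _×′_)
  open SetoidReasoning setoid
  private q = 𝔽.q

  ι-≉0 : ∀ {x} → x 𝔽.≉ 𝔽.0# → ι x ≉ 0#
  ι-≉0 {x} x≉0 e = 0≉1 (begin
    0#                  ≈⟨ zeroˡ _ ⟨
    0# * ι (x 𝔽.⁻¹)     ≈⟨ *-congʳ e ⟨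
    ι x * ι (x 𝔽.⁻¹)    ≈⟨ *-homo _ _ ⟨
    ι (x 𝔽.* x 𝔽.⁻¹)    ≈⟨ ι-cong (𝔽.inverseʳ x≉0) ⟩
    ι 𝔽.1#              ≈⟨ 1#-homo ⟩
    1#                  ∎)

  ι-≈0 : ∀ {x} → ι x ≈ 0# → x 𝔽.≈ 𝔽.0#
  ι-≈0 {x} e with x ≟𝔽 𝔽.0#
  ... | yes p = p
  ... | no n = contradiction e (ι-≉0 n)

  ι-injective : ∀ {x y} → ι x ≈ ι y → x 𝔽.≈ y
  ι-injective {x} {y} e = RingProperties.x∙y⁻¹≈ε⇒x≈y 𝔽.ring x y (ι-≈0 (begin
    ι (x 𝔽.- y)    ≈⟨ +-homo _ _ ⟩
    ι x + ι (𝔽.- y) ≈⟨ +-cong e (-‿homo y) ⟩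
    ι y - ι y      ≈⟨ -‿inverseʳ _ ⟩
    0#             ∎))

  ι-^ : ∀ x n → ι (x 𝔽.^ n) ≈ ι x ^ n
  ι-^ x zero = 1#-homo
  ι-^ x (suc n) = trans (*-homo _ _) (*-congˡ (ι-^ x n))

  ι-^q : ∀ x → ι x ^ q ≈ ι x
  ι-^q x = trans (sym (ι-^ x q)) (ι-cong (fermat x))

  points : Fin q → Carrier
  points i = ι (element i)

  points-distinct : ∀ i j → points i ≈ points j → i ≡ j
  points-distinct i j e = element-injective i j (ι-injective e)

  -- The q elements of 𝔽q are already roots of X^q - X, and one more root would be too many.
  fixed⇒∈ι : ∀ {x} → x ^ q ≈ x → ∃[ a ] ι a ≈ x
  fixed⇒∈ι {x} fixed with Fin.any? (λ i → points i ≟ x)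
  ... | yes (i , e) = element i , e
  ... | no n = contradiction all-fixed (no-more q 2≤q points points-distinct n)
    where
    all-fixed : (∀ i → points i ^ q ≈ points i) × x ^ q ≈ x
    all-fixed = (λ i → ι-^q (element i)) , fixed
    -- The number q is generalised to n, so that it can be matched with s + 2.
    no-more : ∀ n → 2 ℕ.≤ n → (r : Fin n → Carrier) → (∀ i j → r i ≈ r j → i ≡ j) →
      ¬ (∃[ i ] r i ≈ x) → ¬ ((∀ i → r i ^ n ≈ r i) × x ^ n ≈ x)
    no-more (suc (suc s)) (s≤s (s≤s _)) r distinct x∉r (fixed , x-fixed) =
      ¬fixed-by-power s r′ distinct′ λ { zero → x-fixed ; (suc i) → fixed i }
      where
      r′ : Fin (3 ℕ.+ s) → Carrier
      r′ zero = x
      r′ (suc i) = r i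
      distinct′ : ∀ i j → r′ i ≈ r′ j → i ≡ j
      distinct′ zero zero e = ≡.refl
      distinct′ zero (suc j) e = contradiction (j , sym e) x∉r
      distinct′ (suc i) zero e = contradiction (i , e) x∉r
      distinct′ (suc i) (suc j) e = ≡.cong suc (distinct i j e)

  -- For s = 0 the translation by 1 permutes 𝔽q, so adding the sum of ones to the sum of all
  -- elements changes nothing. For s > 0 the scaling by g shows that gˢ S = S; if S were nonzero,
  -- every g would be a root of X^(s+1) - X, which has at most s + 1 < q roots.
  powerSum : ∀ s → suc s ℕ.< q → sum (λ i → points i ^ s) ≈ 0#
  powerSum zero _ = +-identityʳ-unique S₁ S₀ (begin
    S₁ + S₀                                   ≈⟨ ∑-distrib-+ points (λ _ → 1#) ⟨
    sum (λ i → points i + 1#)                 ≈⟨ sum-cong-≋ {q} (λ i → trans (+-homo (element i) 𝔽.1#) (+-congˡ 1#-homo)) ⟨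
    sum (λ i → ι (element i 𝔽.+ 𝔽.1#))        ≈⟨ sum-bijection +-commutativeMonoid ι ι-cong
                                                  (𝔽._+ 𝔽.1#) (𝔽._- 𝔽.1#) 𝔽.+-congʳ 𝔽.+-congʳ
                                                  (𝔽R.//-rightDividesˡ 𝔽.1#) (𝔽R.//-rightDividesʳ 𝔽.1#) ⟨
    S₁                                        ∎)
    where
    module 𝔽R = RingProperties 𝔽.ring
    S₁ = sum points
    S₀ = sum {q} (λ _ → 1#)
  powerSum s@(suc s′) s+1<q with sum (λ i → points i ^ s) ≟ 0#
  ... | yes e = e
  ... | no S≉0 = contradiction (λ i → fixed (element (Fin.inject≤ i s+1<q)))
    (¬fixed-by-power s′ (λ i → points (Fin.inject≤ i s+1<q))
      (λ i j e → Fin.inject≤-injective s+1<q s+1<q i j (points-distinct _ _ e)))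
    where
    S = sum (λ i → points i ^ s)
    invariant : ∀ g → g 𝔽.≉ 𝔽.0# → ι g ^ s * S ≈ S
    invariant g g≉0 = begin
      ι g ^ s * S                             ≈⟨ *-distribˡ-sum (ι g ^ s) (λ i → points i ^ s) ⟩
      sum (λ i → ι g ^ s * points i ^ s)      ≈⟨ sum-cong-≋ {q} (λ i → trans (^-congˡ s (*-homo g (element i)))
                                                  (CommutativeSemiringExp.^-distrib-* commutativeSemiring (ι g) (points i) s)) ⟨
      sum (λ i → ι (g 𝔽.* element i) ^ s)     ≈⟨ sum-bijection +-commutativeMonoid (λ x → ι x ^ s)
                                                  (λ e → ^-congˡ s (ι-cong e)) (g 𝔽.*_) (g 𝔽.⁻¹ 𝔽.*_) 𝔽.*-congˡ 𝔽.*-congˡ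
                                                  (undo (𝔽.inverseʳ g≉0)) (undo (𝔽.trans (𝔽.*-comm _ _) (𝔽.inverseʳ g≉0))) ⟨
      S                                       ∎
      where
      undo : ∀ {a b} → a 𝔽.* b 𝔽.≈ 𝔽.1# → ∀ y → a 𝔽.* (b 𝔽.* y) 𝔽.≈ y
      undo e y = 𝔽.trans (𝔽.sym (𝔽.*-assoc _ _ y)) (𝔽.trans (𝔽.*-congʳ e) (𝔽.*-identityˡ y))
    fixed : ∀ g → ι g ^ suc s ≈ ι g
    fixed g with g ≟𝔽 𝔽.0#
    ... | yes e = trans (*-congʳ ιg≈0) (trans (zeroˡ _) (sym ιg≈0))
      where ιg≈0 = trans (ι-cong e) 0#-homo
    ... | no n = trans (*-congˡ (cancelˡ S≉0 (trans (*-comm _ _) (trans (invariant g n) (sym (*-identityʳ S))))))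
                   (*-identityʳ _)

  private
    -- The inner binomial coefficients for the exponent p + 1, those of X, ..., X^p.
    coefficients : ∀ p → Fin p → Carrier
    coefficients p i = (suc p ℕ.C suc (toℕ i)) ×′ 1#

    expansion : ∀ p x y → (x + y) ^ suc p ≈
      y ^ suc p + (sum {p} (λ i → coefficients p i * (x ^ suc (toℕ i) * y ^ (p ∸ toℕ i))) + x ^ suc p)
    expansion p x y = begin
      (x + y) ^ suc p                      ≈⟨ Binomial.theorem commutativeSemiring (suc p) x y ⟩
      t zero + sum {suc p} (λ i → t (suc i)) ≈⟨ +-cong first (trans (sum-init-last {p} (λ i → t (suc i)))
                                                (+-cong (sum-cong-≋ {p} middle) last)) ⟩
      _ ∎
      where
      t : Fin (2 ℕ.+ p) → Carrier
      t i = (suc p ℕ.C toℕ i) ×′ (x ^ toℕ i * y ^ (suc p ∸ toℕ i))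
      single : ∀ {m z} → m ≡ 1 → m ×′ z ≈ z
      single ≡.refl = +-identityʳ _
      first : t zero ≈ y ^ suc p
      first = trans (single (≡.trans (nCk≡nC[n∸k] {k = 0} {n = suc p} z≤n) (nCn≡1 (suc p)))) (*-identityˡ _)
      middle : ∀ i → t (suc (inject₁ i)) ≈ coefficients p i * (x ^ suc (toℕ i) * y ^ (p ∸ toℕ i))
      middle i rewrite Fin.toℕ-inject₁ i = trans (×-congʳ (suc p ℕ.C suc (toℕ i)) (sym (*-identityˡ _)))
        (sym (×-assoc-* (suc p ℕ.C suc (toℕ i)) 1# _))
      last : t (suc (fromℕ p)) ≈ x ^ suc p
      last rewrite Fin.toℕ-fromℕ p = trans (single (nCn≡1 (suc p)))
        (trans (*-congˡ (reflexive (≡.cong (y ^_) (ℕ.n∸n≡0 p)))) (*-identityʳ _))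

    eval-tabulate : ∀ {n} (b : Fin n → Carrier) x → eval (Vec.tabulate b) x ≈ sum (λ i → b i * x ^ toℕ i)
    eval-tabulate {zero} b x = refl
    eval-tabulate {suc n} b x = +-cong (sym (*-identityʳ _)) (begin
      x * eval (Vec.tabulate (b ∘ suc)) x            ≈⟨ *-congˡ (eval-tabulate (b ∘ suc) x) ⟩
      x * sum (λ i → b (suc i) * x ^ toℕ i)          ≈⟨ *-distribˡ-sum x (λ i → b (suc i) * x ^ toℕ i) ⟩
      sum (λ i → x * (b (suc i) * x ^ toℕ i))        ≈⟨ sum-cong-≋ {n} (λ i → swap x (b (suc i)) (x ^ toℕ i)) ⟩
      sum (λ i → b (suc i) * (x * x ^ toℕ i))        ∎)
      where
      swap : ∀ x y z → x * (y * z) ≈ y * (x * z)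
      swap x y z = trans (sym (*-assoc _ _ _)) (trans (*-congʳ (*-comm x y)) (*-assoc _ _ _))

    tabulate-zero : ∀ {n} (b : Fin n → Carrier) → All (_≈ 0#) (Vec.tabulate b) → ∀ i → b i ≈ 0#
    tabulate-zero b (e ∷ _) zero = e
    tabulate-zero b (_ ∷ h) (suc i) = tabulate-zero (b ∘ suc) h i

    -- The polynomial (X + 1)ⁿ - Xⁿ - 1 has degree less than n, and the n given
    -- points are roots, so that its coefficients, which are binomial, vanish.
    additive : ∀ p (r : Fin (suc p) → Carrier) → (∀ i j → r i ≈ r j → i ≡ j) →
      (∀ i → r i ^ suc p ≈ r i) → (∀ i → (r i + 1#) ^ suc p ≈ r i + 1#) →
      ∀ x y → (x + y) ^ suc p ≈ x ^ suc p + y ^ suc p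
    additive p r distinct fixed fixed+1 x y = begin
      (x + y) ^ suc p                                ≈⟨ expansion p x y ⟩
      y ^ suc p + (sum {p} _ + x ^ suc p)
        ≈⟨ +-congˡ (+-congʳ (trans (sum-cong-≋ {p} (λ i → trans (*-congʳ (vanish i)) (zeroˡ _))) (sum-replicate-zero p))) ⟩
      y ^ suc p + (0# + x ^ suc p)                   ≈⟨ +-congˡ (+-identityˡ _) ⟩
      y ^ suc p + x ^ suc p                          ≈⟨ +-comm _ _ ⟩
      x ^ suc p + y ^ suc p                          ∎
      where
      b = coefficients p
      open SemiringSolver commutativeSemiring using (solve; _:+_; _:*_; _:=_)
      root : ∀ i → eval (0# ∷ Vec.tabulate b) (r i) ≈ 0#
      root i = +-identityʳ-unique (1# + ξ) _ (begin
        1# + ξ + (0# + ξ * eval (Vec.tabulate b) ξ)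
          ≈⟨ +-congˡ (trans (+-identityˡ _) (trans (*-congˡ (eval-tabulate b ξ))
               (*-distribˡ-sum ξ (λ j → b j * ξ ^ toℕ j)))) ⟩
        1# + ξ + sum (λ j → ξ * (b j * ξ ^ toℕ j))
          ≈⟨ +-cong (+-cong (sym (1^n≈1 (suc p))) (sym (fixed i))) (sum-cong-≋ {p} λ j → term j) ⟩
        1# ^ suc p + ξ ^ suc p + sum (λ j → b j * (ξ ^ suc (toℕ j) * 1# ^ (p ∸ toℕ j)))
          ≈⟨ trans (+-assoc _ _ _) (+-congˡ (+-comm _ _)) ⟩
        1# ^ suc p + (sum (λ j → b j * (ξ ^ suc (toℕ j) * 1# ^ (p ∸ toℕ j))) + ξ ^ suc p)
          ≈⟨ expansion p ξ 1# ⟨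
        (ξ + 1#) ^ suc p ≈⟨ fixed+1 i ⟩
        ξ + 1#           ≈⟨ +-comm _ _ ⟩
        1# + ξ           ∎)
        where
        ξ = r i
        term : ∀ j → ξ * (b j * ξ ^ toℕ j) ≈ b j * (ξ ^ suc (toℕ j) * 1# ^ (p ∸ toℕ j))
        term j = trans (solve 3 (λ x b y → x :* (b :* y) := b :* (x :* y)) refl ξ (b j) (ξ ^ toℕ j))
          (*-congˡ (sym (trans (*-congˡ {ξ ^ suc (toℕ j)} (1^n≈1 (p ∸ toℕ j))) (*-identityʳ _))))
      vanish : ∀ i → b i ≈ 0#
      vanish = tabulate-zero b (All.tail (roots⇒zero (0# ∷ Vec.tabulate b) r distinct root))

  -- This does not pass through a prime p with q a power of p. That x^q = x and (x + 1)^q = x + 1 at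
  -- all q points of 𝔽q already forces the inner binomial coefficients to vanish.
  frobenius-+ : ∀ x y → (x + y) ^ q ≈ x ^ q + y ^ q
  frobenius-+ = go q 2≤q points points-distinct (λ i → ι-^q (element i)) (λ i → begin
    (points i + 1#) ^ q          ≈⟨ ^-congˡ q (sum-homo i) ⟨
    ι (element i 𝔽.+ 𝔽.1#) ^ q   ≈⟨ ι-^q _ ⟩
    ι (element i 𝔽.+ 𝔽.1#)       ≈⟨ sum-homo i ⟩
    points i + 1#                ∎)
    where
    sum-homo : ∀ i → ι (element i 𝔽.+ 𝔽.1#) ≈ points i + 1#
    sum-homo i = trans (+-homo _ _) (+-congˡ 1#-homo)
    go : ∀ n → 2 ℕ.≤ n → (r : Fin n → Carrier) → (∀ i j → r i ≈ r j → i ≡ j) →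
      (∀ i → r i ^ n ≈ r i) → (∀ i → (r i + 1#) ^ n ≈ r i + 1#) → ∀ x y → (x + y) ^ n ≈ x ^ n + y ^ n
    go (suc p) _ = additive p

-- Sums over a finite-dimensional 𝔽q-subspace

-- The last q-adic digits of two numbers with sum q^(i+1) - 1 add up to q - 1.
complement-digit : ∀ q .{{_ : ℕ.NonZero q}} i m k → suc (m ℕ.+ k) ≡ q ℕ.^ suc i →
  ∃[ m′ ] suc (m′ ℕ.+ k / q) ≡ q ℕ.^ i × m ≡ (q ∸ 1 ∸ k % q) ℕ.+ q ℕ.* m′ × k % q ℕ.≤ q ∸ 1
complement-digit q i m k e = m′ , e′ , ℕ.+-cancelʳ-≡ (suc k) m _ equation , d≤
  where
  open ≡.≡-Reasoning
  open +-*-Solver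
  suc-pred-q : suc (q ∸ 1) ≡ q
  suc-pred-q = ℕ.suc-pred q
  k′ = k / q
  d = k % q
  m′ = q ℕ.^ i ∸ suc k′
  d≤ : d ℕ.≤ q ∸ 1
  d≤ = ℕ.s≤s⁻¹ (≡.subst (d ℕ.<_) (≡.sym suc-pred-q) (m%n<n k q))
  e′ : suc (m′ ℕ.+ k′) ≡ q ℕ.^ i
  e′ = ≡.trans (≡.sym (ℕ.+-suc m′ k′)) (ℕ.m∸n+n≡m (m<n*o⇒m/o<n (≡.subst (suc k ℕ.≤_)
    (≡.trans e (ℕ.*-comm q (q ℕ.^ i))) (s≤s (ℕ.m≤n+m k m)))))
  equation : m ℕ.+ suc k ≡ (q ∸ 1 ∸ d) ℕ.+ q ℕ.* m′ ℕ.+ suc k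
  equation = begin
    m ℕ.+ suc k                                       ≡⟨ ℕ.+-suc m k ⟩
    suc (m ℕ.+ k)                                     ≡⟨ e ⟩
    q ℕ.* q ℕ.^ i                                     ≡⟨ ≡.cong (q ℕ.*_) e′ ⟨
    q ℕ.* suc (m′ ℕ.+ k′)                             ≡⟨ ℕ.*-suc q _ ⟩
    q ℕ.+ q ℕ.* (m′ ℕ.+ k′)                           ≡⟨ ≡.cong (ℕ._+ q ℕ.* (m′ ℕ.+ k′))
                                                         (≡.trans (≡.cong suc (ℕ.m∸n+n≡m d≤)) suc-pred-q) ⟨
    suc (q ∸ 1 ∸ d ℕ.+ d) ℕ.+ q ℕ.* (m′ ℕ.+ k′)       ≡⟨ solve 5 (λ a d q m k →
                                                         (con 1 :+ (a :+ d)) :+ q :* (m :+ k) :=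
                                                         (a :+ q :* m) :+ (con 1 :+ (d :+ k :* q)))
                                                         ≡.refl (q ∸ 1 ∸ d) d q m′ k′ ⟩
    (q ∸ 1 ∸ d) ℕ.+ q ℕ.* m′ ℕ.+ suc (d ℕ.+ k′ ℕ.* q) ≡⟨ ≡.cong (λ x → (q ∸ 1 ∸ d) ℕ.+ q ℕ.* m′ ℕ.+ suc x) (m≡m%n+[m/n]*n k q) ⟨
    (q ∸ 1 ∸ d) ℕ.+ q ℕ.* m′ ℕ.+ suc k                ∎

module LinearForms {c₁ ℓ₁ c ℓ} (𝔽 : FiniteField c₁ ℓ₁) (K : Field c ℓ)
  (_≟_ : Decidable (Field._≈_ K)) (ι : FiniteField.Carrier 𝔽 → Field.Carrier K)
  (ι-homo : RingMorphisms.IsRingHomomorphism (FiniteField.rawRing 𝔽) (Field.rawRing K) ι) where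

  private module 𝔽 = FiniteField 𝔽
  open Field K hiding (zero)
  open FiniteFieldProperties 𝔽
  open DiscreteField K _≟_
  open FieldExtension 𝔽 K _≟_ ι ι-homo
  open RingMorphisms.IsRingHomomorphism ι-homo renaming (⟦⟧-cong to ι-cong)
  open RingProperties ring
  open SemiringSum semiring hiding (sum)
  open SemiringExp semiring using (^-congˡ; ^-homo-*; ^-assocʳ)
  open CommutativeSemiringExp commutativeSemiring using (^-distrib-*)
  open SetoidReasoning setoid
  open SemiringSolver commutativeSemiring using (solve; _:+_; _:*_; _:=_)

  private
    q = 𝔽.q
    instance
      q≢0 : ℕ.NonZero q
      q≢0 = ℕ.>-nonZero (ℕ.<⇒≤ 2≤q)

    suc-pred-q : suc (q ∸ 1) ≡ q
    suc-pred-q = ℕ.m+[n∸m]≡n (ℕ.<⇒≤ 2≤q)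

  -- Used in two roles: with a basis of V it gives the element λ with coordinates v, and with a
  -- vector of zeros and a one it gives a coefficient of an entry of a.
  linear : ∀ {D} → Vec Carrier D → Vec 𝔽.Carrier D → Carrier
  linear [] [] = 0#
  linear (w ∷ ws) (x ∷ v) = ι x * w + linear ws v

  total : ∀ D → (Vec 𝔽.Carrier D → Carrier) → Carrier
  total zero f = f []
  total (suc D) f = sum λ i → total D λ v → f (element i ∷ v)

  total-cong : ∀ D {f g : Vec 𝔽.Carrier D → Carrier} → (∀ v → f v ≈ g v) → total D f ≈ total D g
  total-cong zero h = h []
  total-cong (suc D) h = sum-cong-≋ {q} λ i → total-cong D λ v → h (element i ∷ v)

  total-+ : ∀ D f g → total D (λ v → f v + g v) ≈ total D f + total D g
  total-+ zero f g = refl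
  total-+ (suc D) f g = trans (sum-cong-≋ {q} λ i → total-+ D (λ v → f (element i ∷ v)) (λ v → g (element i ∷ v)))
    (∑-distrib-+ {q} (λ i → total D λ v → f (element i ∷ v)) (λ i → total D λ v → g (element i ∷ v)))

  total-* : ∀ D a f → total D (λ v → a * f v) ≈ a * total D f
  total-* zero a f = refl
  total-* (suc D) a f = trans (sum-cong-≋ {q} λ i → total-* D a (λ v → f (element i ∷ v)))
    (sym (*-distribˡ-sum {q} a (λ i → total D λ v → f (element i ∷ v))))

  total-zero : ∀ D {f : Vec 𝔽.Carrier D → Carrier} → (∀ v → f v ≈ 0#) → total D f ≈ 0#
  total-zero D h = trans (total-cong D λ v → trans (h v) (sym (zeroˡ 1#)))
    (trans (total-* D 0# (λ _ → 1#)) (zeroˡ _))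

  total-sum : ∀ D n (f : Fin n → Vec 𝔽.Carrier D → Carrier) →
    total D (λ v → sum λ i → f i v) ≈ sum λ i → total D (f i)
  total-sum D zero f = total-zero D (λ _ → refl)
  total-sum D (suc n) f = trans (total-+ D (f zero) (λ v → sum λ i → f (suc i) v))
    (+-congˡ (total-sum D n (λ i → f (suc i))))

  linearProduct : ∀ {D} → List (Vec Carrier D) → Vec 𝔽.Carrier D → Carrier
  linearProduct [] v = 1#
  linearProduct (u ∷ us) v = linear u v * linearProduct us v

  linearProduct-++ : ∀ {D} (us us′ : List (Vec Carrier D)) v →
    linearProduct (us ++ us′) v ≈ linearProduct us v * linearProduct us′ v
  linearProduct-++ [] us′ v = sym (*-identityˡ _)
  linearProduct-++ (u ∷ us) us′ v = trans (*-congˡ (linearProduct-++ us us′ v)) (sym (*-assoc _ _ _))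

  linearProduct-replicate : ∀ {D} n (u : Vec Carrier D) v → linearProduct (replicate n u) v ≈ linear u v ^ n
  linearProduct-replicate zero u v = refl
  linearProduct-replicate (suc n) u v = *-congˡ (linearProduct-replicate n u v)

  -- Expanding the product in the first coordinate x gives terms xˢ P(v), where
  -- P is a product of linear forms and either s < q - 1 or P has few factors.
  total-linearProduct : ∀ D (us : List (Vec Carrier D)) → length us ℕ.< D ℕ.* (q ∸ 1) →
    total D (linearProduct us) ≈ 0#
  total-linearProduct (suc D) us h = trans
    (total-cong (suc D) {linearProduct us} {term 0 [] us} λ { (x ∷ v) → sym (trans (*-identityˡ _) (*-identityˡ _)) })
    (expand 0 [] us h)
    where
    term : ℕ → List (Vec Carrier D) → List (Vec Carrier (suc D)) → Vec 𝔽.Carrier (suc D) → Carrier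
    term s done todo (x ∷ v) = ι x ^ s * (linearProduct done v * linearProduct todo (x ∷ v))

    expand : ∀ s done todo → s ℕ.+ length done ℕ.+ length todo ℕ.< (q ∸ 1) ℕ.+ D ℕ.* (q ∸ 1) →
      total (suc D) (term s done todo) ≈ 0#
    expand s done [] h = begin
      sum (λ i → total D (λ v → points i ^ s * (linearProduct done v * 1#)))
        ≈⟨ sum-cong-≋ {q} (λ i → trans (total-cong D (λ v → *-congˡ (*-identityʳ _)))
             (total-* D (points i ^ s) (linearProduct done))) ⟩
      sum (λ i → points i ^ s * T) ≈⟨ *-distribʳ-sum {q} T (λ i → points i ^ s) ⟨
      sum (λ i → points i ^ s) * T ≈⟨ case ⟩
      0# ∎
      where
      T = total D (linearProduct done)
      case : sum (λ i → points i ^ s) * T ≈ 0#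
      case with s ℕ.<? q ∸ 1
      ... | yes s<q-1 = trans (*-congʳ (powerSum s (≡.subst (suc s ℕ.<_) suc-pred-q (s≤s s<q-1)))) (zeroˡ T)
      ... | no s≮q-1 = trans (*-congˡ (total-linearProduct D done (ℕ.+-cancelˡ-< (q ∸ 1) _ _
        (ℕ.≤-<-trans (ℕ.≤-trans (ℕ.+-monoˡ-≤ (length done) (ℕ.≮⇒≥ s≮q-1)) (ℕ.m≤m+n _ 0)) h)))) (zeroʳ _)
    expand s done ((w ∷ ws) ∷ todo) h = begin
      total (suc D) (term s done ((w ∷ ws) ∷ todo))
        ≈⟨ total-cong (suc D) {term s done ((w ∷ ws) ∷ todo)}
             {λ v → w * term (suc s) done todo v + term s (ws ∷ done) todo v} (λ { (x ∷ v) → solve 6 (λ p P x w l Q →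
             p :* (P :* ((x :* w :+ l) :* Q)) := w :* ((x :* p) :* (P :* Q)) :+ p :* ((l :* P) :* Q))
             refl (ι x ^ s) (linearProduct done v) (ι x) w (linear ws v) (linearProduct todo (x ∷ v)) }) ⟩
      total (suc D) (λ v → w * term (suc s) done todo v + term s (ws ∷ done) todo v)
        ≈⟨ total-+ (suc D) (λ v → w * term (suc s) done todo v) (term s (ws ∷ done) todo) ⟩
      total (suc D) (λ v → w * term (suc s) done todo v) + total (suc D) (term s (ws ∷ done) todo)
        ≈⟨ +-cong (trans (total-* (suc D) w (term (suc s) done todo))
             (trans (*-congˡ (expand (suc s) done todo (≡.subst (ℕ._< (q ∸ 1) ℕ.+ D ℕ.* (q ∸ 1)) (ℕ.+-suc _ (length todo)) h))) (zeroʳ w)))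
             (expand s (ws ∷ done) todo (≡.subst (ℕ._< (q ∸ 1) ℕ.+ D ℕ.* (q ∸ 1))
               (≡.trans (ℕ.+-suc _ (length todo)) (≡.cong (ℕ._+ length todo) (≡.sym (ℕ.+-suc s (length done))))) h)) ⟩
      0# + 0# ≈⟨ +-identityˡ 0# ⟩
      0# ∎

  *-^q : ∀ x y → (ι x * y) ^ q ≈ ι x * y ^ q
  *-^q x y = trans (^-distrib-* (ι x) y q) (*-congʳ (ι-^q x))

  0^q≈0 : 0# ^ q ≈ 0#
  0^q≈0 = trans (reflexive (≡.cong (0# ^_) (≡.sym suc-pred-q))) (zeroˡ _)

  linear-^q : ∀ {D} (w : Vec Carrier D) v → linear w v ^ q ≈ linear (Vec.map (_^ q) w) v
  linear-^q [] [] = 0^q≈0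
  linear-^q (w ∷ ws) (x ∷ v) = trans (frobenius-+ (ι x * w) (linear ws v)) (+-cong (*-^q x w) (linear-^q ws v))

  -- The number s below is the sum of the q-adic digits of k; those of
  -- m = qⁱ - 1 - k are complementary, and λ ↦ λ^(q^j) is linear.
  power-as-linearProduct : ∀ {D} i (w : Vec Carrier D) m k → suc (m ℕ.+ k) ≡ q ℕ.^ i →
    ∃[ us ] ∃[ s ] (∀ v → linear w v ^ m ≈ linearProduct us v) × length us ℕ.+ s ℕ.≤ i ℕ.* (q ∸ 1) ×
      (s ≡ 0 → k ≡ 0) × (s ≡ 1 → ∃[ l ] k ≡ q ℕ.^ l)
  power-as-linearProduct zero w zero zero e = [] , 0 , (λ v → refl) , z≤n , (λ _ → ≡.refl) , λ ()
  power-as-linearProduct (suc i) w m k e =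
    replicate (q ∸ 1 ∸ d) w ++ us , d ℕ.+ s , product′ , bound′ , zero′ , one′
    where
    digit = complement-digit q i m k e
    m′ = proj₁ digit
    k′ = k / q
    d = k % q
    m≡ = proj₁ (proj₂ (proj₂ digit))
    d≤ = proj₂ (proj₂ (proj₂ digit))
    -- The remaining exponent q m′ is the exponent m′ of λ^q, which is the form with coefficients
    -- `Vec.map (_^ q) w`.
    IH = power-as-linearProduct i (Vec.map (_^ q) w) m′ k′ (proj₁ (proj₂ digit))
    us = proj₁ IH
    s = proj₁ (proj₂ IH)
    product = proj₁ (proj₂ (proj₂ IH))
    bound = proj₁ (proj₂ (proj₂ (proj₂ IH)))
    s≡0 = proj₁ (proj₂ (proj₂ (proj₂ (proj₂ IH))))
    s≡1 = proj₂ (proj₂ (proj₂ (proj₂ (proj₂ IH))))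
    product′ : ∀ v → linear w v ^ m ≈ linearProduct (replicate (q ∸ 1 ∸ d) w ++ us) v
    product′ v = begin
      λᵥ ^ m                                    ≈⟨ reflexive (≡.cong (λᵥ ^_) m≡) ⟩
      λᵥ ^ ((q ∸ 1 ∸ d) ℕ.+ q ℕ.* m′)           ≈⟨ ^-homo-* λᵥ (q ∸ 1 ∸ d) (q ℕ.* m′) ⟩
      λᵥ ^ (q ∸ 1 ∸ d) * λᵥ ^ (q ℕ.* m′)
        ≈⟨ *-cong (linearProduct-replicate (q ∸ 1 ∸ d) w v)
             (trans (sym (product v)) (trans (^-congˡ m′ (sym (linear-^q w v))) (^-assocʳ λᵥ q m′))) ⟨
      linearProduct (replicate (q ∸ 1 ∸ d) w) v * linearProduct us v
        ≈⟨ linearProduct-++ (replicate (q ∸ 1 ∸ d) w) us v ⟨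
      linearProduct (replicate (q ∸ 1 ∸ d) w ++ us) v ∎
      where λᵥ = linear w v
    bound′ : length (replicate (q ∸ 1 ∸ d) w ++ us) ℕ.+ (d ℕ.+ s) ℕ.≤ (q ∸ 1) ℕ.+ i ℕ.* (q ∸ 1)
    bound′ = ℕ.≤-trans (ℕ.≤-reflexive (≡.trans
      (≡.cong (ℕ._+ (d ℕ.+ s)) (≡.trans (List.length-++ (replicate (q ∸ 1 ∸ d) w))
        (≡.cong (ℕ._+ length us) (List.length-replicate (q ∸ 1 ∸ d)))))
      (N.solve 4 (λ a b d s → (a N.:+ b) N.:+ (d N.:+ s) N.:= (a N.:+ d) N.:+ (b N.:+ s))
        ≡.refl (q ∸ 1 ∸ d) (length us) d s)))
      (ℕ.+-mono-≤ (ℕ.≤-reflexive (ℕ.m∸n+n≡m d≤)) bound)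
      where module N = +-*-Solver
    k≡ : ∀ {a b} → d ≡ a → k′ ≡ b → k ≡ a ℕ.+ b ℕ.* q
    k≡ ea eb = ≡.trans (m≡m%n+[m/n]*n k q) (≡.cong₂ (λ a b → a ℕ.+ b ℕ.* q) ea eb)
    zero′ : d ℕ.+ s ≡ 0 → k ≡ 0
    zero′ h = k≡ (ℕ.m+n≡0⇒m≡0 d h) (s≡0 (ℕ.m+n≡0⇒n≡0 d h))
    one′ : d ℕ.+ s ≡ 1 → ∃[ l ] k ≡ q ℕ.^ l
    one′ h = split d s ≡.refl ≡.refl h
      where
      -- The only nonzero digit is a 1. Either it lies above the lowest place and k = q q^l, or it
      -- is the lowest digit and k = 1.
      split : ∀ a b → d ≡ a → s ≡ b → a ℕ.+ b ≡ 1 → ∃[ l ] k ≡ q ℕ.^ l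
      split zero b ea eb h with s≡1 (≡.trans eb h)
      ... | l , e = suc l , ≡.trans (k≡ ea e) (ℕ.*-comm _ q)
      split (suc zero) zero ea eb h = 0 , k≡ ea (s≡0 eb)

  -- Linearised polynomials and the annihilator of a subspace

  -- cs represents the linearised polynomial Σ csᵢ X^(qⁱ).
  evalL : ∀ {n} → Vec Carrier n → Carrier → Carrier
  evalL [] ξ = 0#
  evalL (c ∷ cs) ξ = c * ξ + evalL cs (ξ ^ q)

  evalL-cong : ∀ {n} (cs : Vec Carrier n) {ξ η} → ξ ≈ η → evalL cs ξ ≈ evalL cs η
  evalL-cong [] e = refl
  evalL-cong (c ∷ cs) e = +-cong (*-congˡ e) (evalL-cong cs (^-congˡ q e))

  evalL-+ : ∀ {n} (cs : Vec Carrier n) ξ η → evalL cs (ξ + η) ≈ evalL cs ξ + evalL cs η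
  evalL-+ [] ξ η = sym (+-identityˡ 0#)
  evalL-+ (c ∷ cs) ξ η = begin
    c * (ξ + η) + evalL cs ((ξ + η) ^ q)
      ≈⟨ +-congˡ (trans (evalL-cong cs (frobenius-+ ξ η)) (evalL-+ cs (ξ ^ q) (η ^ q))) ⟩
    c * (ξ + η) + (evalL cs (ξ ^ q) + evalL cs (η ^ q))
      ≈⟨ solve 5 (λ c x y a b → c :* (x :+ y) :+ (a :+ b) := (c :* x :+ a) :+ (c :* y :+ b))
           refl c ξ η (evalL cs (ξ ^ q)) (evalL cs (η ^ q)) ⟩
    c * ξ + evalL cs (ξ ^ q) + (c * η + evalL cs (η ^ q)) ∎

  evalL-ι : ∀ {n} (cs : Vec Carrier n) x ξ → evalL cs (ι x * ξ) ≈ ι x * evalL cs ξ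
  evalL-ι [] x ξ = sym (zeroʳ _)
  evalL-ι (c ∷ cs) x ξ = begin
    c * (ι x * ξ) + evalL cs ((ι x * ξ) ^ q)
      ≈⟨ +-congˡ (trans (evalL-cong cs (*-^q x ξ)) (evalL-ι cs x (ξ ^ q))) ⟩
    c * (ι x * ξ) + ι x * evalL cs (ξ ^ q)
      ≈⟨ solve 4 (λ c x y a → c :* (x :* y) :+ x :* a := x :* (c :* y :+ a)) refl c (ι x) ξ (evalL cs (ξ ^ q)) ⟩
    ι x * (c * ξ + evalL cs (ξ ^ q)) ∎

  evalL-frobenius : ∀ {n} (cs : Vec Carrier n) ξ → evalL (Vec.map (_^ q) cs) (ξ ^ q) ≈ evalL cs ξ ^ q
  evalL-frobenius [] ξ = sym 0^q≈0
  evalL-frobenius (c ∷ cs) ξ = begin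
    c ^ q * ξ ^ q + evalL (Vec.map (_^ q) cs) ((ξ ^ q) ^ q)
      ≈⟨ +-cong (sym (^-distrib-* c ξ q)) (evalL-frobenius cs (ξ ^ q)) ⟩
    (c * ξ) ^ q + evalL cs (ξ ^ q) ^ q ≈⟨ frobenius-+ _ _ ⟨
    (c * ξ + evalL cs (ξ ^ q)) ^ q ∎

  evalL-zipWith : ∀ {n} (a b : Vec Carrier n) ξ → evalL (Vec.zipWith _+_ a b) ξ ≈ evalL a ξ + evalL b ξ
  evalL-zipWith [] [] ξ = sym (+-identityˡ 0#)
  evalL-zipWith (a ∷ as) (b ∷ bs) ξ = trans (+-congˡ (evalL-zipWith as bs (ξ ^ q)))
    (solve 5 (λ a b x s t → (a :+ b) :* x :+ (s :+ t) := (a :* x :+ s) :+ (b :* x :+ t))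
      refl a b ξ (evalL as (ξ ^ q)) (evalL bs (ξ ^ q)))

  evalL-scale : ∀ {n} a (cs : Vec Carrier n) ξ → evalL (Vec.map (a *_) cs) ξ ≈ a * evalL cs ξ
  evalL-scale a [] ξ = sym (zeroʳ a)
  evalL-scale a (c ∷ cs) ξ = trans (+-cong (*-assoc a c ξ) (evalL-scale a cs (ξ ^ q))) (sym (distribˡ a _ _))

  evalL-∷ʳ : ∀ {n} (cs : Vec Carrier n) ξ → evalL (cs Vec.∷ʳ 0#) ξ ≈ evalL cs ξ
  evalL-∷ʳ [] ξ = trans (+-identityʳ _) (zeroˡ ξ)
  evalL-∷ʳ (c ∷ cs) ξ = +-congˡ (evalL-∷ʳ cs (ξ ^ q))

  evalL-sum : ∀ {n} (cs : Vec Carrier n) ξ → evalL cs ξ ≈ sum λ i → Vec.lookup cs i * ξ ^ (q ℕ.^ toℕ i)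
  evalL-sum [] ξ = refl
  evalL-sum {suc n} (c ∷ cs) ξ = +-cong (*-congˡ (sym (*-identityʳ ξ))) (trans (evalL-sum cs (ξ ^ q))
    (sum-cong-≋ {n} λ i → *-congˡ (^-assocʳ ξ q (q ℕ.^ toℕ i))))

  Independent : ∀ {D} → Vec Carrier D → Set _
  Independent w = ∀ v → linear w v ≈ 0# → All (𝔽._≈ 𝔽.0#) v

  -- The field `kernel`, that e has no zeros outside V, is what carries the induction: it makes e(μ)
  -- nonzero for the next basis vector μ, and with it the new coefficient of X.
  record Annihilator {D} (w : Vec Carrier D) : Set (c₁ ⊔ c ⊔ ℓ) where
    field
      constant  : Carrier
      higher    : Vec Carrier D
      nonzero   : constant ≉ 0#
      vanishing : ∀ v → evalL (constant ∷ higher) (linear w v) ≈ 0#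
      kernel    : ∀ ξ → evalL (constant ∷ higher) ξ ≈ 0# → ∃[ v ] linear w v ≈ ξ

  -- e_{V + 𝔽q μ} = e_V^q - e_V(μ)^(q-1) e_V.
  annihilator : ∀ {D} (w : Vec Carrier D) → Independent w → Annihilator w
  annihilator [] _ = record
    { constant = 1# ; higher = [] ; nonzero = λ e → 0≉1 (sym e)
    ; vanishing = λ { [] → trans (+-identityʳ _) (zeroʳ 1#) }
    ; kernel = λ ξ e → [] , sym (trans (sym (trans (+-identityʳ _) (*-identityˡ ξ))) e) }
  annihilator {suc D} (μ ∷ w) independent = record
    -- The form with `0# +` is the first entry of `e′` as it computes. Prepending 0 raises each term
    -- of e to the power q, and the appended 0 brings both summands to the same length.
    { constant = 0# + a * constant
    ; higher = Vec.zipWith _+_ (Vec.map (_^ q) e) (Vec.map (a *_) (higher Vec.∷ʳ 0#))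
    ; nonzero = λ h → *-≉0 a≉0 nonzero (trans (sym (+-identityˡ _)) h)
    ; vanishing = vanishing′
    ; kernel = kernel′ }
    where
    open Annihilator (annihilator w λ v h → All.tail (independent (𝔽.0# ∷ v)
      (trans (+-cong (trans (*-congʳ 0#-homo) (zeroˡ μ)) h) (+-identityˡ 0#))))
    e = constant ∷ higher
    u = evalL e μ
    -- Otherwise μ would lie in the span of w, and -1 followed by its coordinates would be a
    -- nontrivial relation.
    u≉0 : u ≉ 0#
    u≉0 h with kernel μ h
    ... | v , e = contradiction (𝔽R.-‿injective (𝔽.trans (All.head (independent ((𝔽.- 𝔽.1#) ∷ v) (begin
      ι (𝔽.- 𝔽.1#) * μ + linear w v ≈⟨ +-cong (trans (*-congʳ (trans (-‿homo _) (-‿cong 1#-homo))) (-1*x≈-x μ)) e ⟩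
      - μ + μ                       ≈⟨ -‿inverseˡ μ ⟩
      0#                            ∎))) (𝔽.sym 𝔽R.-0#≈0#))) λ h → 𝔽.0≉1 (𝔽.sym h)
      where module 𝔽R = RingProperties 𝔽.ring
    b = u ^ (q ∸ 1)
    b≉0 : b ≉ 0#
    b≉0 = ^-≉0 (q ∸ 1) u≉0
    a = - b
    a≉0 : a ≉ 0#
    a≉0 h = b≉0 (-‿injective (trans h (sym -0#≈0#)))
    frobenius = 0# ∷ Vec.map (_^ q) e
    scaled = Vec.map (a *_) (e Vec.∷ʳ 0#)
    e′ = Vec.zipWith _+_ frobenius scaled
    e′-eval : ∀ ξ → evalL e′ ξ ≈ evalL e ξ ^ q - b * evalL e ξ
    e′-eval ξ = trans (evalL-zipWith frobenius scaled ξ) (+-cong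
      (trans (+-cong (zeroˡ ξ) (evalL-frobenius e ξ)) (+-identityˡ _))
      (trans (evalL-scale a (e Vec.∷ʳ 0#) ξ) (trans (*-congˡ (evalL-∷ʳ e ξ)) (sym (-‿distribˡ-* b _)))))
    u^q : u ^ q ≈ u * b
    u^q = reflexive (≡.cong (u ^_) (≡.sym suc-pred-q))
    eval-span : ∀ x ξ → evalL e (ι x * μ + ξ) ≈ ι x * u + evalL e ξ
    eval-span x ξ = trans (evalL-+ e (ι x * μ) ξ) (+-congʳ (evalL-ι e x μ))
    vanishing′ : ∀ v → evalL e′ (linear (μ ∷ w) v) ≈ 0#
    vanishing′ (x ∷ v) = begin
      evalL e′ (ι x * μ + linear w v) ≈⟨ e′-eval _ ⟩
      y ^ q - b * y                   ≈⟨ +-cong (^-congˡ q y≈) (-‿cong (*-congˡ y≈)) ⟩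
      (ι x * u) ^ q - b * (ι x * u)
        ≈⟨ +-cong (trans (*-^q x u) (*-congˡ u^q)) (-‿cong (solve 3 (λ b x u → b :* (x :* u) := x :* (u :* b)) refl b (ι x) u)) ⟩
      ι x * (u * b) - ι x * (u * b)   ≈⟨ -‿inverseʳ _ ⟩
      0#                              ∎
      where
      y = evalL e (ι x * μ + linear w v)
      y≈ : y ≈ ι x * u
      y≈ = trans (eval-span x (linear w v)) (trans (+-congˡ (vanishing v)) (+-identityʳ _))
    -- If e′(ξ) = 0, the quotient t of e(ξ) by u satisfies t^q = t and so lies in 𝔽q; then ξ - t μ
    -- is a zero of e and belongs to the span of w.
    kernel′ : ∀ ξ → evalL e′ ξ ≈ 0# → ∃[ v ] linear (μ ∷ w) v ≈ ξ
    kernel′ ξ h = x ∷ proj₁ k , (begin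
      ι x * μ + linear w (proj₁ k) ≈⟨ +-congˡ (proj₂ k) ⟩
      ι x * μ + (ξ - ι x * μ)      ≈⟨ +-comm _ _ ⟩
      ξ - ι x * μ + ι x * μ        ≈⟨ //-rightDividesˡ _ ξ ⟩
      ξ                            ∎)
      where
      y = evalL e ξ
      t = y * u ⁻¹
      y≈ : y ≈ t * u
      y≈ = sym (trans (*-assoc _ _ _) (trans (*-congˡ (inverseˡ u≉0)) (*-identityʳ y)))
      y^q : y ^ q ≈ b * y
      y^q = x∙y⁻¹≈ε⇒x≈y _ _ (trans (sym (e′-eval ξ)) h)
      t^q : t ^ q ≈ t
      t^q = cancelˡ (^-≉0 q u≉0) (begin
        u ^ q * t ^ q   ≈⟨ *-comm _ _ ⟩
        t ^ q * u ^ q   ≈⟨ ^-distrib-* t u q ⟨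
        (t * u) ^ q     ≈⟨ ^-congˡ q y≈ ⟨
        y ^ q           ≈⟨ y^q ⟩
        b * y           ≈⟨ *-congˡ y≈ ⟩
        b * (t * u)     ≈⟨ solve 3 (λ b t u → b :* (t :* u) := (u :* b) :* t) refl b t u ⟩
        u * b * t       ≈⟨ *-congʳ u^q ⟨
        u ^ q * t       ∎)
      fixed = fixed⇒∈ι t^q
      x = proj₁ fixed
      k = kernel (ξ - ι x * μ) (+-identityʳ-unique (ι x * u) _ (begin
        ι x * u + evalL e (ξ - ι x * μ) ≈⟨ eval-span x _ ⟨
        evalL e (ι x * μ + (ξ - ι x * μ))
          ≈⟨ evalL-cong e (trans (+-comm _ _) (//-rightDividesˡ (ι x * μ) ξ)) ⟩
        y                               ≈⟨ trans y≈ (*-congʳ (sym (proj₂ fixed))) ⟩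
        ι x * u                         ∎))

  -- The factor `linear u v` vanishes at v = 0, so the sum may run over all of V, whatever the value
  -- of `_⁻¹` at 0.
  moment : ∀ {D} → Vec Carrier D → ℕ → Vec Carrier D → Carrier
  moment {D} w k u = total D λ v → linear u v * (linear w v) ⁻¹ ^ k

  linear-zero : ∀ {D} (u : Vec Carrier D) {v} → All (𝔽._≈ 𝔽.0#) v → linear u v ≈ 0#
  linear-zero [] [] = refl
  linear-zero (u ∷ us) (e ∷ es) = trans (+-cong (trans (*-congʳ (trans (ι-cong e) 0#-homo)) (zeroˡ u))
    (linear-zero us es)) (+-identityˡ 0#)

  private
    cancel-^ : ∀ {x} → x ≉ 0# → ∀ n → x ^ n * x ⁻¹ ^ n ≈ 1#
    cancel-^ {x} x≉0 n = trans (sym (^-distrib-* x (x ⁻¹) n)) (trans (^-congˡ n (inverseʳ x≉0)) (1^n≈1 n))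

    negative-power : ∀ {x} → x ≉ 0# → ∀ m n → x ^ m * x ⁻¹ ^ (m ℕ.+ n) ≈ x ⁻¹ ^ n
    negative-power {x} x≉0 m n = begin
      x ^ m * x ⁻¹ ^ (m ℕ.+ n)      ≈⟨ *-congˡ (^-homo-* (x ⁻¹) m n) ⟩
      x ^ m * (x ⁻¹ ^ m * x ⁻¹ ^ n) ≈⟨ *-assoc _ _ _ ⟨
      x ^ m * x ⁻¹ ^ m * x ⁻¹ ^ n   ≈⟨ trans (*-congʳ (cancel-^ x≉0 m)) (*-identityˡ _) ⟩
      x ⁻¹ ^ n                      ∎

    positive-power : ∀ {x} → x ≉ 0# → ∀ m n → x ^ (m ℕ.+ n) * x ⁻¹ ^ n ≈ x ^ m
    positive-power {x} x≉0 m n = begin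
      x ^ (m ℕ.+ n) * x ⁻¹ ^ n   ≈⟨ *-congʳ (^-homo-* x m n) ⟩
      x ^ m * x ^ n * x ⁻¹ ^ n   ≈⟨ *-assoc _ _ _ ⟩
      x ^ m * (x ^ n * x ⁻¹ ^ n) ≈⟨ trans (*-congˡ (cancel-^ x≉0 n)) (*-identityʳ _) ⟩
      x ^ m                      ∎

  -- Multiply the relation Σ eᵢ λ^(qⁱ) = 0 by λ^(-k-1) and sum: the terms with
  -- qⁱ > k are sums of products of few linear forms, hence vanish.
  module MomentRecursion {D} (w : Vec Carrier D) (independent : Independent w)
    (k : ℕ) (1≤k : 1 ℕ.≤ k) (k≢q^ : ∀ l → k ≢ q ℕ.^ l) where
    open Annihilator (annihilator w independent)

    private
      e : Fin D → Carrier
      e = Vec.lookup higher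

      -- The vector `higher` starts after the coefficient of X, hence the exponent i + 1.
      degree : Fin D → ℕ
      degree i = q ℕ.^ suc (toℕ i)

      -- By independence λ = 0 only at the origin, where both sides vanish; everywhere else powers
      -- of λ may be cancelled.
      restrict : ∀ u v {x y} → (linear w v ≉ 0# → x ≈ y) → linear u v * x ≈ linear u v * y
      restrict u v h with linear w v ≟ 0#
      ... | no λ≉0 = *-congˡ (h λ≉0)
      ... | yes λ≈0 = trans (vanish _) (sym (vanish _))
        where
        vanish : ∀ x → linear u v * x ≈ 0#
        vanish x = trans (*-congʳ (linear-zero u (independent v λ≈0))) (zeroˡ x)

      term : Vec Carrier D → Fin D → Carrier
      term u i = total D λ v → linear u v * (linear w v ^ degree i * linear w v ⁻¹ ^ suc k)

      relation : ∀ u → constant * moment w k u + sum (λ i → e i * term u i) ≈ 0#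
      relation u = begin
        constant * moment w k u + sum (λ i → e i * term u i)
          ≈⟨ +-cong (total-* D constant (λ v → linear u v * linear w v ⁻¹ ^ k))
               (trans (total-sum D D (λ i v → e i * summand i v)) (sum-cong-≋ {D} λ i → total-* D (e i) (summand i))) ⟨
        total D (λ v → constant * (linear u v * linear w v ⁻¹ ^ k)) + total D (λ v → sum λ i → e i * summand i v)
          ≈⟨ total-+ D (λ v → constant * (linear u v * linear w v ⁻¹ ^ k)) (λ v → sum λ i → e i * summand i v) ⟨
        total D (λ v → constant * (linear u v * linear w v ⁻¹ ^ k) + sum (λ i → e i * summand i v))
          ≈⟨ total-zero D pointwise ⟩
        0# ∎
        where
        summand : Fin D → Vec 𝔽.Carrier D → Carrier
        summand i v = linear u v * (linear w v ^ degree i * linear w v ⁻¹ ^ suc k)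
        pointwise : ∀ v → constant * (linear u v * linear w v ⁻¹ ^ k) + sum (λ i → e i * summand i v) ≈ 0#
        pointwise v = begin
          constant * (l * λ⁻ᵏ) + sum (λ i → e i * summand i v)
            ≈⟨ +-cong head (trans (sum-cong-≋ {D} tail) (sym (*-distribˡ-sum {D} (l * λ⁻ᵏ⁻¹) _))) ⟩
          l * λ⁻ᵏ⁻¹ * (constant * x) + l * λ⁻ᵏ⁻¹ * sum (λ i → e i * (x ^ q) ^ (q ℕ.^ toℕ i))
            ≈⟨ trans (distribˡ (l * λ⁻ᵏ⁻¹) (constant * x) _) (+-congˡ (*-congˡ (evalL-sum higher (x ^ q)))) ⟨
          l * λ⁻ᵏ⁻¹ * evalL (constant ∷ higher) x
            ≈⟨ trans (*-congˡ (vanishing v)) (zeroʳ _) ⟩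
          0# ∎
          where
          l = linear u v
          x = linear w v
          λ⁻ᵏ = x ⁻¹ ^ k
          λ⁻ᵏ⁻¹ = x ⁻¹ ^ suc k
          head : constant * (l * λ⁻ᵏ) ≈ l * λ⁻ᵏ⁻¹ * (constant * x)
          head = begin
            constant * (l * λ⁻ᵏ)
              ≈⟨ *-congˡ (restrict u v λ x≉0 → trans (sym (*-identityˡ _)) (*-congʳ (sym (inverseʳ x≉0)))) ⟩
            constant * (l * (x * x ⁻¹ * λ⁻ᵏ))
              ≈⟨ solve 5 (λ c l x y z → c :* (l :* (x :* y :* z)) := l :* (y :* z) :* (c :* x))
                   refl constant l x (x ⁻¹) λ⁻ᵏ ⟩
            l * λ⁻ᵏ⁻¹ * (constant * x) ∎
          tail : ∀ i → e i * summand i v ≈ l * λ⁻ᵏ⁻¹ * (e i * (x ^ q) ^ (q ℕ.^ toℕ i))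
          tail i = trans (solve 4 (λ e l x y → e :* (l :* (x :* y)) := l :* y :* (e :* x))
            refl (e i) l (x ^ degree i) λ⁻ᵏ⁻¹) (*-congˡ (*-congˡ (sym (^-assocʳ x q (q ℕ.^ toℕ i)))))

      low-term : ∀ u i → degree i ℕ.≤ k → term u i ≈ moment w (suc k ∸ degree i) u
      low-term u i d≤k = total-cong D λ v → restrict u v λ x≉0 →
        trans (*-congˡ (reflexive (≡.cong (linear w v ⁻¹ ^_) (≡.sym (ℕ.m+[n∸m]≡n (ℕ.m≤n⇒m≤1+n d≤k))))))
          (negative-power x≉0 (degree i) (suc k ∸ degree i))

      high-term : ∀ u i → k ℕ.< degree i → term u i ≈ 0#
      high-term u i k<d = trans
        (total-cong D λ v → trans
          (restrict u v λ x≉0 → trans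
            (*-congʳ (reflexive (≡.cong (linear w v ^_) (≡.sym (ℕ.m∸n+n≡m k<d)))))
            (positive-power x≉0 m (suc k)))
          (*-congˡ (product v)))
        (total-linearProduct D (u ∷ us) (few s ≡.refl))
        where
        m = degree i ∸ suc k
        digits = power-as-linearProduct (suc (toℕ i)) w m k
          (≡.trans (≡.sym (ℕ.+-suc m k)) (ℕ.m∸n+n≡m k<d))
        us = proj₁ digits
        s = proj₁ (proj₂ digits)
        product = proj₁ (proj₂ (proj₂ digits))
        bound = proj₁ (proj₂ (proj₂ (proj₂ digits)))
        -- The list gets one more factor, the form u. The cases s = 0 and s = 1 would make k zero or
        -- a power of q; for s at least 2 the bound (i + 1)(q - 1) - s on the length leaves room for
        -- u.
        few : ∀ s′ → s′ ≡ s → suc (length us) ℕ.< D ℕ.* (q ∸ 1)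
        few 0 e = contradiction (proj₁ (proj₂ (proj₂ (proj₂ (proj₂ digits)))) (≡.sym e)) (ℕ.>⇒≢ 1≤k)
        few 1 e = contradiction (proj₂ l) (k≢q^ (proj₁ l))
          where l = proj₂ (proj₂ (proj₂ (proj₂ (proj₂ digits)))) (≡.sym e)
        few (suc (suc s″)) e = ℕ.≤-trans (ℕ.≤-trans
          (ℕ.≤-trans (ℕ.≤-reflexive (ℕ.+-comm 2 (length us))) (ℕ.+-monoʳ-≤ (length us)
            (≡.subst (2 ℕ.≤_) e (s≤s (s≤s z≤n)))))
          bound) (ℕ.*-monoˡ-≤ (q ∸ 1) (Fin.toℕ<n i))

      choose : (i : Fin D) → Dec (degree i ℕ.≤ k) → Carrier × ℕ
      choose i (yes _) = e i , suc k ∸ degree i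
      -- A vanishing term keeps its place with coefficient 0; the placeholder weight 1 is in range
      -- because k, not being q^0, exceeds 1.
      choose i (no _) = 0# , 1

      choice : Fin D → Carrier × ℕ
      choice i = choose i (degree i ℕ.≤? k)

      1<k : 1 ℕ.< k
      1<k = ℕ.≤∧≢⇒< 1≤k (λ e → k≢q^ 0 (≡.sym e))

      choose-range : ∀ i d → 1 ℕ.≤ proj₂ (choose i d) × proj₂ (choose i d) ℕ.< k
      choose-range i (yes d≤k) = ℕ.m<n⇒0<n∸m (s≤s d≤k) ,
        ℕ.≤-trans (ℕ.≤-reflexive (≡.sym (ℕ.+-∸-assoc 1 (ℕ.m≤n⇒m≤1+n d≤k))))
          (ℕ.∸-monoʳ-≤ (2 ℕ.+ k) (ℕ.≤-trans 2≤q (ℕ.m≤m*n q (q ℕ.^ toℕ i) {{ℕ.m^n≢0 q (toℕ i)}})))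
      choose-range i (no _) = ℕ.≤-refl , 1<k

      choose-term : ∀ u i d → e i * term u i ≈ proj₁ (choose i d) * moment w (proj₂ (choose i d)) u
      choose-term u i (yes d≤k) = *-congˡ (low-term u i d≤k)
      choose-term u i (no d≰k) = trans (trans (*-congˡ (high-term u i (ℕ.≰⇒> d≰k))) (zeroʳ _)) (sym (zeroˡ _))

    exponent : Fin D → ℕ
    exponent i = proj₂ (choice i)

    exponent-range : ∀ i → 1 ℕ.≤ exponent i × exponent i ℕ.< k
    exponent-range i = choose-range i (degree i ℕ.≤? k)

    weight : Fin D → Carrier
    weight i = - constant ⁻¹ * proj₁ (choice i)

    -- The weights and exponents do not depend on u, so the same relation holds for every
    -- coefficient of every entry and becomes one between vectors over 𝕋.
    recursion : ∀ u → moment w k u ≈ sum λ i → weight i * moment w (exponent i) u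
    recursion u = cancelˡ nonzero (begin
      constant * moment w k u   ≈⟨ +-inverseˡ-unique _ _ (relation u) ⟩
      - sum (λ i → e i * term u i) ≈⟨ -‿cong (sum-cong-≋ {D} λ i → choose-term u i (degree i ℕ.≤? k)) ⟩
      - sum terms               ≈⟨ -1*x≈-x _ ⟨
      - 1# * sum terms          ≈⟨ *-congʳ (-‿cong (inverseʳ nonzero)) ⟨
      - (constant * constant ⁻¹) * sum terms ≈⟨ *-congʳ (-‿distribʳ-* _ _) ⟩
      constant * - constant ⁻¹ * sum terms ≈⟨ *-assoc _ _ _ ⟩
      constant * (- constant ⁻¹ * sum terms) ≈⟨ *-congˡ (*-distribˡ-sum {D} (- constant ⁻¹) terms) ⟩
      constant * sum (λ i → - constant ⁻¹ * terms i)
        ≈⟨ *-congˡ (sum-cong-≋ {D} λ i → sym (*-assoc (- constant ⁻¹) (proj₁ (choice i)) (moment w (exponent i) u))) ⟩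
      constant * sum (λ i → weight i * moment w (exponent i) u) ∎)
      where
      terms : Fin D → Carrier
      terms i = proj₁ (choice i) * moment w (exponent i) u

-- Polynomials in θ

module Valuation {c₁ ℓ₁ c ℓ} (𝔽 : FiniteField c₁ ℓ₁) (ℂ∞ : CompletedClosure 𝔽 c ℓ) where
  private module 𝔽 = FiniteField 𝔽
  open CompletedClosure ℂ∞ hiding (zero)
  open Estimates 𝔽 ℂ∞
  open FiniteFieldProperties 𝔽
  open RingProperties ring
  open RingMorphisms.IsRingHomomorphism ι-isRingHomomorphism renaming (⟦⟧-cong to ι-cong)
  open SemiringSum semiring hiding (sum)
  open SetoidReasoning setoid

  infix 4 _≟_
  -- The logarithm decides: it is -∞ exactly at 0.
  _≟_ : Decidable _≈_
  x ≟ y with log∣ x - y ∣ in eq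
  ... | ⊥₋ = yes (x∙y⁻¹≈ε⇒x≈y x y (log-⊥ eq))
  ... | [ d ] = no λ e → contradiction
    (≡.trans (≡.sym eq) (≡.trans (log-cong (x≈y⇒x∙y⁻¹≈ε e)) log-0)) λ ()

  open DiscreteField fieldStructure _≟_ public
  open FieldExtension 𝔽 fieldStructure _≟_ ι ι-isRingHomomorphism public

  private
    ≤₋-≡ : ∀ {x y : ℚ ₋} {e} → x ≡ y → y ≤₋ e → x ≤₋ e
    ≤₋-≡ ≡.refl p = p

    ℚ-<⇒≱ : ∀ {a b} → a ℚ.< b → ¬ b ℚ.≤ a
    ℚ-<⇒≱ a<b b≤a = ℚ.<-irrefl ≡.refl (ℚ.<-≤-trans a<b b≤a)

    []-injective : ∀ {a b : ℚ} → _≡_ {A = ℚ ₋} [ a ] [ b ] → a ≡ b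
    []-injective ≡.refl = ≡.refl

  ∣x∣≤all⇒x≈0 : ∀ {x} → (∀ e → ∣ x ∣≤q^ e) → x ≈ 0#
  ∣x∣≤all⇒x≈0 {x} h with log∣ x ∣ in eq
  ... | ⊥₋ = log-⊥ eq
  ... | [ d ] = contradiction ([≤]-injective (h (d ℚ.- 1ℚ))) (ℚ-<⇒≱ d-1<d)
    where
    d-1<d : d ℚ.- 1ℚ ℚ.< d
    d-1<d = ≡.subst (d ℚ.- 1ℚ ℚ.<_) (ℚ.+-identityʳ d)
      (ℚ.+-monoʳ-< d {ℚ.- 1ℚ} {0ℚ} (ℚ.negative⁻¹ (ℚ.- 1ℚ)))

  -- If log |x| > 0, the logarithms of the powers of x increase, against x^q = x.
  log-ι : ∀ x → ∣ ι x ∣≤q^ 0ℚ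
  log-ι x with log∣ ι x ∣ in eq
  ... | ⊥₋ = ⊥₋≤ _
  ... | [ d ] with d ℚ.≤? 0ℚ
  ... | yes d≤0 = [ d≤0 ]
  ... | no d≰0 = contradiction (go 𝔽.q 2≤q (≡.trans (log-cong (ι-^q x)) eq)) λ ()
    where
    d>0 : 0ℚ ℚ.< d
    d>0 = ℚ.≰⇒> d≰0
    log-power : ∀ n → ∃[ d′ ] log∣ ι x ^ suc n ∣ ≡ [ d′ ] × 0ℚ ℚ.< d′
    log-power zero = d , ≡.trans (log-cong (*-identityʳ (ι x))) eq , d>0
    log-power (suc n) =
      let (d′ , e , d′>0) = log-power n in
      d ℚ.+ d′ , ≡.trans (log-* _ _) (≡.cong₂ _+₋_ eq e) , ℚ.+-mono-< d>0 d′>0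
    go : ∀ n → 2 ℕ.≤ n → log∣ ι x ^ n ∣ ≡ [ d ] → 1 ≡ 0
    go (suc (suc n)) _ h =
      let (d′ , e , d′>0) = log-power n in
      contradiction (≡.sym (RingProperties.+-identityʳ-unique ℚ.+-*-ring d d′
        ([]-injective (≡.trans (≡.sym (≡.trans (log-* _ _) (≡.cong₂ _+₋_ eq e))) h))))
        (ℚ.<⇒≢ d′>0)
    go (suc zero) (s≤s ()) _

  -- The logarithms of an element and its inverse add up to 0, and the latter is at most 0.
  log-ι-nonzero : ∀ {x} → x 𝔽.≉ 𝔽.0# → ∃[ d ] log∣ ι x ∣ ≡ [ d ] × 0ℚ ℚ.≤ d
  log-ι-nonzero {x} x≉0 with log∣ ι x ∣ in eq | log∣ ι (x 𝔽.⁻¹) ∣ in eq′ | log-ι (x 𝔽.⁻¹)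
  ... | ⊥₋ | _ | _ = contradiction (log-⊥ eq) (ι-≉0 x≉0)
  ... | [ d ] | ⊥₋ | _ = contradiction (≡.trans (≡.sym product) (≡.cong₂ _+₋_ eq eq′)) λ ()
    where
    product : log∣ ι x ∣ +₋ log∣ ι (x 𝔽.⁻¹) ∣ ≡ [ 0ℚ ]
    product = ≡.trans (≡.sym (log-* _ _)) (≡.trans (log-cong (trans (sym (*-homo _ _))
      (trans (ι-cong (𝔽.inverseʳ x≉0)) 1#-homo))) log-1)
  ... | [ d ] | [ d′ ] | [ d′≤0 ] = d , ≡.refl , ≡.subst (ℚ._≤ d) d+d′≡0
      (≡.subst (d ℚ.+ d′ ℚ.≤_) (ℚ.+-identityʳ d) (ℚ.+-monoʳ-≤ d d′≤0))
    where
    d+d′≡0 : d ℚ.+ d′ ≡ 0ℚ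
    d+d′≡0 = []-injective (≡.trans (≡.sym (≡.trans (log-* _ _) (≡.cong₂ _+₋_ eq eq′)))
      (≡.trans (log-cong (trans (sym (*-homo _ _)) (trans (ι-cong (𝔽.inverseʳ x≉0)) 1#-homo))) log-1))

  private
    Aq = A 𝔽 ℂ∞
    infix 4 _≈A_
    _≈A_ = _≈ᴬ_ 𝔽 ℂ∞
    cf = coeff 𝔽 ℂ∞
    ev = evalθ 𝔽 ℂ∞

  evalθ-zero : ∀ a → a ≈A [] → ev a ≈ 0#
  evalθ-zero [] h = refl
  evalθ-zero (x ∷ a) h = trans (+-cong (trans (ι-cong (h 0)) 0#-homo)
    (trans (*-congˡ (evalθ-zero a (h ∘ suc))) (zeroʳ θ))) (+-identityˡ 0#)

  private
    evalθ-large : ∀ x a {d} → log∣ ev a ∣ ≡ [ d ] → 0ℚ ℚ.≤ d → ¬ ∣ ev (x ∷ a) ∣≤q^ 0ℚ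
    evalθ-large x a {d} e 0≤d small = ℚ-<⇒≱ (ℚ.+-mono-<-≤ {0ℚ} {1ℚ} (ℚ.positive⁻¹ 1ℚ) 0≤d)
      ([≤]-injective (≤₋-≡ (≡.sym (≡.trans (log-* θ (ev a)) (≡.cong₂ _+₋_ log-θ e)))
        (∣∣-cong (xyx⁻¹≈y (ι x) (θ * ev a)) (log-+ small (∣-∣≤ (log-ι x))))))

  -- A Horner step multiplies by θ, of logarithm 1, and adds a constant of logarithm at most 0, so
  -- once the value is nonzero its logarithm stays nonnegative. Hence A embeds in ℂ∞.
  log-evalθ : ∀ a → a ≈A [] ⊎ (∃[ d ] log∣ ev a ∣ ≡ [ d ] × 0ℚ ℚ.≤ d)
  log-evalθ [] = inj₁ λ _ → 𝔽.refl
  log-evalθ (x ∷ a) with log-evalθ a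
  log-evalθ (x ∷ a) | inj₁ a≈0 with x ≟𝔽 𝔽.0#
  ... | yes x≈0 = inj₁ λ { zero → x≈0 ; (suc n) → a≈0 n }
  ... | no x≉0 =
    let (d , e , 0≤d) = log-ι-nonzero x≉0 in
    inj₂ (d , ≡.trans (log-cong (trans (+-congˡ (trans (*-congˡ (evalθ-zero a a≈0)) (zeroʳ θ))) (+-identityʳ _))) e , 0≤d)
  log-evalθ (x ∷ a) | inj₂ (d , e , 0≤d) with log∣ ev (x ∷ a) ∣ in eq
  ... | ⊥₋ = contradiction (≤₋-≡ eq (⊥₋≤ _)) (evalθ-large x a e 0≤d)
  ... | [ d′ ] with d′ ℚ.≤? 0ℚ
  ... | no d′≰0 = inj₂ (d′ , ≡.refl , ℚ.<⇒≤ (ℚ.≰⇒> d′≰0))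
  ... | yes d′≤0 = contradiction (≤₋-≡ eq [ d′≤0 ]) (evalθ-large x a e 0≤d)

  evalθ-injective : ∀ a → ev a ≈ 0# → a ≈A []
  evalθ-injective a h with log-evalθ a
  ... | inj₁ a≈0 = a≈0
  ... | inj₂ (d , e , _) = contradiction (≡.trans (≡.sym e) (≡.trans (log-cong h) log-0)) λ ()

  θ≉0 : θ ≉ 0#
  θ≉0 h = contradiction (≡.trans (≡.sym log-θ) (≡.trans (log-cong h) log-0)) λ ()

  private
    -- The Laurent expansion of a polynomial of degree at most N starts at θᴺ.
    digit : (ℕ → 𝔽.Carrier) → ℕ → ℕ → 𝔽.Carrier
    digit c N       zero    = c N
    digit c zero    (suc i) = 𝔽.0#
    digit c (suc N) (suc i) = digit c N i

    polynomial : (ℕ → 𝔽.Carrier) → ℕ → Carrier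
    polynomial c zero = ι (c 0)
    polynomial c (suc N) = ι (c (suc N)) * θ ^ suc N + polynomial c N

    partialSum : ∀ c N n → N ℕ.< n →
      sum {n} (λ i → ι (digit c N (toℕ i)) * (θ ^ N * (θ ⁻¹) ^ toℕ i)) ≈ polynomial c N
    partialSum c zero (suc n) _ = trans (+-cong
      (trans (*-congˡ (*-identityˡ 1#)) (*-identityʳ _))
      (trans (sum-cong-≋ {n} (λ i → trans (*-congʳ 0#-homo) (zeroˡ _))) (sum-replicate-zero n)))
      (+-identityʳ _)
    partialSum c (suc N) (suc n) (s≤s N<n) = +-cong (*-congˡ (*-identityʳ _))
      (trans (sum-cong-≋ {n} λ i → *-congˡ (shift (θ ^ N) (θ ⁻¹ ^ toℕ i))) (partialSum c N n N<n))
      where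
      open SemiringSolver commutativeSemiring using (solve; _:*_; _:=_)
      shift : ∀ x y → θ * x * (θ ⁻¹ * y) ≈ x * y
      shift x y = trans (solve 4 (λ t s x y → t :* x :* (s :* y) := (t :* s) :* (x :* y)) refl θ (θ ⁻¹) x y)
        (trans (*-congʳ (inverseʳ θ≉0)) (*-identityˡ _))

    polynomial-suc : ∀ c N → polynomial c (suc N) ≈ ι (c 0) + θ * polynomial (c ∘ suc) N
    polynomial-suc c zero = trans (+-comm _ _) (+-congˡ (trans (*-congˡ (*-identityʳ θ)) (*-comm _ _)))
    polynomial-suc c (suc N) = trans (+-congˡ (polynomial-suc c N))
      (solve 5 (λ a t x b p → a :* (t :* x) :+ (b :+ t :* p) := b :+ t :* (a :* x :+ p))
        refl (ι (c (suc (suc N)))) θ (θ ^ suc N) (ι (c 0)) (polynomial (c ∘ suc) N))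
      where open SemiringSolver commutativeSemiring using (solve; _:+_; _:*_; _:=_)

    polynomial-zero : ∀ c N → (∀ n → c n 𝔽.≈ 𝔽.0#) → polynomial c N ≈ 0#
    polynomial-zero c zero h = trans (ι-cong (h 0)) 0#-homo
    polynomial-zero c (suc N) h = trans (+-cong (trans (*-congʳ (trans (ι-cong (h (suc N))) 0#-homo)) (zeroˡ _))
      (polynomial-zero c N h)) (+-identityˡ 0#)

    polynomial-evalθ : ∀ a → polynomial (cf a) (length a) ≈ ev a
    polynomial-evalθ [] = 0#-homo
    polynomial-evalθ (x ∷ a) = trans (polynomial-suc (cf (x ∷ a)) (length a))
      (+-congˡ (*-congˡ (polynomial-evalθ a)))

  evalθ∈K∞ : ∀ a → InK∞ (ev a)
  -- The length exceeds every exponent that occurs, so the leading digit is 0; in return the empty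
  -- list needs no case of its own.
  evalθ∈K∞ a = length a , digit (cf a) (length a) , λ e → suc (length a) , λ n h →
    ∣∣-cong (sym (x≈y⇒x∙y⁻¹≈ε (trans (partialSum (cf a) (length a) n h) (polynomial-evalθ a)))) ∣0∣≤

-- The lattices of vectors of bounded degree

module Lattice {c₁ ℓ₁ c ℓ} (𝔽 : FiniteField c₁ ℓ₁) (ℂ∞ : CompletedClosure 𝔽 c ℓ) where
  private module 𝔽 = FiniteField 𝔽
  open CompletedClosure ℂ∞ hiding (zero)
  open FiniteFieldProperties 𝔽
  open Valuation 𝔽 ℂ∞
  open LinearForms 𝔽 fieldStructure _≟_ ι ι-isRingHomomorphism
  open RingMorphisms.IsRingHomomorphism ι-isRingHomomorphism renaming (⟦⟧-cong to ι-cong)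
  open SemiringSum semiring hiding (sum)
  open SemiringExp semiring using (^-congˡ)
  open SetoidReasoning setoid

  private
    Aq = A 𝔽 ℂ∞
    infix 4 _≈A_
    _≈A_ = _≈ᴬ_ 𝔽 ℂ∞
    cf = coeff 𝔽 ℂ∞
    ev = evalθ 𝔽 ℂ∞

  -- Coordinates on the vectors over A with entries of degree less than d.
  decode : ∀ r d → Vec 𝔽.Carrier (r ℕ.* d) → Vector Aq r
  decode (suc r) d v zero    = Vec.toList (Vec.take d v)
  decode (suc r) d v (suc i) = decode r d (Vec.drop d v) i

  linear-++ : ∀ m {n} (w : Vec Carrier m) (w′ : Vec Carrier n) v →
    linear (w Vec.++ w′) v ≈ linear w (Vec.take m v) + linear w′ (Vec.drop m v)
  linear-++ zero [] w′ v = sym (+-identityˡ _)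
  linear-++ (suc m) (x ∷ w) w′ (y ∷ v) = trans (+-congˡ (linear-++ m w w′ v)) (sym (+-assoc _ _ _))

  linear-scale : ∀ {n} a (w : Vec Carrier n) v → linear (Vec.map (a *_) w) v ≈ a * linear w v
  linear-scale a [] [] = sym (zeroʳ a)
  linear-scale a (w ∷ ws) (x ∷ v) = trans (+-cong
    (solve 3 (λ x a w → x :* (a :* w) := a :* (x :* w)) refl (ι x) a w) (linear-scale a ws v))
    (sym (distribˡ a _ _))
    where open SemiringSolver commutativeSemiring using (solve; _:+_; _:*_; _:=_)

  powers : ∀ d → Vec Carrier d
  powers zero = []
  powers (suc d) = 1# ∷ Vec.map (θ *_) (powers d)

  evalθ-linear : ∀ d v → ev (Vec.toList v) ≈ linear (powers d) v
  evalθ-linear zero [] = refl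
  evalθ-linear (suc d) (x ∷ v) = +-cong (sym (*-identityʳ _))
    (trans (*-congˡ (evalθ-linear d v)) (sym (linear-scale θ (powers d) v)))

  basis : ∀ r d → Vector Carrier r → Vec Carrier (r ℕ.* d)
  basis zero    d z = []
  basis (suc r) d z = Vec.map (z zero *_) (powers d) Vec.++ basis r d (z ∘ suc)

  pairing-linear : ∀ r d z v → pairing 𝔽 ℂ∞ z (decode r d v) ≈ linear (basis r d z) v
  pairing-linear zero d z [] = refl
  pairing-linear (suc r) d z v = begin
    z zero * ev (Vec.toList v₁) + pairing 𝔽 ℂ∞ (z ∘ suc) (decode r d v₂)
      ≈⟨ +-cong (trans (*-congˡ (evalθ-linear d v₁)) (sym (linear-scale (z zero) (powers d) v₁)))
           (pairing-linear r d (z ∘ suc) v₂) ⟩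
    linear (Vec.map (z zero *_) (powers d)) v₁ + linear (basis r d (z ∘ suc)) v₂
      ≈⟨ linear-++ d (Vec.map (z zero *_) (powers d)) (basis r d (z ∘ suc)) v ⟨
    linear (basis (suc r) d z) v ∎
    where
    v₁ = Vec.take d v
    v₂ = Vec.drop d v

  linear-replicate : ∀ n v → linear (Vec.replicate n 0#) v ≈ 0#
  linear-replicate zero [] = refl
  linear-replicate (suc n) (x ∷ v) = trans (+-cong (zeroʳ _) (linear-replicate n v)) (+-identityˡ 0#)

  private
    unit : ∀ d → ℕ → Vec Carrier d
    unit zero    _       = []
    unit (suc d) zero    = 1# ∷ Vec.replicate d 0#
    unit (suc d) (suc n) = 0# ∷ unit d n

    unit-linear : ∀ d n v → linear (unit d n) v ≈ ι (cf (Vec.toList v) n)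
    unit-linear zero n [] = sym 0#-homo
    unit-linear (suc d) zero (x ∷ v) = trans (+-cong (*-identityʳ _) (linear-replicate d v)) (+-identityʳ _)
    unit-linear (suc d) (suc n) (x ∷ v) = trans (+-cong (zeroʳ _) (unit-linear d n v)) (+-identityˡ _)

  -- For n at least d this is the zero form, in agreement with the coefficient of θⁿ, so that n can
  -- range over all coefficients of an element of 𝕋.
  coordinate : ∀ r d → Fin r → ℕ → Vec Carrier (r ℕ.* d)
  coordinate (suc r) d zero    n = unit d n Vec.++ Vec.replicate (r ℕ.* d) 0#
  coordinate (suc r) d (suc i) n = Vec.replicate d 0# Vec.++ coordinate r d i n

  coordinate-linear : ∀ r d i n v → linear (coordinate r d i n) v ≈ ι (cf (decode r d v i) n)
  coordinate-linear (suc r) d zero n v = trans (linear-++ d (unit d n) _ v)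
    (trans (+-cong (unit-linear d n (Vec.take d v)) (linear-replicate (r ℕ.* d) _)) (+-identityʳ _))
  coordinate-linear (suc r) d (suc i) n v = trans (linear-++ d (Vec.replicate d 0#) _ v)
    (trans (+-cong (linear-replicate d _) (coordinate-linear r d i n (Vec.drop d v))) (+-identityˡ _))

  private
    toList-zero : ∀ {d} (v : Vec 𝔽.Carrier d) → Vec.toList v ≈A [] → All (𝔽._≈ 𝔽.0#) v
    toList-zero [] h = []
    toList-zero (x ∷ v) h = h 0 ∷ toList-zero v (h ∘ suc)

    toList-injective : ∀ {d} (v v′ : Vec 𝔽.Carrier d) → Vec.toList v ≈A Vec.toList v′ → Pointwise 𝔽._≈_ v v′
    toList-injective [] [] h = []
    toList-injective (x ∷ v) (x′ ∷ v′) h = h 0 ∷ toList-injective v v′ (h ∘ suc)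

    pad : ∀ d → Aq → Vec 𝔽.Carrier d
    pad zero _ = []
    pad (suc d) [] = 𝔽.0# ∷ pad d []
    pad (suc d) (x ∷ a) = x ∷ pad d a

    toList-pad : ∀ d a → length a ℕ.≤ d → Vec.toList (pad d a) ≈A a
    toList-pad zero [] _ n = 𝔽.refl
    toList-pad (suc d) [] _ zero = 𝔽.refl
    toList-pad (suc d) [] _ (suc n) = toList-pad d [] z≤n n
    toList-pad (suc d) (x ∷ a) _ zero = 𝔽.refl
    toList-pad (suc d) (x ∷ a) (s≤s h) (suc n) = toList-pad d a h n

    take-drop-++ : ∀ d {n} (v : Vec 𝔽.Carrier d) (v′ : Vec 𝔽.Carrier n) →
      Vec.take d (v Vec.++ v′) ≡ v × Vec.drop d (v Vec.++ v′) ≡ v′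
    take-drop-++ d v v′ = VecProperties.++-injective (Vec.take d (v Vec.++ v′)) v (VecProperties.take++drop≡id d (v Vec.++ v′))

  decode-zero : ∀ r d v → (∀ i → decode r d v i ≈A []) → All (𝔽._≈ 𝔽.0#) v
  decode-zero zero d [] h = []
  decode-zero (suc r) d v h = ≡.subst (All (𝔽._≈ 𝔽.0#)) (VecProperties.take++drop≡id d v)
    (AllProperties.++⁺ (toList-zero (Vec.take d v) (h zero)) (decode-zero r d (Vec.drop d v) (h ∘ suc)))

  decode-injective : ∀ r d v v′ → (∀ i → decode r d v i ≈A decode r d v′ i) → Pointwise 𝔽._≈_ v v′
  decode-injective zero d [] [] h = []
  decode-injective (suc r) d v v′ h = ≡.subst₂ (Pointwise 𝔽._≈_) (VecProperties.take++drop≡id d v) (VecProperties.take++drop≡id d v′)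
    (Pointwise.++⁺ (toList-injective (Vec.take d v) (Vec.take d v′) (h zero))
      (decode-injective r d (Vec.drop d v) (Vec.drop d v′) (h ∘ suc)))

  decode-surjective : ∀ r d (a : Vector Aq r) → (∀ i → length (a i) ℕ.≤ d) → ∃[ v ] ∀ i → decode r d v i ≈A a i
  decode-surjective zero d a h = [] , λ ()
  decode-surjective (suc r) d a h = v₁ Vec.++ v₂ , λ
    { zero n → 𝔽.trans (𝔽.reflexive (≡.cong (λ v → cf (Vec.toList v) n) (proj₁ split))) (toList-pad d (a zero) (h zero) n)
    ; (suc i) n → 𝔽.trans (𝔽.reflexive (≡.cong (λ v → cf (decode r d v i) n) (proj₂ split))) (proj₂ rest i n) }
    where
    rest = decode-surjective r d (a ∘ suc) (h ∘ suc)
    v₁ = pad d (a zero)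
    v₂ = proj₁ rest
    split = take-drop-++ d v₁ v₂

  private
    toList-cong : ∀ {d} {v v′ : Vec 𝔽.Carrier d} → Pointwise 𝔽._≈_ v v′ → Vec.toList v ≈A Vec.toList v′
    toList-cong [] n = 𝔽.refl
    toList-cong (e ∷ p) zero = e
    toList-cong (e ∷ p) (suc n) = toList-cong p n

    take-cong : ∀ d {n} {v v′ : Vec 𝔽.Carrier (d ℕ.+ n)} → Pointwise 𝔽._≈_ v v′ →
      Pointwise 𝔽._≈_ (Vec.take d v) (Vec.take d v′) × Pointwise 𝔽._≈_ (Vec.drop d v) (Vec.drop d v′)
    take-cong zero p = [] , p
    take-cong (suc d) (e ∷ p) = e ∷ proj₁ (take-cong d p) , proj₂ (take-cong d p)

  decode-cong : ∀ r d {v v′} → Pointwise 𝔽._≈_ v v′ → ∀ i → decode r d v i ≈A decode r d v′ i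
  decode-cong (suc r) d p zero = toList-cong (proj₁ (take-cong d p))
  decode-cong (suc r) d p (suc i) = decode-cong r d (proj₂ (take-cong d p)) i

  -- A relation between the zᵢ θⁿ groups into one between the zᵢ with coefficients in the image of
  -- A, which lies in K∞. These coefficients vanish because z lies in Ω, and A embeds in ℂ∞.
  basis-independent : ∀ r d z → InΩ 𝔽 ℂ∞ z → Independent (basis r d z)
  basis-independent r d z z∈Ω v h = decode-zero r d v λ i → evalθ-injective (decode r d v i)
    (InΩ.independent z∈Ω (λ i → ev (decode r d v i)) (λ i → evalθ∈K∞ (decode r d v i))
      (trans (sum-cong-≋ {r} λ i → *-comm (ev (decode r d v i)) (z i)) (trans (pairing-linear r d z v) h)) i)

  -- Enumeration of the nonzero vectors of bounded degree

  vectorSetoid : ℕ → Setoid _ _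
  vectorSetoid D = VecEquality.≋-setoid 𝔽.setoid D

  vectors : ∀ D → List (Vec 𝔽.Carrier D)
  vectors zero = [] ∷ []
  vectors (suc D) = List.cartesianProductWith _∷_ (List.tabulate element) (vectors D)

  vectors-unique : ∀ D → Uniqueness.Unique (vectorSetoid D) (vectors D)
  vectors-unique zero = ListAll.[] AllPairs.∷ AllPairs.[]
  vectors-unique (suc D) = Unique.cartesianProductWith⁺ 𝔽.setoid (vectorSetoid D) (vectorSetoid (suc D))
    _∷_ (λ { (e ∷ p) → e , p }) (Unique.tabulate⁺ 𝔽.setoid (λ {i} {j} → element-injective i j)) (vectors-unique D)

  ∈-vectors : ∀ D v → Membership._∈_ (vectorSetoid D) v (vectors D)
  ∈-vectors zero [] = here []
  ∈-vectors (suc D) (x ∷ v) = MembershipProperties.∈-cartesianProductWith⁺ 𝔽.setoid (vectorSetoid D) (vectorSetoid (suc D))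
    _∷_ (MembershipProperties.∈-resp-≈ 𝔽.setoid (element-index x) (MembershipProperties.∈-tabulate⁺ 𝔽.setoid (index x))) (∈-vectors D v)

  listSum : ∀ {a} {X : Set a} → (X → Carrier) → List X → Carrier
  listSum f = List.foldr (λ x s → f x + s) 0#

  private
    listSum-++ : ∀ {a} {X : Set a} (f : X → Carrier) xs ys → listSum f (xs List.++ ys) ≈ listSum f xs + listSum f ys
    listSum-++ f [] ys = sym (+-identityˡ _)
    listSum-++ f (x ∷ xs) ys = trans (+-congˡ (listSum-++ f xs ys)) (sym (+-assoc _ _ _))

    listSum-map : ∀ {a b} {X : Set a} {Y : Set b} (f : Y → Carrier) (g : X → Y) xs →
      listSum f (List.map g xs) ≈ listSum (f ∘ g) xs
    listSum-map f g [] = refl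
    listSum-map f g (x ∷ xs) = +-congˡ (listSum-map f g xs)

    listSum-product : ∀ {D} (f : Vec 𝔽.Carrier (suc D) → Carrier) n (g : Fin n → 𝔽.Carrier) vs →
      listSum f (List.cartesianProductWith _∷_ (List.tabulate g) vs) ≈ sum (λ i → listSum (λ v → f (g i ∷ v)) vs)
    listSum-product f zero g vs = refl
    listSum-product f (suc n) g vs = trans (listSum-++ f (List.map (g zero ∷_) vs) _)
      (+-cong (listSum-map f (g zero ∷_) vs) (listSum-product f n (g ∘ suc) vs))

  listSum-vectors : ∀ D f → listSum f (vectors D) ≈ total D f
  listSum-vectors zero f = +-identityʳ _
  listSum-vectors (suc D) f = trans (listSum-product f 𝔽.q element (vectors D))
    (sum-cong-≋ {𝔽.q} λ i → listSum-vectors D (λ v → f (element i ∷ v)))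

  module _ (r d : ℕ) where
    private
      D = r ℕ.* d
      N = nonzeroVectors 𝔽 ℂ∞ r
      open Membership N using (_∈_)

      zero? : ∀ v → Dec (∀ i → decode r d v i ≈A [])
      zero? v = Dec.map′ (λ z i → 𝔽-zero z i) (decode-zero r d v) (All.all? (_≟𝔽 𝔽.0#) v)
        where
        replicate-zero : ∀ {n} {v : Vec 𝔽.Carrier n} → All (𝔽._≈ 𝔽.0#) v → ∀ m → cf (Vec.toList v) m 𝔽.≈ 𝔽.0#
        replicate-zero [] m = 𝔽.refl
        replicate-zero (e ∷ _) zero = e
        replicate-zero (_ ∷ z) (suc m) = replicate-zero z m
        𝔽-zero : ∀ {r} {v : Vec 𝔽.Carrier (r ℕ.* d)} → All (𝔽._≈ 𝔽.0#) v → ∀ i → decode r d v i ≈A []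
        𝔽-zero {suc r} z zero = replicate-zero (AllProperties.take⁺ d z)
        𝔽-zero {suc r} {v} z (suc i) = 𝔽-zero {r} {Vec.drop d v} (AllProperties.drop⁺ d z) i

      keep : ∀ v → Dec (∀ i → decode r d v i ≈A []) → List (NonzeroVector 𝔽 ℂ∞ r) → List (NonzeroVector 𝔽 ℂ∞ r)
      keep v (yes _) as = as
      keep v (no v≉0) as = (decode r d v , v≉0) ∷ as

      nonzeros : List (Vec 𝔽.Carrier D) → List (NonzeroVector 𝔽 ℂ∞ r)
      nonzeros [] = []
      nonzeros (v ∷ vs) = keep v (zero? v) (nonzeros vs)

      nonzeros-∉ : ∀ v vs (v≉0 : ¬ (∀ i → decode r d v i ≈A [])) →
        ListAll.All (λ v′ → ¬ Pointwise 𝔽._≈_ v v′) vs →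
        ListAll.All (λ a → ¬ (∀ i → decode r d v i ≈A proj₁ a i)) (nonzeros vs)
      nonzeros-∉ v [] v≉0 ListAll.[] = ListAll.[]
      nonzeros-∉ v (v′ ∷ vs) v≉0 (p ListAll.∷ ps) with zero? v′
      ... | yes _ = nonzeros-∉ v vs v≉0 ps
      ... | no _ = (λ h → p (decode-injective r d v v′ h)) ListAll.∷ nonzeros-∉ v vs v≉0 ps

      nonzeros-unique : ∀ vs → Uniqueness.Unique (vectorSetoid D) vs → Uniqueness.Unique N (nonzeros vs)
      nonzeros-unique [] AllPairs.[] = AllPairs.[]
      nonzeros-unique (v ∷ vs) (p AllPairs.∷ ps) with zero? v
      ... | yes _ = nonzeros-unique vs ps
      ... | no v≉0 = nonzeros-∉ v vs v≉0 p AllPairs.∷ nonzeros-unique vs ps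

      ∈-nonzeros : ∀ a v vs → (∀ i → decode r d v i ≈A proj₁ a i) → Membership._∈_ (vectorSetoid D) v vs → a ∈ nonzeros vs
      ∈-nonzeros a v (v′ ∷ vs) h v∈ with zero? v′
      ∈-nonzeros a v (v′ ∷ vs) h (here p) | yes v′≈0 =
        contradiction (λ i n → 𝔽.trans (𝔽.sym (h i n)) (𝔽.trans (decode-cong r d p i n) (v′≈0 i n))) (proj₂ a)
      ∈-nonzeros a v (v′ ∷ vs) h (here p) | no _ =
        here λ i n → 𝔽.trans (𝔽.sym (h i n)) (decode-cong r d p i n)
      ∈-nonzeros a v (v′ ∷ vs) h (there v∈) | yes _ = ∈-nonzeros a v vs h v∈
      ∈-nonzeros a v (v′ ∷ vs) h (there v∈) | no _ = there (∈-nonzeros a v vs h v∈)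

    truncation : List (NonzeroVector 𝔽 ℂ∞ r)
    truncation = nonzeros (vectors D)

    truncation-unique : Uniqueness.Unique N truncation
    truncation-unique = nonzeros-unique (vectors D) (vectors-unique D)

    ∈-truncation : ∀ a → (∀ i → length (proj₁ a i) ℕ.≤ d) → a ∈ truncation
    ∈-truncation a h =
      let (v , e) = decode-surjective r d (proj₁ a) h in
      ∈-nonzeros a v (vectors D) e (∈-vectors D v)

    module _ (z : Vector Carrier r) (k : ℕ) (j : Fin r) (n : ℕ) where
      private
        term : NonzeroVector 𝔽 ℂ∞ r → Carrier
        term (a , _) = (pairing 𝔽 ℂ∞ z a ⁻¹) ^ k * ι (cf (a j) n)

        form : Vec 𝔽.Carrier D → Carrier
        form v = linear (coordinate r d j n) v * linear (basis r d z) v ⁻¹ ^ k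

        term-form : ∀ v v≉0 → term (decode r d v , v≉0) ≈ form v
        term-form v v≉0 = trans (*-cong (^-congˡ k (⁻¹-cong (pairing-linear r d z v)))
          (sym (coordinate-linear r d j n v))) (*-comm _ _)

        listSum-nonzeros : ∀ vs → listSum term (nonzeros vs) ≈ listSum form vs
        listSum-nonzeros [] = refl
        listSum-nonzeros (v ∷ vs) with zero? v
        ... | no v≉0 = +-cong (term-form v v≉0) (listSum-nonzeros vs)
        ... | yes v≈0 = trans (listSum-nonzeros vs) (trans (sym (+-identityˡ _)) (+-congʳ (sym
          (trans (*-congʳ (trans (coordinate-linear r d j n v) (trans (ι-cong (v≈0 j n)) 0#-homo))) (zeroˡ _)))))

      -- The zero vector, absent from `truncation`, contributes 0 to the moment.
      listSum-truncation : listSum term truncation ≈ moment (basis r d z) k (coordinate r d j n)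
      listSum-truncation = trans (listSum-nonzeros (vectors D)) (listSum-vectors D form)

-- Vanishing of the determinant

open import Data.Nat.Base using (_≤_; _<_; _^_)

n<q^n : ∀ q → 2 ≤ q → ∀ n → n < q ^ n
n<q^n q 2≤q zero = s≤s z≤n
n<q^n q 2≤q (suc n) = ℕ.≤-trans (ℕ.≤-trans
  (ℕ.+-mono-≤ (ℕ.≤-trans (s≤s z≤n) (n<q^n q 2≤q n)) (n<q^n q 2≤q n))
  (ℕ.≤-reflexive (≡.cong (q ^ n ℕ.+_) (≡.sym (ℕ.+-identityʳ (q ^ n))))))
  (ℕ.*-monoˡ-≤ (q ^ n) 2≤q)

-- By the pigeonhole principle some f i is at least r; remove it and use induction.
injective-sum : ∀ q → 1 ≤ q → ∀ r (f : Fin r → ℕ) → (∀ i j → f i ≡ f j → i ≡ j) →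
  sumℕ {r} (λ i → q ^ toℕ i) ≤ sumℕ (λ i → q ^ f i)
injective-sum q 1≤q zero f inj = z≤n
injective-sum q 1≤q (suc r) f inj with Fin.any? (λ i → r ℕ.≤? f i)
... | no small = contradiction (Fin.pigeonhole (ℕ.n<1+n r) (λ i → fromℕ< (f<r i)))
  λ (i , j , i<j , e) → ℕ.<⇒≢ i<j (≡.cong toℕ (inj i j (Fin.fromℕ<-injective (f i) (f j) (f<r i) (f<r j) e)))
  where
  f<r : ∀ i → f i < r
  f<r i = ℕ.≰⇒> λ r≤ → small (i , r≤)
... | yes (i , r≤fi) = begin
  sum {suc r} (λ j → q ^ toℕ j)                  ≡⟨ sum-init-last {r} (λ j → q ^ toℕ j) ⟩
  sum {r} (λ j → q ^ toℕ (inject₁ j)) ℕ.+ q ^ toℕ (fromℕ r)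
    ≡⟨ ≡.cong₂ ℕ._+_ (sum-cong-≋ {r} λ j → ≡.cong (q ^_) (Fin.toℕ-inject₁ j)) (≡.cong (q ^_) (Fin.toℕ-fromℕ r)) ⟩
  sum {r} (λ j → q ^ toℕ j) ℕ.+ q ^ r
    ≤⟨ ℕ.+-mono-≤ (injective-sum q 1≤q r (f ∘ punchIn i) λ a b e → Fin.punchIn-injective i a b (inj _ _ e))
         (ℕ.^-monoʳ-≤ q {{ℕ.>-nonZero 1≤q}} r≤fi) ⟩
  sum {r} (λ j → q ^ f (punchIn i j)) ℕ.+ q ^ f i    ≡⟨ ℕ.+-comm _ (q ^ f i) ⟩
  q ^ f i ℕ.+ sum {r} (λ j → q ^ f (punchIn i j))    ≡⟨ sum-remove {i = i} (λ j → q ^ f j) ⟨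
  sum {suc r} (λ j → q ^ f j)                    ∎
  where
  open CommutativeMonoidSum ℕ.+-0-commutativeMonoid
  open ℕ.≤-Reasoning

sum-mono : ∀ r {f g : Fin r → ℕ} → (∀ i → f i ≤ g i) → sumℕ f ≤ sumℕ g
sum-mono zero h = z≤n
sum-mono (suc r) h = ℕ.+-mono-≤ (h zero) (sum-mono r (h ∘ suc))

-- The truncated Eisenstein series

module Truncated {c₁ ℓ₁ c ℓ} (𝔽 : FiniteField c₁ ℓ₁) (ℂ∞ : CompletedClosure 𝔽 c ℓ)
  (r : ℕ) (z : Vector (CompletedClosure.Carrier ℂ∞) r) (z∈Ω : InΩ 𝔽 ℂ∞ z) where

  private
    module K = CompletedClosure ℂ∞
    q = FiniteField.q 𝔽
    R = 𝕋-commutativeRing 𝔽 ℂ∞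
    module R = CommutativeRing R
    module KSum = SemiringSum K.semiring
    module RSum = SemiringSum R.semiring
  open FiniteFieldProperties 𝔽 using (2≤q)
  open DeterminantProperties R
  open Valuation 𝔽 ℂ∞ using (_≟_)
  open Lattice 𝔽 ℂ∞
  open LinearForms 𝔽 K.fieldStructure _≟_ K.ι K.ι-isRingHomomorphism

  module _ (d : ℕ) where
    private
      w = basis r d z

    -- This is literally a partial sum from `HasSum`, so the convergence hypothesis applies to it by
    -- computation.
    column : ℕ → Vector R.Carrier r
    column k j = List.foldr R._+_ R.0# (List.map
      (λ (a , _) → _•_ 𝔽 ℂ∞ ((pairing 𝔽 ℂ∞ z a K.⁻¹) K.^ k) (χₜ 𝔽 ℂ∞ (a j))) (truncation r d))

    private
      coefficient-foldr : ∀ {x} {X : Set x} (g : X → R.Carrier) n as →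
        proj₁ (List.foldr R._+_ R.0# (List.map g as)) n ≡ listSum (λ a → proj₁ (g a) n) as
      coefficient-foldr g n [] = ≡.refl
      coefficient-foldr g n (a ∷ as) = ≡.cong (proj₁ (g a) n K.+_) (coefficient-foldr g n as)

      coefficient-sum : ∀ m (f : Fin m → R.Carrier) n → proj₁ (RSum.sum f) n ≡ K.sum (λ i → proj₁ (f i) n)
      coefficient-sum zero f n = ≡.refl
      coefficient-sum (suc m) f n = ≡.cong (proj₁ (f zero) n K.+_) (coefficient-sum m (f ∘ suc) n)

      column-moment : ∀ k j n → proj₁ (column k j) n K.≈ moment w k (coordinate r d j n)
      column-moment k j n = K.trans (K.reflexive (coefficient-foldr _ n (truncation r d)))
        (listSum-truncation r d z k j n)

    -- The bound N stays at the original weight while the recursion lowers k, so all derivations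
    -- share one set of generators.
    Generator : ℕ → Vector R.Carrier r → Set c
    Generator N v = ∃[ l ] q ^ l ≤ N × v ≡ column (q ^ l)

    column-recursion : ∀ k → 1 ≤ k → (∀ l → k ≢ q ^ l) → ∃[ m ] Σ (Fin m → R.Carrier) λ a → Σ (Fin m → ℕ) λ κ →
      (∀ i → 1 ≤ κ i × κ i < k) × (∀ j → column k j R.≈ RSum.sum λ i → a i R.* column (κ i) j)
    column-recursion k 1≤k k≢q^ = r ℕ.* d , (λ i → constantᵀ 𝔽 ℂ∞ (weight i)) , exponent , exponent-range , λ j n →
      K.trans (column-moment k j n) (K.trans (recursion (coordinate r d j n)) (K.sym (K.trans
        (K.reflexive (coefficient-sum (r ℕ.* d) (λ i → constantᵀ 𝔽 ℂ∞ (weight i) R.* column (exponent i) j) n))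
        (KSum.sum-cong-≋ {r ℕ.* d} λ i → K.trans (constantᵀ-* 𝔽 ℂ∞ (weight i) (column (exponent i) j) n)
          (K.*-congˡ (column-moment (exponent i) j n))))))
      where open MomentRecursion w (basis-independent r d z z∈Ω) k 1≤k k≢q^

    column-span : ∀ N k → 1 ≤ k → k ≤ N → Span (Generator N) (column k)
    column-span N = <-rec _ go
      where
      go : ∀ k → (∀ {m} → m < k → 1 ≤ m → m ≤ N → Span (Generator N) (column m)) →
           1 ≤ k → k ≤ N → Span (Generator N) (column k)
      -- Since l < q^l, only l < k can give k = q^l, and the search is finite.
      go k IH 1≤k k≤N with Fin.any? {n = k} (λ l → k ℕ.≟ q ^ toℕ l)
      ... | yes (l , e) = generator (toℕ l , ≡.subst (_≤ N) e k≤N , ≡.cong column e)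
      ... | no n =
        let (m , a , κ , range , e) = column-recursion k 1≤k k≢q^ in
        span-cong e (span-sum m a (λ i → column (κ i)) λ i →
          IH (proj₂ (range i)) (proj₁ (range i)) (ℕ.≤-trans (ℕ.<⇒≤ (proj₂ (range i))) k≤N))
        where
        k≢q^ : ∀ l → k ≢ q ^ l
        k≢q^ l e = n (fromℕ< l<k , ≡.trans e (≡.cong (q ^_) (≡.sym (Fin.toℕ-fromℕ< l<k))))
          where
          l<k : l < k
          l<k = ≡.subst (l <_) (≡.sym e) (n<q^n q 2≤q l)

    colDet-columns : ∀ (k : Vector ℕ r) → (∀ j → 1 ≤ k j) → sumℕ k < sumℕ {r} (λ i → q ^ toℕ i) →
      colDet (λ j → column (k j)) R.≈ R.0#
    colDet-columns k 1≤k small = colDet-spans (λ j → Generator (k j)) generators (λ j → column (k j))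
      (λ j → column-span (k j) (k j) (1≤k j) ℕ.≤-refl)
      where
      generators : ∀ C → (∀ j → Generator (k j) (C j)) → colDet C R.≈ R.0#
      generators C g with Fin.any? (λ i → Fin.any? (λ j → ¬? (i Fin.≟ j) ×-dec (proj₁ (g i) ℕ.≟ proj₁ (g j))))
      ... | yes (i , j , i≢j , e) = colDet-alternating i j i≢j C λ a → R.reflexive (≡.cong (λ f → f a)
        (≡.trans (proj₂ (proj₂ (g i))) (≡.trans (≡.cong (λ l → column (q ^ l)) e) (≡.sym (proj₂ (proj₂ (g j)))))))
      ... | no n = contradiction (ℕ.≤-trans (injective-sum q (ℕ.<⇒≤ 2≤q) r l injective) (sum-mono r λ j → proj₁ (proj₂ (g j))))
          (ℕ.<⇒≱ small)
        where
        l : Fin r → ℕ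
        l j = proj₁ (g j)
        injective : ∀ i j → l i ≡ l j → i ≡ j
        injective i j e with i Fin.≟ j
        ... | yes p = p
        ... | no p = contradiction (i , j , p , e) n

private
  maximum : ∀ n (f : Fin n → ℕ) → ∃[ m ] ∀ i → f i ≤ m
  maximum zero f = 0 , λ ()
  maximum (suc n) f with maximum n (f ∘ suc)
  ... | m , h = f zero ℕ.⊔ m , λ { zero → ℕ.m≤m⊔n _ _ ; (suc i) → ℕ.≤-trans (h i) (ℕ.m≤n⊔m (f zero) m) }

-- Passage to the limit

module _ {c₁ ℓ₁ c ℓ} (𝔽 : FiniteField c₁ ℓ₁) (ℂ∞ : CompletedClosure 𝔽 c ℓ) (r : ℕ) where

  private
    N = nonzeroVectors 𝔽 ℂ∞ r
    open Membership N using (_∈_)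
    open Lattice 𝔽 ℂ∞ using (truncation; ∈-truncation)

  -- The truncations are cofinal among the finite subsets, so the net in `HasSum` may be followed
  -- along them. All d′ from d on are included because the columns, each with its own threshold,
  -- must share one truncation.
  truncation-exhausts : ∀ S → ∃[ d ] ∀ d′ → d ≤ d′ → ∀ {a} → a ∈ S → a ∈ truncation r d′
  truncation-exhausts [] = 0 , λ _ _ ()
  truncation-exhausts (a ∷ S) with truncation-exhausts S | maximum r (λ i → length (proj₁ a i))
  ... | d , h | m , h′ = d ℕ.⊔ m , λ d′ ≤d′ →
    λ { {b} (here e) → MembershipProperties.∈-resp-≈ N {xs = truncation r d′} {a} {b} (Setoid.sym N {b} {a} e)
          (∈-truncation r d′ a λ i → ℕ.≤-trans (h′ i) (ℕ.≤-trans (ℕ.m≤n⊔m d m) ≤d′))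
      ; {b} (there b∈) → h d′ (ℕ.≤-trans (ℕ.m≤m⊔n d m) ≤d′) {b} b∈ }

corollary4p8 : ∀ {c₁ ℓ₁ c ℓ : Level} (𝔽 : FiniteField c₁ ℓ₁) (ℂ∞ : CompletedClosure 𝔽 c ℓ) →
    let q = FiniteField.q 𝔽 in
    ∀ (r : ℕ) → 2 ≤ r →
    ∀ (k : Vector ℕ r) → (∀ j → 1 ≤ k j) → (∀ j → (q ∸ 1) ∣ (k j ∸ 1)) →
    sumℕ k < sumℕ {r} (λ i → q ^ toℕ i) →
    ∀ (z : Vector (CompletedClosure.Carrier ℂ∞) r) → InΩ 𝔽 ℂ∞ z →
    ∀ (E : Fin r → Vector (𝕋 𝔽 ℂ∞) r) → (∀ j → IsEisenstein 𝔽 ℂ∞ (k j) z (E j)) →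
    _≈ᵀ_ 𝔽 ℂ∞ (detᵀ 𝔽 ℂ∞ (λ i j → E j i)) (0ᵀ 𝔽 ℂ∞)
corollary4p8 𝔽 ℂ∞ r _ k 1≤k _ small z z∈Ω E eisenstein n = ∣x∣≤all⇒x≈0 λ e → estimate e n
  where
  module K = CompletedClosure ℂ∞
  R = 𝕋-commutativeRing 𝔽 ℂ∞
  module R = CommutativeRing R
  open Valuation 𝔽 ℂ∞ using (∣x∣≤all⇒x≈0)
  open Lattice 𝔽 ℂ∞ using (truncation; truncation-unique)
  open Truncated 𝔽 ℂ∞ r z z∈Ω
  open Estimates 𝔽 ℂ∞

  Near : ℚ → (Fin r → Fin r → R.Carrier) → Set
  Near e M = ∀ i j → ‖_‖≤q^_ 𝔽 ℂ∞ (M i j R.- E j i) e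

  limit : Fin r → Fin r → R.Carrier
  limit i j = E j i

  open Continuity R (gaussNorm 𝔽 ℂ∞) Near
    (λ {_} {_} {M} d≤e h i j → ‖‖-mono 𝔽 ℂ∞ {M i j R.- E j i} d≤e (h i j)) limit

  approximation : ∀ e → ∃[ d ] Near e (λ i j → column d (k j) i)
  approximation e = d , λ i j → proj₂ (eisenstein j e) (truncation r d) (truncation-unique r d)
    (λ {a} → proj₂ (exhausted j) d (proj₂ largest j) {a}) i
    where
    exhausted = λ j → truncation-exhausts 𝔽 ℂ∞ r (proj₁ (eisenstein j e))
    largest = maximum r (λ j → proj₁ (exhausted j))
    d = proj₁ largest

  estimate : ∀ e n → K.∣_∣≤q^_ (proj₁ (detᵀ 𝔽 ℂ∞ limit) n) e
  estimate e n =
    -- The determinant is taken as a function of the whole matrix; its entries are projections, for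
    -- which the distance e itself serves as the modulus.
    let (δ , continuous) = det-continuous r (λ i j M → M i j) (λ i j e → e , λ M h → h i j) e
        (d , near) = approximation δ
    -- The truncated determinant is 0, so the difference bounded by continuity is minus the
    -- coefficient sought.
    in ∣∣-cong (K.trans (K.-‿cong (K.trans (K.+-congʳ (colDet-columns d k 1≤k small n)) (K.+-identityˡ _)))
         (RingProperties.-‿involutive K.ring _))
         (∣-∣≤ (continuous (λ i j → column d (k j) i) near n))
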